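{- Let $0\le k\le n$ be integers with $n\ge 1$, and let $X\in G_k(\mathbb{C}^n)$. If the torus orbit closure $\overline{TX}$ is smooth, then there exist a partition $(J_1,J_2,\dots,J_r)$ of the set $[n]=\{1,\dots,n\}$ and non-negative integers $k_1,\dots,k_r$ with $k_1+\dots+k_r=k$ and $k_i\in\{0,1,|J_i|-1,|J_i|\}$ for each $i$, such that $$\overline{TX}=G_{k_1}(\mathbb{C}^{J_1})\times G_{k_2}(\mathbb{C}^{J_2})\times\cdots\times G_{k_r}(\mathbb{C}^{J_r})$$ as subvarieties of $G_k(\mathbb{C}^n)$. In particular, $\overline{TX}$ is isomorphic to a product of complex projective spaces (where a point is regarded as a projective space of dimension $0$).
   Context: For a finite-dimensional complex vector space $E$, $G_k(E)$ denotes the Grassmannian of $k$-dimensional complex linear subspaces of $E$. $T=(\mathbb{C}^*)^n$ acts on $\mathbb{C}^n$ by coordinatewise multiplication (i.e. $T$ is the group of non-singular diagonal matrices in $\mathrm{GL}(\mathbb{C}^n)$), and hence acts on $G_k(\mathbb{C}^n)$. $TX$ is the $T$-orbit of $X$ and $\overline{TX}$ is its closure in $G_k(\mathbb{C}^n)$, regarded as a (reduced) subvariety. A partition of a set is a decomposition into pairwise disjoint nonempty subsets whose union is the set. For $J\subset[n]$, $\mathbb{C}^J$ is the space of complex-valued functions on $J$. For a partition $(J_1,\dots,J_r)$ of $[n]$ we identify $\mathbb{C}^{J_1}\times\cdots\times\mathbb{C}^{J_r}$ with $\mathbb{C}^n$, and for $k_i\le|J_i|$ with $\sum_i k_i=k$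 the product $G_{k_1}(\mathbb{C}^{J_1})\times\cdots\times G_{k_r}(\mathbb{C}^{J_r})$ is regarded as a subvariety of $G_k(\mathbb{C}^n)$ via $(X_1,\dots,X_r)\mapsto X_1\oplus\cdots\oplus X_r$. -}

module Defs where

open import Algebra.Bundles using (CommutativeRing)
import Algebra.Properties.Semiring.Exp as Exp
import Algebra.Properties.AbelianGroup as AbelianGroupProperties
import Algebra.Properties.CommutativeSemigroup as CommutativeSemigroupProperties
import Algebra.Properties.Semiring.Sum as Sum
import Algebra.Properties.Ring as RingProperties
import Algebra.Solver.Ring.NaturalCoefficients.Default as NaturalCoefficients
open import Data.Bool.Base using (true; false)
open import Data.Fin.Base using (Fin; zero; suc; toℕ; inject₁; punchIn)
import Data.Fin.Properties as Fin
open import Data.Fin.Subset using (Subset; Nonempty; Empty; _∩_; ∣_∣) renaming (_∈_ to _∈ₛ_)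
open import Data.List.Base using (List; []; _∷_; foldr; length; filter)
open import Data.List.Relation.Unary.All using (All)
open import Data.Nat.Base as ℕ using (ℕ; zero; suc)
import Data.Nat.Properties as ℕ
open import Data.Product.Base using (Σ; ∃; ∃-syntax; _×_; _,_; proj₁; proj₂)
open import Data.Rational.Base as ℚ using (ℚ; 0ℚ; 1ℚ; ½)
import Data.Rational.Properties as ℚ
open import Data.Sum.Base using (_⊎_)
open import Data.Vec.Base using (_∷_)
open import Function.Bundles using (_⇔_)
open import Level using (Level; 0ℓ; _⊔_) renaming (suc to lsuc)
open import Relation.Binary.PropositionalEquality
  using (_≡_; _≢_; refl; sym; trans; cong; cong₂; subst; subst₂)
open import Relation.Unary using (Pred; _∈_; _⊆_; _⊂_; _∪_; _≐_; Satisfiable; U)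

-- Cauchy sequences of rationals; real numbers are equal when the
-- difference is a null sequence (Reals._≈_)
record ℝ : Set where
  constructor mkℝ
  field
    seq    : ℕ → ℚ
    cauchy : ∀ ε → 0ℚ ℚ.< ε →
             ∃[ N ] (∀ m n → N ℕ.≤ m → N ℕ.≤ n → ℚ.∣ seq m ℚ.- seq n ∣ ℚ.< ε)

module Reals where
  open ℝ

  infix  4 _≈_
  infixl 6 _+_
  infixl 7 _*_
  infix  8 -_

  record _≈_ (x y : ℝ) : Set where
    constructor mk≈
    field
      close : ∀ ε → 0ℚ ℚ.< ε →
              ∃[ N ] (∀ n → N ℕ.≤ n → ℚ.∣ seq x n ℚ.- seq y n ∣ ℚ.< ε)
  open _≈_ public

  private
    module ℚ+ = AbelianGroupProperties ℚ.+-0-abelianGroup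

    0<½ : 0ℚ ℚ.< ½
    0<½ = ℚ.positive⁻¹ ½

    half+half : ∀ ε → ½ ℚ.* ε ℚ.+ ½ ℚ.* ε ≡ ε
    half+half ε = trans (sym (ℚ.*-distribʳ-+ ε ½ ½)) (ℚ.*-identityˡ ε)

    half>0 : ∀ {ε} → 0ℚ ℚ.< ε → 0ℚ ℚ.< ½ ℚ.* ε
    half>0 {ε} 0<ε = subst (ℚ._< ½ ℚ.* ε) (ℚ.*-zeroʳ ½) (ℚ.*-monoʳ-<-pos ½ 0<ε)

    self-close : ∀ ε a b → a ≡ b → 0ℚ ℚ.< ε → ℚ.∣ a ℚ.- b ∣ ℚ.< ε
    self-close ε a _ refl 0<ε =
      subst (λ z → ℚ.∣ z ∣ ℚ.< ε) (sym (ℚ.+-inverseʳ a)) 0<ε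

    ∣-∣-sym : ∀ a b → ℚ.∣ a ℚ.- b ∣ ≡ ℚ.∣ b ℚ.- a ∣
    ∣-∣-sym a b = trans (sym (ℚ.∣-p∣≡∣p∣ (a ℚ.- b))) (cong ℚ.∣_∣ (ℚ+.⁻¹-anti-homo-// a b))

    sum-close : ∀ ε x y → ℚ.∣ x ∣ ℚ.< ½ ℚ.* ε → ℚ.∣ y ∣ ℚ.< ½ ℚ.* ε → ℚ.∣ x ℚ.+ y ∣ ℚ.< ε
    sum-close ε x y p q = ℚ.≤-<-trans (ℚ.∣p+q∣≤∣p∣+∣q∣ x y)
      (subst (ℚ.∣ x ∣ ℚ.+ ℚ.∣ y ∣ ℚ.<_) (half+half ε)
        (ℚ.+-mono-< {ℚ.∣ x ∣} {½ ℚ.* ε} {ℚ.∣ y ∣} {½ ℚ.* ε} p q))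

    trans-eq : ∀ a b c → a ℚ.- c ≡ (a ℚ.- b) ℚ.+ (b ℚ.- c)
    trans-eq a b c = sym (trans (ℚ.+-assoc a (ℚ.- b) (b ℚ.- c))
      (cong (a ℚ.+_) (ℚ+.\\-leftDividesʳ b (ℚ.- c))))

    add-eq : ∀ a b c d → (a ℚ.+ b) ℚ.- (c ℚ.+ d) ≡ (a ℚ.- c) ℚ.+ (b ℚ.- d)
    add-eq a b c d = trans (cong ((a ℚ.+ b) ℚ.+_) (ℚ.neg-distrib-+ c d))
      (interchange a b (ℚ.- c) (ℚ.- d))
      where open CommutativeSemigroupProperties
              (CommutativeRing.+-commutativeSemigroup ℚ.+-*-commutativeRing)

    *-distribˡ-- : ∀ a b c → a ℚ.* b ℚ.- a ℚ.* c ≡ a ℚ.* (b ℚ.- c)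
    *-distribˡ-- a b c = trans (cong (a ℚ.* b ℚ.+_) (ℚ.neg-distribʳ-* a c))
      (sym (ℚ.*-distribˡ-+ a b (ℚ.- c)))

    mul-eq : ∀ a b c d → (a ℚ.* b) ℚ.- (c ℚ.* d) ≡ a ℚ.* (b ℚ.- d) ℚ.+ d ℚ.* (a ℚ.- c)
    mul-eq a b c d = trans (trans-eq (a ℚ.* b) (a ℚ.* d) (c ℚ.* d))
      (cong₂ ℚ._+_ (*-distribˡ-- a b d)
        (trans (cong₂ ℚ._-_ (ℚ.*-comm a d) (ℚ.*-comm c d)) (*-distribˡ-- d a c)))

    trans-close : ∀ ε a b c → ℚ.∣ a ℚ.- b ∣ ℚ.< ½ ℚ.* ε → ℚ.∣ b ℚ.- c ∣ ℚ.< ½ ℚ.* ε →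
                  ℚ.∣ a ℚ.- c ∣ ℚ.< ε
    trans-close ε a b c p q = subst (λ z → ℚ.∣ z ∣ ℚ.< ε) (sym (trans-eq a b c))
      (sum-close ε (a ℚ.- b) (b ℚ.- c) p q)

    add-close : ∀ ε a b c d → ℚ.∣ a ℚ.- c ∣ ℚ.< ½ ℚ.* ε → ℚ.∣ b ℚ.- d ∣ ℚ.< ½ ℚ.* ε →
                ℚ.∣ (a ℚ.+ b) ℚ.- (c ℚ.+ d) ∣ ℚ.< ε
    add-close ε a b c d p q = subst (λ z → ℚ.∣ z ∣ ℚ.< ε) (sym (add-eq a b c d))
      (sum-close ε (a ℚ.- c) (b ℚ.- d) p q)

    neg-close : ∀ ε a b → ℚ.∣ a ℚ.- b ∣ ℚ.< ε → ℚ.∣ (ℚ.- a) ℚ.- (ℚ.- b) ∣ ℚ.< ε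
    neg-close ε a b = subst (ℚ._< ε)
      (trans (sym (ℚ.∣-p∣≡∣p∣ (a ℚ.- b))) (cong ℚ.∣_∣ (ℚ.neg-distrib-+ a (ℚ.- b))))

    -- ε / 2B, the precision needed of the factors of a product bounded by B
    δ : ∀ B → 0ℚ ℚ.< B → ℚ → ℚ
    δ B 0<B ε = (ℚ.1/ B) {{ℚ.pos⇒nonZero B {{ℚ.positive 0<B}}}} ℚ.* (½ ℚ.* ε)

    δ>0 : ∀ B (0<B : 0ℚ ℚ.< B) {ε} → 0ℚ ℚ.< ε → 0ℚ ℚ.< δ B 0<B ε
    δ>0 B 0<B {ε} 0<ε = subst (ℚ._< δ B 0<B ε) (ℚ.*-zeroʳ B⁻¹)
      (ℚ.*-monoʳ-<-pos B⁻¹ {{ℚ.1/pos⇒pos B {{ℚ.positive 0<B}}}} (half>0 0<ε))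
      where B⁻¹ = (ℚ.1/ B) {{ℚ.pos⇒nonZero B {{ℚ.positive 0<B}}}}

    scale : ∀ B (0<B : 0ℚ ℚ.< B) ε a x → ℚ.∣ a ∣ ℚ.< B → ℚ.∣ x ∣ ℚ.< δ B 0<B ε →
            ℚ.∣ a ℚ.* x ∣ ℚ.< ½ ℚ.* ε
    scale B 0<B ε a x a<B x<δ = subst₂ ℚ._<_ (sym (ℚ.∣p*q∣≡∣p∣*∣q∣ a x)) Bδ
      (ℚ.≤-<-trans
        (ℚ.*-monoʳ-≤-nonNeg ℚ.∣ x ∣ {{ℚ.∣-∣-nonNeg x}} (ℚ.<⇒≤ a<B))
        (ℚ.*-monoʳ-<-pos B {{ℚ.positive 0<B}} x<δ))
      where
      instance _ = ℚ.pos⇒nonZero B {{ℚ.positive 0<B}}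
      Bδ : B ℚ.* (ℚ.1/ B ℚ.* (½ ℚ.* ε)) ≡ ½ ℚ.* ε
      Bδ = trans (sym (ℚ.*-assoc B (ℚ.1/ B) (½ ℚ.* ε)))
        (trans (cong (ℚ._* (½ ℚ.* ε)) (ℚ.*-inverseʳ B)) (ℚ.*-identityˡ (½ ℚ.* ε)))

    mul-close : ∀ B (0<B : 0ℚ ℚ.< B) ε a b c d → ℚ.∣ a ∣ ℚ.< B → ℚ.∣ d ∣ ℚ.< B →
                ℚ.∣ a ℚ.- c ∣ ℚ.< δ B 0<B ε → ℚ.∣ b ℚ.- d ∣ ℚ.< δ B 0<B ε →
                ℚ.∣ (a ℚ.* b) ℚ.- (c ℚ.* d) ∣ ℚ.< ε
    mul-close B 0<B ε a b c d a<B d<B p q = subst (λ z → ℚ.∣ z ∣ ℚ.< ε) (sym (mul-eq a b c d))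
      (sum-close ε (a ℚ.* (b ℚ.- d)) (d ℚ.* (a ℚ.- c))
        (scale B 0<B ε a (b ℚ.- d) a<B q) (scale B 0<B ε d (a ℚ.- c) d<B p))

    <-+ʳ : ∀ {p} b c → p ℚ.< b → 0ℚ ℚ.< c → p ℚ.< b ℚ.+ c
    <-+ʳ {p} b c p<b 0<c = subst (ℚ._< b ℚ.+ c) (ℚ.+-identityʳ p) (ℚ.+-mono-< {p} {b} {0ℚ} {c} p<b 0<c)

    Bounded : (ℕ → ℚ) → ℚ → ℕ → Set
    Bounded s B N = ∀ n → N ℕ.≤ n → ℚ.∣ s n ∣ ℚ.< B

    bounded : ∀ x → ∃[ B ] ∃[ N ] (0ℚ ℚ.< B × Bounded (seq x) B N)
    bounded x with cauchy x 1ℚ (ℚ.positive⁻¹ 1ℚ)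
    ... | N , close = B , N , 0<B , below
      where
      s = seq x
      B = ℚ.∣ s N ∣ ℚ.+ 1ℚ
      0<B : 0ℚ ℚ.< B
      0<B = ℚ.+-mono-≤-< (ℚ.nonNegative⁻¹ ℚ.∣ s N ∣ {{ℚ.∣-∣-nonNeg (s N)}}) (ℚ.positive⁻¹ 1ℚ)
      split : ∀ a b → a ≡ b ℚ.+ (a ℚ.- b)
      split a b = trans (sym (ℚ+.xyx⁻¹≈y b a)) (ℚ.+-assoc b a (ℚ.- b))
      below : Bounded s B N
      below n N≤n = ℚ.≤-<-trans
        (subst (λ z → ℚ.∣ z ∣ ℚ.≤ ℚ.∣ s N ∣ ℚ.+ ℚ.∣ s n ℚ.- s N ∣) (sym (split (s n) (s N)))
          (ℚ.∣p+q∣≤∣p∣+∣q∣ (s N) (s n ℚ.- s N)))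
        (ℚ.+-monoʳ-< ℚ.∣ s N ∣ (close n N N≤n ℕ.≤-refl))

    bounded₂ : ∀ x y → ∃[ B ] ∃[ N ] (0ℚ ℚ.< B × Bounded (seq x) B N × Bounded (seq y) B N)
    bounded₂ x y = common (seq x) (seq y) (bounded x) (bounded y)
      where
      common : ∀ s t → ∃[ B ] ∃[ N ] (0ℚ ℚ.< B × Bounded s B N) →
               ∃[ B ] ∃[ N ] (0ℚ ℚ.< B × Bounded t B N) →
               ∃[ B ] ∃[ N ] (0ℚ ℚ.< B × Bounded s B N × Bounded t B N)
      common s t (B₁ , N₁ , 0<B₁ , b₁) (B₂ , N₂ , 0<B₂ , b₂) =
        B₁ ℚ.+ B₂ , N₁ ℕ.⊔ N₂ , <-+ʳ B₁ B₂ 0<B₁ 0<B₂ ,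
        (λ n N≤n → <-+ʳ B₁ B₂ (b₁ n (ℕ.m⊔n≤o⇒m≤o N₁ N₂ N≤n)) 0<B₂) ,
        (λ n N≤n → subst (ℚ.∣ t n ∣ ℚ.<_) (ℚ.+-comm B₂ B₁)
          (<-+ʳ B₂ B₁ (b₂ n (ℕ.m⊔n≤o⇒n≤o N₁ N₂ N≤n)) 0<B₁))

  fromℚ : ℚ → ℝ
  fromℚ q = mkℝ (λ _ → q) λ ε 0<ε → 0 , λ _ _ _ _ → self-close ε q q refl 0<ε

  0ℝ 1ℝ : ℝ
  0ℝ = fromℚ 0ℚ
  1ℝ = fromℚ 1ℚ

  _+_ : ℝ → ℝ → ℝ
  seq (x + y) n = seq x n ℚ.+ seq y n
  cauchy (x + y) ε 0<ε with cauchy x (½ ℚ.* ε) (half>0 0<ε) | cauchy y (½ ℚ.* ε) (half>0 0<ε)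
  ... | M , p | N , q = M ℕ.⊔ N , λ m n ≤m ≤n →
    add-close ε (seq x m) (seq y m) (seq x n) (seq y n)
      (p m n (ℕ.m⊔n≤o⇒m≤o M N ≤m) (ℕ.m⊔n≤o⇒m≤o M N ≤n))
      (q m n (ℕ.m⊔n≤o⇒n≤o M N ≤m) (ℕ.m⊔n≤o⇒n≤o M N ≤n))

  -_ : ℝ → ℝ
  seq (- x) n = ℚ.- seq x n
  cauchy (- x) ε 0<ε with cauchy x ε 0<ε
  ... | N , p = N , λ m n ≤m ≤n → neg-close ε (seq x m) (seq x n) (p m n ≤m ≤n)

  _*_ : ℝ → ℝ → ℝ
  seq (x * y) n = seq x n ℚ.* seq y n
  cauchy (x * y) ε 0<ε = combine (bounded₂ x y)
    where
    combine : ∃[ B ] ∃[ N ] (0ℚ ℚ.< B × Bounded (seq x) B N × Bounded (seq y) B N) → _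
    combine (B , K , 0<B , bx , by)
      with cauchy x (δ B 0<B ε) (δ>0 B 0<B 0<ε) | cauchy y (δ B 0<B ε) (δ>0 B 0<B 0<ε)
    ... | M , p | N , q = K ℕ.⊔ (M ℕ.⊔ N) , λ m n ≤m ≤n →
      let ≤m′ = ℕ.m⊔n≤o⇒n≤o K (M ℕ.⊔ N) ≤m
          ≤n′ = ℕ.m⊔n≤o⇒n≤o K (M ℕ.⊔ N) ≤n
      in mul-close B 0<B ε (seq x m) (seq y m) (seq x n) (seq y n)
           (bx m (ℕ.m⊔n≤o⇒m≤o K (M ℕ.⊔ N) ≤m)) (by n (ℕ.m⊔n≤o⇒m≤o K (M ℕ.⊔ N) ≤n))
           (p m n (ℕ.m⊔n≤o⇒m≤o M N ≤m′) (ℕ.m⊔n≤o⇒m≤o M N ≤n′))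
           (q m n (ℕ.m⊔n≤o⇒n≤o M N ≤m′) (ℕ.m⊔n≤o⇒n≤o M N ≤n′))

  private
    pointwise : ∀ {x y} → (∀ n → seq x n ≡ seq y n) → x ≈ y
    pointwise {x} {y} e = mk≈ λ ε 0<ε → 0 , λ n _ → self-close ε (seq x n) (seq y n) (e n) 0<ε

    ≈-sym : ∀ {x y} → x ≈ y → y ≈ x
    close (≈-sym {x} {y} p) ε 0<ε with close p ε 0<ε
    ... | N , q = N , λ n ≤n → subst (ℚ._< ε) (∣-∣-sym (seq x n) (seq y n)) (q n ≤n)

    ≈-trans : ∀ {x y z} → x ≈ y → y ≈ z → x ≈ z
    close (≈-trans {x} {y} {z} p q) ε 0<ε with close p (½ ℚ.* ε) (half>0 0<ε) | close q (½ ℚ.* ε) (half>0 0<ε)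
    ... | M , p′ | N , q′ = M ℕ.⊔ N , λ n ≤n →
      trans-close ε (seq x n) (seq y n) (seq z n)
        (p′ n (ℕ.m⊔n≤o⇒m≤o M N ≤n)) (q′ n (ℕ.m⊔n≤o⇒n≤o M N ≤n))

    +-cong : ∀ {x x′ y y′} → x ≈ x′ → y ≈ y′ → x + y ≈ x′ + y′
    close (+-cong {x} {x′} {y} {y′} p q) ε 0<ε with close p (½ ℚ.* ε) (half>0 0<ε) | close q (½ ℚ.* ε) (half>0 0<ε)
    ... | M , p′ | N , q′ = M ℕ.⊔ N , λ n ≤n →
      add-close ε (seq x n) (seq y n) (seq x′ n) (seq y′ n)
        (p′ n (ℕ.m⊔n≤o⇒m≤o M N ≤n)) (q′ n (ℕ.m⊔n≤o⇒n≤o M N ≤n))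

    -‿cong : ∀ {x y} → x ≈ y → - x ≈ - y
    close (-‿cong {x} {y} p) ε 0<ε with close p ε 0<ε
    ... | N , q = N , λ n ≤n → neg-close ε (seq x n) (seq y n) (q n ≤n)

    *-cong : ∀ {x x′ y y′} → x ≈ x′ → y ≈ y′ → x * y ≈ x′ * y′
    close (*-cong {x} {x′} {y} {y′} p q) ε 0<ε = combine (bounded₂ x y′)
      where
      combine : ∃[ B ] ∃[ N ] (0ℚ ℚ.< B × Bounded (seq x) B N × Bounded (seq y′) B N) → _
      combine (B , K , 0<B , bx , by)
        with close p (δ B 0<B ε) (δ>0 B 0<B 0<ε) | close q (δ B 0<B ε) (δ>0 B 0<B 0<ε)
      ... | M , p′ | N , q′ = K ℕ.⊔ (M ℕ.⊔ N) , λ n ≤n →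
        let ≤n′ = ℕ.m⊔n≤o⇒n≤o K (M ℕ.⊔ N) ≤n
            ≤K  = ℕ.m⊔n≤o⇒m≤o K (M ℕ.⊔ N) ≤n
        in mul-close B 0<B ε (seq x n) (seq y n) (seq x′ n) (seq y′ n) (bx n ≤K) (by n ≤K)
             (p′ n (ℕ.m⊔n≤o⇒m≤o M N ≤n′)) (q′ n (ℕ.m⊔n≤o⇒n≤o M N ≤n′))

  commutativeRing : CommutativeRing 0ℓ 0ℓ
  commutativeRing = record
    { Carrier = ℝ ; _≈_ = _≈_ ; _+_ = _+_ ; _*_ = _*_ ; -_ = -_ ; 0# = 0ℝ ; 1# = 1ℝ
    ; isCommutativeRing = record
      { isRing = record
        { +-isAbelianGroup = record
          { isGroup = record
            { isMonoid = record
              { isSemigroup = record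
                { isMagma = record
                  { isEquivalence = record
                    { refl  = pointwise (λ _ → refl)
                    ; sym   = ≈-sym
                    ; trans = ≈-trans }
                  ; ∙-cong = +-cong }
                ; assoc = λ x y z → pointwise
                    (λ n → ℚ.+-assoc (seq x n) (seq y n) (seq z n)) }
              ; identity = (λ x → pointwise (λ n → ℚ.+-identityˡ (seq x n)))
                         , (λ x → pointwise (λ n → ℚ.+-identityʳ (seq x n))) }
            ; inverse = (λ x → pointwise (λ n → ℚ.+-inverseˡ (seq x n)))
                      , (λ x → pointwise (λ n → ℚ.+-inverseʳ (seq x n)))
            ; ⁻¹-cong = -‿cong }
          ; comm = λ x y → pointwise (λ n → ℚ.+-comm (seq x n) (seq y n)) }
        ; *-cong = *-cong
        ; *-assoc = λ x y z → pointwise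
            (λ n → ℚ.*-assoc (seq x n) (seq y n) (seq z n))
        ; *-identity = (λ x → pointwise (λ n → ℚ.*-identityˡ (seq x n)))
                     , (λ x → pointwise (λ n → ℚ.*-identityʳ (seq x n)))
        ; distrib = (λ x y z → pointwise
                      (λ n → ℚ.*-distribˡ-+ (seq x n) (seq y n) (seq z n)))
                  , (λ x y z → pointwise
                      (λ n → ℚ.*-distribʳ-+ (seq x n) (seq y n) (seq z n))) }
      ; *-comm = λ x y → pointwise (λ n → ℚ.*-comm (seq x n) (seq y n)) } }

-- K[i] = K[x] / (x² + 1)
module Gaussian (K : CommutativeRing 0ℓ 0ℓ) where
  private module R = CommutativeRing K
  open R using (0#; 1#; _+_; _*_; -_; _-_; _≈_)

  record Carrier : Set where
    constructor _+i_
    field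
      re im : R.Carrier

  open Carrier public

  record _≈ᶜ_ (x y : Carrier) : Set where
    constructor _,_
    field
      re≈ : re x R.≈ re y
      im≈ : im x R.≈ im y

  infix  4 _≈ᶜ_
  infixl 6 _+ᶜ_
  infixl 7 _*ᶜ_
  infix  8 -ᶜ_

  _+ᶜ_ _*ᶜ_ : Carrier → Carrier → Carrier
  (a +i b) +ᶜ (c +i d) = (a + c) +i (b + d)
  (a +i b) *ᶜ (c +i d) = (a * c - b * d) +i (a * d + b * c)

  -ᶜ_ : Carrier → Carrier
  -ᶜ (a +i b) = (- a) +i (- b)

  private
    open NaturalCoefficients R.commutativeSemiring
    open RingProperties R.ring using (-1*x≈-x; -0#≈0#)

    assoc-re : ∀ n a b c d e f →
      (a * c + n * (b * d)) * e + n * ((a * d + b * c) * f) ≈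
      a * (c * e + n * (d * f)) + n * (b * (c * f + d * e))
    assoc-re = solve 7 (λ n a b c d e f →
      (a :* c :+ n :* (b :* d)) :* e :+ n :* ((a :* d :+ b :* c) :* f) :=
      a :* (c :* e :+ n :* (d :* f)) :+ n :* (b :* (c :* f :+ d :* e))) R.refl

    assoc-im : ∀ n a b c d e f →
      (a * c + n * (b * d)) * f + (a * d + b * c) * e ≈
      a * (c * f + d * e) + b * (c * e + n * (d * f))
    assoc-im = solve 7 (λ n a b c d e f →
      (a :* c :+ n :* (b :* d)) :* f :+ (a :* d :+ b :* c) :* e :=
      a :* (c :* f :+ d :* e) :+ b :* (c :* e :+ n :* (d :* f))) R.refl

    distrib-re : ∀ n a b c d e f →
      a * (c + e) + n * (b * (d + f)) ≈ (a * c + n * (b * d)) + (a * e + n * (b * f))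
    distrib-re = solve 7 (λ n a b c d e f →
      a :* (c :+ e) :+ n :* (b :* (d :+ f)) :=
      (a :* c :+ n :* (b :* d)) :+ (a :* e :+ n :* (b :* f))) R.refl

    distrib-im : ∀ a b c d e f →
      a * (d + f) + b * (c + e) ≈ (a * d + b * c) + (a * f + b * e)
    distrib-im = solve 6 (λ a b c d e f →
      a :* (d :+ f) :+ b :* (c :+ e) := (a :* d :+ b :* c) :+ (a :* f :+ b :* e)) R.refl

    ≈ᶜ-trans : ∀ {x y z} → x ≈ᶜ y → y ≈ᶜ z → x ≈ᶜ z
    ≈ᶜ-trans (p , q) (p′ , q′) = R.trans p p′ , R.trans q q′

    +ᶜ-cong : ∀ {x x′ y y′} → x ≈ᶜ x′ → y ≈ᶜ y′ → x +ᶜ y ≈ᶜ x′ +ᶜ y′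
    +ᶜ-cong (p , q) (p′ , q′) = R.+-cong p p′ , R.+-cong q q′

    *ᶜ-comm : ∀ x y → x *ᶜ y ≈ᶜ y *ᶜ x
    *ᶜ-comm (a +i b) (c +i d) =
      R.+-cong (R.*-comm a c) (R.-‿cong (R.*-comm b d)) ,
      R.trans (R.+-comm (a * d) (b * c)) (R.+-cong (R.*-comm b c) (R.*-comm a d))

    n : R.Carrier
    n = - 1#

    minus : ∀ p q → p - q ≈ p + n * q
    minus p q = R.+-congˡ (R.sym (-1*x≈-x q))

    one-times : ∀ x → (1# +i 0#) *ᶜ x ≈ᶜ x
    one-times (a +i b) =
      R.trans (R.+-cong (R.*-identityˡ a) (R.trans (R.-‿cong (R.zeroˡ b)) -0#≈0#)) (R.+-identityʳ a) ,
      R.trans (R.+-cong (R.*-identityˡ b) (R.zeroˡ a)) (R.+-identityʳ b)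

    distribˡ : ∀ x y z → x *ᶜ (y +ᶜ z) ≈ᶜ x *ᶜ y +ᶜ x *ᶜ z
    distribˡ (a +i b) (c +i d) (e +i f) =
      R.trans (minus _ _) (R.trans (distrib-re n a b c d e f)
        (R.sym (R.+-cong (minus _ _) (minus _ _)))) ,
      distrib-im a b c d e f

  commutativeRing : CommutativeRing 0ℓ 0ℓ
  commutativeRing = record
    { Carrier = Carrier ; _≈_ = _≈ᶜ_ ; _+_ = _+ᶜ_ ; _*_ = _*ᶜ_ ; -_ = -ᶜ_
    ; 0# = 0# +i 0# ; 1# = 1# +i 0#
    ; isCommutativeRing = record
      { isRing = record
        { +-isAbelianGroup = record
          { isGroup = record
            { isMonoid = record
              { isSemigroup = record
                { isMagma = record
                  { isEquivalence = record
                    { refl  = R.refl , R.refl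
                    ; sym   = λ (p , q) → R.sym p , R.sym q
                    ; trans = ≈ᶜ-trans }
                  ; ∙-cong = +ᶜ-cong }
                ; assoc = λ x y z → R.+-assoc (re x) (re y) (re z) , R.+-assoc (im x) (im y) (im z) }
              ; identity = (λ x → R.+-identityˡ (re x) , R.+-identityˡ (im x))
                         , (λ x → R.+-identityʳ (re x) , R.+-identityʳ (im x)) }
            ; inverse = (λ x → R.-‿inverseˡ (re x) , R.-‿inverseˡ (im x))
                      , (λ x → R.-‿inverseʳ (re x) , R.-‿inverseʳ (im x))
            ; ⁻¹-cong = λ (p , q) → R.-‿cong p , R.-‿cong q }
          ; comm = λ x y → R.+-comm (re x) (re y) , R.+-comm (im x) (im y) }
        ; *-cong = λ (p , q) (p′ , q′) →
            R.+-cong (R.*-cong p p′) (R.-‿cong (R.*-cong q q′)) ,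
            R.+-cong (R.*-cong p q′) (R.*-cong q p′)
        ; *-assoc = λ (a +i b) (c +i d) (e +i f) →
            R.trans (R.trans (minus _ _) (R.+-congʳ (R.*-congʳ (minus _ _))))
              (R.trans (assoc-re n a b c d e f)
                (R.sym (R.trans (minus _ _) (R.+-congʳ (R.*-congˡ (minus _ _)))))) ,
            R.trans (R.+-congʳ (R.*-congʳ (minus _ _)))
              (R.trans (assoc-im n a b c d e f) (R.sym (R.+-congˡ (R.*-congˡ (minus _ _)))))
        ; *-identity = (λ x → one-times x) , (λ x → ≈ᶜ-trans (*ᶜ-comm x (1# +i 0#)) (one-times x))
        ; distrib = distribˡ , λ x y z →
            ≈ᶜ-trans (*ᶜ-comm (y +ᶜ z) x) (≈ᶜ-trans (distribˡ x y z)
              (+ᶜ-cong (*ᶜ-comm x y) (*ᶜ-comm x z))) }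
      ; *-comm = *ᶜ-comm } }

ℂ : CommutativeRing 0ℓ 0ℓ
ℂ = Gaussian.commutativeRing Reals.commutativeRing

module Geometry (K : CommutativeRing 0ℓ 0ℓ) where
  open CommutativeRing K
    using (_≈_; _≉_; _+_; _*_; -_; 0#; 1#; semiring) renaming (Carrier to 𝕂)
  open Sum semiring using (sum)
  open Exp semiring using (_^_)

  infix 4 _≋_ _∝_

  _≋_ : {ι : Set} → (ι → 𝕂) → (ι → 𝕂) → Set
  u ≋ v = ∀ i → u i ≈ v i

  _∝_ : {ι : Set} → (ι → 𝕂) → (ι → 𝕂) → Set
  u ∝ v = ∃[ c ] (c ≉ 0# × u ≋ (λ i → c * v i))

  combination : {ι : Set} {d : ℕ} → (Fin d → 𝕂) → (Fin d → ι → 𝕂) → ι → 𝕂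
  combination c b i = sum (λ j → c j * b j i)

  -- W is a linear subspace of dimension d
  record HasDimension {ℓ : Level} {ι : Set} (W : Pred (ι → 𝕂) ℓ) (d : ℕ) : Set ℓ where
    field
      basis       : Fin d → ι → 𝕂
      independent : ∀ c → combination c basis ≋ (λ _ → 0#) → ∀ j → c j ≈ 0#
      spans       : ∀ v → v ∈ W ⇔ (∃[ c ] v ≋ combination c basis)

  det : {n : ℕ} → (Fin n → Fin n → 𝕂) → 𝕂
  det {zero}  A = 1#
  det {suc n} A =
    sum (λ j → (- 1#) ^ toℕ j * (A zero j * det (λ p q → A (suc p) (punchIn j q))))

  -- Points of ∏ₐ ℙ(𝕂^(I a)).  Points are compared with _∼_, which V S and
  -- Plücker Z below respect when 𝕂 is a field.
  record Point {r : ℕ} (I : Fin r → Set) : Set where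
    field
      coords  : ∀ a → I a → 𝕂
      nonzero : ∀ a → ∃[ i ] coords a i ≉ 0#
  open Point public

  infix 4 _∼_

  _∼_ : {r : ℕ} {I : Fin r → Set} → Point I → Point I → Set
  x ∼ y = ∀ a → coords x a ∝ coords y a

  ℙ : Set → Set
  ℙ ι = Point {1} (λ _ → ι)

  Var : {r : ℕ} → (Fin r → Set) → Set
  Var {r} I = Σ (Fin r) I

  -- A monomial is the list of its variables, with multiplicity.
  Monomial : {r : ℕ} → (Fin r → Set) → Set
  Monomial I = List (Var I)

  Poly : {r : ℕ} → (Fin r → Set) → Set
  Poly I = List (𝕂 × Monomial I)

  evalMonomial : {r : ℕ} {I : Fin r → Set} → Monomial I → (∀ a → I a → 𝕂) → 𝕂
  evalMonomial m x = foldr (λ (a , i) z → x a i * z) 1# m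

  eval : {r : ℕ} {I : Fin r → Set} → Poly I → (∀ a → I a → 𝕂) → 𝕂
  eval f x = foldr (λ (c , m) z → c * evalMonomial m x + z) 0# f

  -- The differential at x, applied to the tangent vector v
  diffMonomial : {r : ℕ} {I : Fin r → Set} → Monomial I → (x v : ∀ a → I a → 𝕂) → 𝕂
  diffMonomial []            x v = 0#
  diffMonomial ((a , i) ∷ m) x v = v a i * evalMonomial m x + x a i * diffMonomial m x v

  diff : {r : ℕ} {I : Fin r → Set} → Poly I → (x v : ∀ a → I a → 𝕂) → 𝕂
  diff f x v = foldr (λ (c , m) z → c * diffMonomial m x v + z) 0# f

  multidegree : {r : ℕ} {I : Fin r → Set} → Monomial I → Fin r → ℕ
  multidegree m a = length (filter (λ x → proj₁ x Fin.≟ a) m)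

  Homogeneous : {r : ℕ} {I : Fin r → Set} → (Fin r → ℕ) → Poly I → Set
  Homogeneous d f = All (λ (_ , m) → ∀ a → multidegree m a ≡ d a) f

  record Form {r : ℕ} (I : Fin r → Set) : Set where
    field
      degree      : Fin r → ℕ
      poly        : Poly I
      homogeneous : Homogeneous degree poly
  open Form public

  V : {r : ℕ} {I : Fin r → Set} → Pred (Form I) 0ℓ → Pred (Point I) 0ℓ
  V S p = ∀ f → f ∈ S → eval (poly f) (coords p) ≈ 0#

  Irreducible : {r : ℕ} {I : Fin r → Set} → Pred (Point I) 0ℓ → Set₁
  Irreducible Z = Satisfiable Z ×
    (∀ S T → Z ⊆ V S ∪ V T → Z ⊆ V S ⊎ Z ⊆ V T)

  -- Z₀ ⊂ Z₁ ⊂ … ⊂ Z_d ⊆ Z with every Zᵢ closed and irreducible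
  Chain : {ℓ : Level} {r : ℕ} {I : Fin r → Set} → Pred (Point I) ℓ → ℕ → Set (lsuc 0ℓ ⊔ ℓ)
  Chain {I = I} Z d = Σ (Fin (suc d) → Pred (Form I) 0ℓ) λ S →
    (∀ i → Irreducible (V (S i))) ×
    (∀ (i : Fin d) → V (S (inject₁ i)) ⊂ V (S (suc i))) ×
    (∀ i → V (S i) ⊆ Z)

  HasKrullDimension : {ℓ : Level} {r : ℕ} {I : Fin r → Set} →
    Pred (Point I) ℓ → ℕ → Set (lsuc 0ℓ ⊔ ℓ)
  HasKrullDimension Z d = Chain Z d × (∀ e → Chain Z e → e ℕ.≤ d)

  -- The tangent space at p of the affine cone over Z, cut out by the
  -- differentials of all forms vanishing on Z (Z carries its reduced structure).
  ConeTangentSpace : {ℓ : Level} {ι : Set} → Pred (ℙ ι) ℓ → ℙ ι → Pred (ι → 𝕂) ℓ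
  ConeTangentSpace {ι = ι} Z p v = (f : Form {1} (λ _ → ι)) →
    (∀ q → q ∈ Z → eval (poly f) (coords q) ≈ 0#) →
    diff (poly f) (coords p) (λ _ → v) ≈ 0#

  -- For a closed irreducible Z: its tangent spaces all have dimension dim Z,
  -- which is one less than the dimension of those of the cone.
  Smooth : {ℓ : Level} {ι : Set} → Pred (ℙ ι) ℓ → Set (lsuc 0ℓ ⊔ ℓ)
  Smooth Z = ∃[ d ] (HasKrullDimension Z d ×
    (∀ p → p ∈ Z → HasDimension (ConeTangentSpace Z p) (suc d)))

  -- Each component of φ is given, near every point, by forms of the same
  -- multidegree without common zero.  (The neighbourhood is where some F j is
  -- nonzero; a smaller basic open {h ≠ 0} is obtained by multiplying F by h.)
  -- Over a field such a φ respects _∼_.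
  Regular : {ℓ : Level} {r s : ℕ} {I : Fin r → Set} {J : Fin s → Set}
    (Z : Pred (Point I) ℓ) → (∃ Z → Point J) → Set ℓ
  Regular {r = r} {I = I} {J} Z φ = ∀ (p : ∃ Z) b →
    Σ (Fin r → ℕ) λ d → Σ (J b → Poly I) λ F →
      (∀ j → Homogeneous d (F j)) ×
      (∃[ j ] eval (F j) (coords (proj₁ p)) ≉ 0#) ×
      (∀ (q : ∃ Z) → (∃[ j ] eval (F j) (coords (proj₁ q)) ≉ 0#) →
        coords (φ q) b ∝ (λ j → eval (F j) (coords (proj₁ q))))

  record _≅_ {ℓ ℓ′ : Level} {r s : ℕ} {I : Fin r → Set} {J : Fin s → Set}
    (Z : Pred (Point I) ℓ) (W : Pred (Point J) ℓ′) : Set (ℓ ⊔ ℓ′) where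
    field
      to           : ∃ Z → ∃ W
      from         : ∃ W → ∃ Z
      to-regular   : Regular Z (λ p → proj₁ (to p))
      from-regular : Regular W (λ q → proj₁ (from q))
      from∘to      : ∀ p → proj₁ (from (to p)) ∼ proj₁ p
      to∘from      : ∀ q → proj₁ (to (from q)) ∼ proj₁ q

  -- ℙ^(m 0) × … × ℙ^(m (s - 1))
  ProjectiveSpaces : {s : ℕ} (m : Fin s → ℕ) → Pred (Point (λ a → Fin (suc (m a)))) 0ℓ
  ProjectiveSpaces m = U

  record Gr (k : ℕ) (ι : Set) : Set₁ where
    field
      subspace  : Pred (ι → 𝕂) 0ℓ
      dimension : HasDimension subspace k
    open HasDimension dimension public using (basis)
  open Gr public

  KSubset : ℕ → ℕ → Set
  KSubset k n = Σ (Subset n) λ S → ∣ S ∣ ≡ k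

  elements : {n : ℕ} (S : Subset n) → Fin ∣ S ∣ → Fin n
  elements (true  ∷ S) zero    = zero
  elements (true  ∷ S) (suc j) = suc (elements S j)
  elements (false ∷ S) j       = suc (elements S j)

  -- The Plücker coordinates of a subspace, computed in the given basis
  plücker : {k n : ℕ} → Gr k (Fin n) → KSubset k n → 𝕂
  plücker Y (S , refl) = det (λ i j → basis Y i (elements S j))

  -- The image of Z ⊆ G_k(𝕂ⁿ) under the Plücker embedding
  Plücker : {ℓ : Level} {k n : ℕ} → Pred (Gr k (Fin n)) ℓ → Pred (ℙ (KSubset k n)) (lsuc 0ℓ ⊔ ℓ)
  Plücker Z p = ∃[ Y ] (Y ∈ Z × coords p zero ∝ plücker Y)

  -- The Zariski closure; the closed subsets of G_k(𝕂ⁿ) are cut out by forms in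
  -- the Plücker coordinates.
  Closure : {ℓ : Level} {k n : ℕ} → Pred (Gr k (Fin n)) ℓ → Pred (Gr k (Fin n)) (lsuc 0ℓ ⊔ ℓ)
  Closure {k = k} {n} Z Y = (f : Form {1} (λ _ → KSubset k n)) →
    (∀ Y′ → Y′ ∈ Z → eval (poly f) (λ _ → plücker Y′) ≈ 0#) →
    eval (poly f) (λ _ → plücker Y) ≈ 0#

  Torus : ℕ → Set
  Torus n = Σ (Fin n → 𝕂) λ t → ∀ i → t i ≉ 0#

  _·_ : {k n : ℕ} → Torus n → Gr k (Fin n) → Pred (Fin n → 𝕂) 0ℓ
  (t · X) v = ∃[ x ] (x ∈ subspace X × v ≋ (λ i → proj₁ t i * x i))

  Orbit : {k n : ℕ} → Gr k (Fin n) → Pred (Gr k (Fin n)) 0ℓ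
  Orbit X Y = ∃[ t ] subspace Y ≐ (t · X)

  OrbitClosure : {k n : ℕ} → Gr k (Fin n) → Pred (Gr k (Fin n)) (lsuc 0ℓ)
  OrbitClosure X = Closure (Orbit X)

  Elements : {n : ℕ} → Subset n → Set
  Elements J = ∃[ x ] x ∈ₛ J

  restrict : {n : ℕ} (J : Subset n) → (Fin n → 𝕂) → Elements J → 𝕂
  restrict J v (x , _) = v x

  _isDirectSumOf_ : {k n r : ℕ} {J : Fin r → Subset n} {κ : Fin r → ℕ} →
    Gr k (Fin n) → (∀ i → Gr (κ i) (Elements (J i))) → Set
  _isDirectSumOf_ {J = J} Y Xs = ∀ v → v ∈ subspace Y ⇔ (∀ i → restrict (J i) v ∈ subspace (Xs i))

  ProductOfGrassmannians : {k n r : ℕ} (J : Fin r → Subset n) (κ : Fin r → ℕ) →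
    Pred (Gr k (Fin n)) (lsuc 0ℓ)
  ProductOfGrassmannians J κ Y =
    Σ (∀ i → Gr (κ i) (Elements (J i))) λ Xs → Y isDirectSumOf Xs

record IsPartition {n r : ℕ} (J : Fin r → Subset n) : Set where
  field
    nonempty : ∀ i → Nonempty (J i)
    disjoint : ∀ i j → i ≢ j → Empty (J i ∩ J j)
    covers   : ∀ x → ∃[ i ] x ∈ₛ J i

open Geometry ℂ public

{-# OPTIONS --safe #-}

-- At the torus-fixed point of the orbit closure attached to a basis B of X, the
-- tangent space of the cone contains the point itself and one direction for every
-- edge i — j, that is, every nonzero entry (i ∈ B, j ∉ B) of the matrix of X reduced
-- at B.  At the point X the binomial relations between the Plücker coordinates show
-- that a tangent vector is determined by its coordinates at B and at the edges, and
-- that one edge of a four-cycle is superfluous.  On a smooth variety both tangent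
-- spaces have the same dimension, so there are no four-cycles at any basis; pivoting
-- then rules out paths of length three, and the edges form a disjoint union of stars.
-- On a star with center in B (outside B), X is a line (a hyperplane) all of whose
-- coordinates (coefficients) are nonzero.  The torus acts transitively on such spaces,
-- and as it is dense the closure of the orbit consists of all sums of lines and
-- hyperplanes in the blocks: a product of projective spaces.

module Submission where

open import Algebra.Bundles using (CommutativeRing; RawRing)
import Algebra.Properties.Ring as RingProperties
import Algebra.Properties.CommutativeMonoid.Sum as MonoidSum
import Algebra.Properties.Semiring.Exp as Exp
import Algebra.Properties.Semiring.Mult as Mult
import Algebra.Properties.Semiring.Sum as Sum
import Algebra.Solver.Ring as Solver
import Algebra.Solver.Ring.AlmostCommutativeRing as ACR
open import Axiom.ExcludedMiddle using (ExcludedMiddle)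
open import Data.Bool.Base using (Bool; true; false; if_then_else_; not)
import Data.Bool.Properties as Bool
open import Data.Empty using (⊥; ⊥-elim)
open import Data.Fin.Base using (Fin; zero; suc; toℕ; punchIn; punchOut; combine; remQuot)
import Data.Fin.Properties as Fin
open import Data.Fin.Subset using (Subset; ∣_∣; _⊃_) renaming (_∈_ to _∈ₛ_)
import Data.Fin.Subset as Subset
import Data.Fin.Subset.Properties as Subset
open import Data.Fin.Subset.Induction using (⊃-wellFounded; ⊂-wellFounded)
open import Data.List.Base using (List; []; _∷_)
import Data.List.Base as List
open import Data.List.Relation.Unary.All using ([]; _∷_)
open import Data.List.Relation.Unary.Any using (Any; here; there)
import Data.List.Relation.Unary.Any.Properties as Any
open import Data.Maybe.Base using (Maybe; just; nothing)
open import Data.Nat.Base as ℕ using (ℕ; zero; suc; s≤s; _∸_; _≤_)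
import Data.Nat.Properties as ℕ
open import Data.Product.Base using (Σ; ∃; ∃-syntax; Σ-syntax; _×_; _,_; proj₁; proj₂)
open import Data.Sum.Base using (_⊎_; inj₁; inj₂)
open import Data.Unit.Base using (⊤; tt)
open import Data.Vec.Base as Vec using (Vec; []; _∷_; lookup; tabulate)
import Data.Vec.Properties as Vec
open import Data.Vec.Properties.WithK using ([]=-irrelevant)
import Data.Vec.Functional as F
import Data.Vec.Functional.Properties as FP
open import Function.Base using (_∘_; id; case_of_)
open import Function.Bundles using (_⇔_; mk⇔; Equivalence)
open import Induction.WellFounded using (Acc; acc)
open import Level as Level using (Level; 0ℓ)
open import Relation.Binary.PropositionalEquality as ≡ using (_≡_; _≢_)
import Relation.Binary.Reasoning.Setoid as SetoidReasoning
open import Relation.Nullary using (¬_; Dec; yes; no; does; contradiction)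
open import Relation.Nullary.Decidable using (map′)
open import Relation.Unary using (Pred; _∈_; _≐_)
open import Data.Rational.Base as ℚ using (ℚ; 0ℚ; 1ℚ; ½)
import Data.Rational.Properties as ℚ
open import Defs using (module Geometry; IsPartition; ℝ; mkℝ; module Reals; module Gaussian; ℂ)

-- No limits are taken. A one-variable polynomial that vanishes outside a finite list is zero, since
-- the natural numbers are distinct in characteristic zero; so a form vanishing on the orbit also
-- vanishes at `s = 0` on a curve that lies in the orbit for `s ≠ 0`, and so does its differential
-- along the curve. The curve weights 0, 1, 2, 3 give `B` order 1, the one edge order 2 and all
-- other bases order at least 3; without a weight of its own for `i`, all exchanges into `j` would
-- have the same order. In the second half the obstacle is that the torus acts on equations of
-- hyperplanes by inverses. Multiplying by the product of `z` over the hyperplane blocks clears the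
-- denominators: every Plücker coordinate becomes a constant times a monomial `ψ z S`. This
-- parametrises the closure by all `z` that are nonzero somewhere in each block, and it is a Segre
-- map up to nonzero constants. Conversely, a point of the closure has only bases of X, so its
-- reduced matrix is block diagonal and the point is again of this form. The product decomposition
-- and the isomorphism both rest on this parametrisation.

-- Integer coefficients for the ring solver, as formal differences of naturals.
module RingSolver (K : CommutativeRing 0ℓ 0ℓ) where
  open CommutativeRing K hiding (zero) renaming (Carrier to 𝕂)
  open RingProperties ring using (-0#≈0#; -‿distribˡ-*; -‿distribʳ-*; -‿involutive; -‿+-comm)
  module ≈-Reasoning = SetoidReasoning setoid
  module M = Mult semiring

  value : ℕ × ℕ → 𝕂
  value (a , b) = a M.× 1# - b M.× 1#

  private
    shuffle : ∀ a b c d → (a + b) + (c + d) ≈ (a + c) + (b + d)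
    shuffle a b c d = trans (+-assoc a b (c + d)) (trans (+-congˡ
      (trans (sym (+-assoc b c d)) (trans (+-congʳ (+-comm b c)) (+-assoc c b d))))
      (sym (+-assoc a c (b + d))))

    ×-homo-* : ∀ a b → (a ℕ.* b) M.× 1# ≈ (a M.× 1#) * (b M.× 1#)
    ×-homo-* zero    b = sym (zeroˡ _)
    ×-homo-* (suc a) b = trans (M.×-homo-+ 1# b (a ℕ.* b)) (trans
      (+-cong (sym (*-identityˡ _)) (×-homo-* a b)) (sym (distribʳ _ _ _)))

    +-homo : ∀ x y → value (proj₁ x ℕ.+ proj₁ y , proj₂ x ℕ.+ proj₂ y) ≈ value x + value y
    +-homo (a , b) (c , d) = trans
      (+-cong (M.×-homo-+ 1# a c) (trans (-‿cong (M.×-homo-+ 1# b d)) (sym (-‿+-comm _ _))))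
      (shuffle _ _ _ _)

    product-of-differences : ∀ a b c d → (a * c + b * d) - (a * d + b * c) ≈ (a - b) * (c - d)
    product-of-differences a b c d = sym (begin
      (a - b) * (c - d)                              ≈⟨ distribʳ _ _ _ ⟩
      a * (c - d) + - b * (c - d)                    ≈⟨ +-cong (distribˡ _ _ _) (distribˡ _ _ _) ⟩
      (a * c + a * - d) + (- b * c + - b * - d)
        ≈⟨ +-cong (+-congˡ (sym (-‿distribʳ-* a d)))
                  (+-cong (sym (-‿distribˡ-* b c))
                    (trans (sym (-‿distribˡ-* b (- d))) (trans (-‿cong (sym (-‿distribʳ-* b d))) (-‿involutive _)))) ⟩
      (a * c - a * d) + (- (b * c) + b * d)          ≈⟨ +-congˡ (+-comm _ _) ⟩
      (a * c - a * d) + (b * d - b * c)              ≈⟨ shuffle _ _ _ _ ⟩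
      (a * c + b * d) + (- (a * d) - b * c)          ≈⟨ +-congˡ (-‿+-comm _ _) ⟩
      (a * c + b * d) - (a * d + b * c)              ∎)
      where open ≈-Reasoning

    *-homo : ∀ x y → value (proj₁ x ℕ.* proj₁ y ℕ.+ proj₂ x ℕ.* proj₂ y
                          , proj₁ x ℕ.* proj₂ y ℕ.+ proj₂ x ℕ.* proj₁ y) ≈ value x * value y
    *-homo (a , b) (c , d) = trans (+-cong
      (trans (M.×-homo-+ 1# (a ℕ.* c) (b ℕ.* d)) (+-cong (×-homo-* a c) (×-homo-* b d)))
      (-‿cong (trans (M.×-homo-+ 1# (a ℕ.* d) (b ℕ.* c)) (+-cong (×-homo-* a d) (×-homo-* b c)))))
      (product-of-differences _ _ _ _)

    cancel : ∀ a b c d → a + d ≈ c + b → a - b ≈ c - d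
    cancel a b c d e = begin
      a - b              ≈⟨ +-congʳ (trans (sym (+-identityʳ a)) (+-congˡ (sym (-‿inverseʳ d)))) ⟩
      a + (d - d) - b    ≈⟨ +-congʳ (trans (sym (+-assoc _ _ _)) (+-congʳ e)) ⟩
      c + b - d - b      ≈⟨ +-assoc _ _ _ ⟩
      c + b + (- d - b)  ≈⟨ shuffle _ _ _ _ ⟩
      c - d + (b - b)    ≈⟨ trans (+-congˡ (-‿inverseʳ b)) (+-identityʳ _) ⟩
      c - d              ∎
      where open ≈-Reasoning

    -- Formal differences have no normal form, so coefficients are compared by cross sums; `nothing`
    -- only means that no equality was recognised.
    decide : ∀ x y → Maybe (value x ≈ value y)
    decide (a , b) (c , d) with a ℕ.+ d ℕ.≟ c ℕ.+ b
    ... | yes e = just (cancel _ _ _ _ (trans (sym (M.×-homo-+ 1# a d))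
                    (trans (reflexive (≡.cong (M._× 1#) e)) (M.×-homo-+ 1# c b))))
    ... | no  _ = nothing

  target = ACR.fromCommutativeRing K

  coefficients : RawRing 0ℓ 0ℓ
  coefficients = record
    { Carrier = ℕ × ℕ
    ; _≈_ = _≡_
    ; _+_ = λ (a , b) (c , d) → a ℕ.+ c , b ℕ.+ d
    ; _*_ = λ (a , b) (c , d) → a ℕ.* c ℕ.+ b ℕ.* d , a ℕ.* d ℕ.+ b ℕ.* c
    ; -_ = λ (a , b) → b , a
    ; 0# = 0 , 0
    ; 1# = 1 , 0 }

  morphism : coefficients ACR.-Raw-AlmostCommutative⟶ target
  morphism = record
    { ⟦_⟧    = value
    ; +-homo = +-homo
    ; *-homo = *-homo
    ; -‿homo = λ (a , b) → trans (+-comm _ _) (trans (+-congˡ (sym (-‿involutive _))) (-‿+-comm _ _))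
    ; 0-homo = -‿inverseʳ 0#
    ; 1-homo = trans (+-cong (+-identityʳ 1#) -0#≈0#) (+-identityʳ 1#)
    }

  open Solver coefficients target morphism decide public
    using (solve; _:=_; _:+_; _:*_; _:-_; :-_; con)

-- The interface through which the geometry sees ℂ. Whether a Cauchy sequence is null is not
-- decidable, hence `em`; `char0` makes the field infinite, on which `density` rests.
record ClassicalField (K : CommutativeRing 0ℓ 0ℓ) : Set₁ where
  open CommutativeRing K
  open Mult semiring using () renaming (_×_ to _×ₙ_)
  field
    inverse : ∀ x → ¬ x ≈ 0# → ∃[ y ] x * y ≈ 1#
    char0   : ∀ n → ¬ suc n ×ₙ 1# ≈ 0#
    em      : (P : Set) → Dec P

module FieldTools {K : CommutativeRing 0ℓ 0ℓ} (F : ClassicalField K) where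
  open ClassicalField F using (inverse; char0; em) public
  open CommutativeRing K hiding (zero) renaming (Carrier to 𝕂) public
  open RingProperties ring public
    using (-0#≈0#; -‿distribˡ-*; -‿distribʳ-*; -‿involutive; -‿+-comm)
  open Sum semiring public
    using (sum; sum-cong-≋; sum-remove; ∑-distrib-+; ∑-comm; *-distribˡ-sum; *-distribʳ-sum; sum-replicate-zero)
  open Exp semiring public using (_^_)
  open Geometry K public
  module Π = MonoidSum *-commutativeMonoid
  open Π public using () renaming (sum to prod; sum-cong-≋ to prod-cong)
  module ≈-Reasoning = SetoidReasoning setoid

  open RingSolver K public using (solve; _:=_; _:+_; _:*_; _:-_; :-_)

-- Linear dependence, bases and dimension.

module LinearAlgebra {K : CommutativeRing 0ℓ 0ℓ} (F : ClassicalField K) where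
  open FieldTools F public

  1≉0 : 1# ≉ 0#
  1≉0 e = char0 0 (trans (+-identityʳ 1#) e)

  _⁻¹[_] : ∀ x → x ≉ 0# → 𝕂
  x ⁻¹[ x≉0 ] = proj₁ (inverse x x≉0)

  *-inv : ∀ {x} (x≉0 : x ≉ 0#) → x * x ⁻¹[ x≉0 ] ≈ 1#
  *-inv {x} x≉0 = proj₂ (inverse x x≉0)

  0*≈0 : ∀ {x y} → x ≈ 0# → x * y ≈ 0#
  0*≈0 e = trans (*-congʳ e) (zeroˡ _)

  *0≈0 : ∀ {x y} → y ≈ 0# → x * y ≈ 0#
  *0≈0 e = trans (*-congˡ e) (zeroʳ _)

  0+≈ : ∀ {x y} → x ≈ 0# → x + y ≈ y
  0+≈ e = trans (+-congʳ e) (+-identityˡ _)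

  +0≈ : ∀ {x y} → y ≈ 0# → x + y ≈ x
  +0≈ e = trans (+-congˡ e) (+-identityʳ _)

  1*≈ : ∀ {x y} → x ≈ 1# → x * y ≈ y
  1*≈ e = trans (*-congʳ e) (*-identityˡ _)

  *1≈ : ∀ {x y} → y ≈ 1# → x * y ≈ x
  *1≈ e = trans (*-congˡ e) (*-identityʳ _)

  x≈y⇒x-y≈0 : ∀ {x y} → x ≈ y → x - y ≈ 0#
  x≈y⇒x-y≈0 e = trans (+-congʳ e) (-‿inverseʳ _)

  x-y≈0⇒x≈y : ∀ {x y} → x - y ≈ 0# → x ≈ y
  x-y≈0⇒x≈y {x} {y} e = trans (solve 2 (λ x y → x := x :- y :+ y) refl x y) (0+≈ e)

  -0≈0 : ∀ {x} → x ≈ 0# → - x ≈ 0#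
  -0≈0 e = trans (-‿cong e) -0#≈0#

  *-cancel-0 : ∀ {x y} → x ≉ 0# → x * y ≈ 0# → y ≈ 0#
  *-cancel-0 {x} {y} x≉0 xy≈0 = begin
    y                      ≈⟨ *-identityˡ y ⟨
    1# * y                 ≈⟨ *-congʳ (*-inv x≉0) ⟨
    x * x ⁻¹[ x≉0 ] * y    ≈⟨ solve 3 (λ x i y → x :* i :* y := i :* (x :* y)) refl _ _ _ ⟩
    x ⁻¹[ x≉0 ] * (x * y)  ≈⟨ *0≈0 xy≈0 ⟩
    0#                     ∎
    where open ≈-Reasoning

  *-cancel : ∀ {x y z} → x ≉ 0# → x * y ≈ x * z → y ≈ z
  *-cancel {x} {y} {z} x≉0 e = x-y≈0⇒x≈y (*-cancel-0 x≉0
    (trans (solve 3 (λ x y z → x :* (y :- z) := x :* y :- x :* z) refl x y z) (x≈y⇒x-y≈0 e)))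

  *-≉0 : ∀ {x y} → x ≉ 0# → y ≉ 0# → x * y ≉ 0#
  *-≉0 x≉0 y≉0 e = y≉0 (*-cancel-0 x≉0 e)

  ≉0-factorˡ : ∀ {x y} → x * y ≉ 0# → x ≉ 0#
  ≉0-factorˡ xy≉0 e = xy≉0 (0*≈0 e)

  ≉0-factorʳ : ∀ {x y} → x * y ≉ 0# → y ≉ 0#
  ≉0-factorʳ xy≉0 e = xy≉0 (*0≈0 e)

  ≉0-cong : ∀ {x y} → x ≈ y → x ≉ 0# → y ≉ 0#
  ≉0-cong e x≉0 y≈0 = x≉0 (trans e y≈0)

  inv≉0 : ∀ {x} (x≉0 : x ≉ 0#) → x ⁻¹[ x≉0 ] ≉ 0#
  inv≉0 x≉0 = ≉0-factorʳ (≉0-cong (sym (*-inv x≉0)) 1≉0)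

  -‿≉0 : ∀ {x} → x ≉ 0# → - x ≉ 0#
  -‿≉0 x≉0 e = x≉0 (trans (sym (-‿involutive _)) (-0≈0 e))

  by-contradiction : ∀ {x} → ¬ x ≉ 0# → x ≈ 0#
  by-contradiction {x} ¬¬ with em (x ≈ 0#)
  ... | yes e = e
  ... | no  n = contradiction n ¬¬

  δ : ∀ {n} → Fin n → Fin n → 𝕂
  δ i j = if does (i Fin.≟ j) then 1# else 0#

  δ-same : ∀ {n} (i : Fin n) → δ i i ≈ 1#
  δ-same i with i Fin.≟ i
  ... | yes _ = refl
  ... | no  n = contradiction ≡.refl n

  δ-≡ : ∀ {n} {i j : Fin n} → i ≡ j → δ i j ≈ 1#
  δ-≡ {i = i} ≡.refl = δ-same i

  δ-≢ : ∀ {n} {i j : Fin n} → i ≢ j → δ i j ≈ 0#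
  δ-≢ {i = i} {j} i≢j with i Fin.≟ j
  ... | yes e = contradiction e i≢j
  ... | no  _ = refl

  sum-zero : ∀ {n} {f : Fin n → 𝕂} → (∀ i → f i ≈ 0#) → sum f ≈ 0#
  sum-zero {n} e = trans (sum-cong-≋ e) (sum-replicate-zero n)

  sum-single : ∀ {n} (f : Fin n → 𝕂) i → (∀ j → j ≢ i → f j ≈ 0#) → sum f ≈ f i
  sum-single {suc n} f i e = trans (sum-remove {i = i} f)
    (+0≈ (sum-zero (λ j → e (punchIn i j) (Fin.punchInᵢ≢i i j))))

  sum-δ : ∀ {n} (c : Fin n → 𝕂) i → sum (λ j → c j * δ j i) ≈ c i
  sum-δ c i = trans (sum-single _ i (λ j j≢i → *0≈0 (δ-≢ j≢i)))
    (*1≈ (δ-same i))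

  sum-≉0 : ∀ {n} (f : Fin n → 𝕂) → sum f ≉ 0# → ∃[ i ] f i ≉ 0#
  sum-≉0 f ≉0 with em (∃[ i ] f i ≉ 0#)
  ... | yes p = p
  ... | no ¬p = contradiction (sum-zero (λ i → by-contradiction (λ fi≉0 → ¬p (i , fi≉0)))) ≉0

  sum-neg : ∀ {n} (f : Fin n → 𝕂) → sum (λ i → - f i) ≈ - sum f
  sum-neg {zero}  f = sym -0#≈0#
  sum-neg {suc n} f = trans (+-congˡ (sum-neg (f ∘ suc))) (-‿+-comm _ _)

  prod-one : ∀ {n} {f : Fin n → 𝕂} → (∀ i → f i ≈ 1#) → prod f ≈ 1#
  prod-one {n} e = trans (prod-cong e) (Π.sum-replicate-zero n)

  prod-single : ∀ {n} (f : Fin n → 𝕂) i → (∀ j → j ≢ i → f j ≈ 1#) → prod f ≈ f i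
  prod-single {suc n} f i e = trans (Π.sum-remove {i = i} f)
    (*1≈ (prod-one (λ j → e (punchIn i j) (Fin.punchInᵢ≢i i j))))

  prod-≉0 : ∀ {n} {f : Fin n → 𝕂} → (∀ i → f i ≉ 0#) → prod f ≉ 0#
  prod-≉0 {zero}  e = 1≉0
  prod-≉0 {suc n} e = *-≉0 (e zero) (prod-≉0 (e ∘ suc))

  private variable
    ℓ : Level
    ι : Set
    m n d : ℕ

  -- A pivot row for the column a; if the column vanishes, any row serves with μ = 0.
  pivot-row : (a : Fin (suc n) → 𝕂) → ∃[ j ] ∃[ μ ] ∀ i → a (punchIn j i) ≈ μ i * a j
  pivot-row a with em (∃[ j ] a j ≉ 0#)
  ... | yes (j , aj≉0) = j , (λ i → a (punchIn j i) * aj≉0⁻¹) , λ i →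
          sym (trans (*-assoc _ _ _) (*1≈ (trans (*-comm _ _) (*-inv aj≉0))))
    where aj≉0⁻¹ = _ ⁻¹[ aj≉0 ]
  ... | no ¬p = zero , (λ _ → 0#) , λ i →
          trans (by-contradiction (λ n → ¬p (suc i , n))) (sym (zeroˡ _))

  -- Gaussian elimination: subtracting multiples of a pivot row clears the first coordinate, the
  -- remaining rows have a relation by induction, and the coefficient of the pivot row is chosen to
  -- absorb the subtracted multiples.
  dependent : n ℕ.< m → (A : Fin m → Fin n → 𝕂) →
    ∃[ c ] (∃[ j ] c j ≉ 0#) × combination c A ≋ (λ _ → 0#)
  dependent {zero}  {suc m} _         A = (λ _ → 1#) , (zero , 1≉0) , λ ()
  dependent {suc n} {suc m} (s≤s n<m) A = c , nontrivial , vanishes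
    where
    pivot = pivot-row (λ i → A i zero)
    j = proj₁ pivot
    μ = proj₁ (proj₂ pivot)
    A′ : Fin m → Fin n → 𝕂
    A′ i p = A (punchIn j i) (suc p) - μ i * A j (suc p)
    IH = dependent n<m A′
    c′ = proj₁ IH
    x = - sum (λ i → c′ i * μ i)
    c = F.insertAt c′ j x
    at-j : c j ≈ x
    at-j = reflexive (FP.insertAt-lookup c′ j x)
    at-i : ∀ i → c (punchIn j i) ≈ c′ i
    at-i i = reflexive (FP.insertAt-punchIn c′ j x i)
    nontrivial : ∃[ j ] c j ≉ 0#
    nontrivial = let (i , p) = proj₁ (proj₂ IH) in punchIn j i , ≉0-cong (sym (at-i i)) p
    split : ∀ p → combination c A p ≈ sum (λ i → c′ i * (A (punchIn j i) p - μ i * A j p))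
    split p = begin
      combination c A p
        ≈⟨ sum-remove {i = j} (λ i → c i * A i p) ⟩
      c j * A j p + sum (λ i → c (punchIn j i) * A (punchIn j i) p)
        ≈⟨ +-cong (*-congʳ at-j) (sum-cong-≋ (λ i → *-congʳ (at-i i))) ⟩
      x * A j p + sum (λ i → c′ i * A (punchIn j i) p)
        ≈⟨ +-congʳ (trans (sym (-‿distribˡ-* _ _)) (-‿cong (*-distribʳ-sum (A j p) (λ i → c′ i * μ i)))) ⟩
      - sum (λ i → c′ i * μ i * A j p) + sum (λ i → c′ i * A (punchIn j i) p)
        ≈⟨ +-congʳ (-‿cong (sum-cong-≋ (λ i → *-assoc (c′ i) (μ i) (A j p)))) ⟩
      - y + sum (λ i → c′ i * A (punchIn j i) p)
        ≈⟨ +-congˡ (trans (sum-cong-≋ (λ i → solve 4 (λ c a μ b → c :* a := c :* (a :- μ :* b) :+ c :* (μ :* b)) refl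
              (c′ i) (A (punchIn j i) p) (μ i) (A j p)))
              (∑-distrib-+ (λ i → c′ i * (A (punchIn j i) p - μ i * A j p)) (λ i → c′ i * (μ i * A j p)))) ⟩
      - y + (sum (λ i → c′ i * (A (punchIn j i) p - μ i * A j p)) + y)
        ≈⟨ solve 2 (λ y z → :- y :+ (z :+ y) := z) refl _ _ ⟩
      sum (λ i → c′ i * (A (punchIn j i) p - μ i * A j p)) ∎
      where
      open ≈-Reasoning
      y = sum (λ i → c′ i * (μ i * A j p))
    vanishes : combination c A ≋ (λ _ → 0#)
    vanishes zero    = trans (split zero) (sum-zero (λ i → trans
      (*-congˡ (trans (+-congʳ (proj₂ (proj₂ pivot) i)) (-‿inverseʳ _))) (zeroʳ _)))
    vanishes (suc p) = trans (split (suc p)) (proj₂ (proj₂ IH) p)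

  -- Covers sums, multiples, the zero vector (`m = 0`) and pointwise equal vectors at once.
  Closed : Pred (ι → 𝕂) ℓ → Set ℓ
  Closed {ι} W = ∀ {m} (c : Fin m → 𝕂) (u : Fin m → ι → 𝕂) → (∀ j → u j ∈ W) →
    ∀ v → v ≋ combination c u → v ∈ W

  combination-assoc : (c : Fin m → 𝕂) (C : Fin m → Fin d → 𝕂) (b : Fin d → ι → 𝕂) →
    combination (combination c C) b ≋ combination c (λ j → combination (C j) b)
  combination-assoc c C b i = begin
    sum (λ p → sum (λ j → c j * C j p) * b p i)
      ≈⟨ sum-cong-≋ (λ p → trans (*-distribʳ-sum (b p i) (λ j → c j * C j p)) (sum-cong-≋ (λ j → *-assoc (c j) (C j p) (b p i)))) ⟩
    sum (λ p → sum (λ j → c j * (C j p * b p i)))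
      ≈⟨ ∑-comm (λ p j → c j * (C j p * b p i)) ⟩
    sum (λ j → sum (λ p → c j * (C j p * b p i)))
      ≈⟨ sum-cong-≋ (λ j → sym (*-distribˡ-sum (c j) (λ p → C j p * b p i))) ⟩
    sum (λ j → c j * sum (λ p → C j p * b p i)) ∎
    where open ≈-Reasoning

  combination-cong : {c c′ : Fin m → 𝕂} {u u′ : Fin m → ι → 𝕂} → (∀ j → c j ≈ c′ j) → (∀ j → u j ≋ u′ j) →
    combination c u ≋ combination c′ u′
  combination-cong e e′ i = sum-cong-≋ (λ j → *-cong (e j) (e′ j i))

  module _ {W : Pred (ι → 𝕂) ℓ} (H : HasDimension W d) where
    open HasDimension H using (independent; spans) renaming (basis to b)
    open module Spans v = Equivalence (spans v) using (to; from)

    basis∈ : ∀ j → b j ∈ W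
    basis∈ j = from (b j) (δ j , λ i → sym (trans
      (sum-single _ j (λ p p≢j → 0*≈0 (δ-≢ (p≢j ∘ ≡.sym))))
      (1*≈ (δ-same j))))

    closed : Closed W
    closed c u u∈ v e = from v (combination c C , λ i → trans (e i) (trans
      (combination-cong (λ _ → refl) (λ j → proj₂ (to (u j) (u∈ j))) i) (sym (combination-assoc c C b i))))
      where C = λ j → proj₁ (to (u j) (u∈ j))

    coefficients-unique : ∀ c c′ → combination c b ≋ combination c′ b → ∀ j → c j ≈ c′ j
    coefficients-unique c c′ e j = x-y≈0⇒x≈y (independent (λ j → c j - c′ j) vanishes j)
      where
      vanishes : combination (λ j → c j - c′ j) b ≋ (λ _ → 0#)
      vanishes i = begin
        sum (λ j → (c j - c′ j) * b j i)
          ≈⟨ sum-cong-≋ (λ j → solve 3 (λ x y z → (x :- y) :* z := x :* z :+ (:- y) :* z) refl (c j) (c′ j) (b j i)) ⟩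
        sum (λ j → c j * b j i + - c′ j * b j i)
          ≈⟨ ∑-distrib-+ (λ j → c j * b j i) (λ j → - c′ j * b j i) ⟩
        combination c b i + sum (λ j → - c′ j * b j i)
          ≈⟨ +-cong (e i) (trans (sum-cong-≋ (λ j → sym (-‿distribˡ-* (c′ j) (b j i)))) (sum-neg (λ j → c′ j * b j i))) ⟩
        combination c′ b i - combination c′ b i
          ≈⟨ -‿inverseʳ _ ⟩
        0# ∎
        where open ≈-Reasoning

    -- Otherwise the coefficient vectors of the `u j` in the basis would be dependent, and the
    -- relation would carry over to the `u j`.
    independent-bound : (u : Fin m → ι → 𝕂) → (∀ j → u j ∈ W) →
      (∀ c → combination c u ≋ (λ _ → 0#) → ∀ j → c j ≈ 0#) → m ℕ.≤ d
    independent-bound {m} u u∈ ind = ℕ.≮⇒≥ λ d<m →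
      let C = λ j → proj₁ (to (u j) (u∈ j))
          (c , (j , cj≉0) , e) = dependent d<m C
      in cj≉0 (ind c (λ i → trans (combination-cong (λ _ → refl) (λ j → proj₂ (to (u j) (u∈ j))) i)
           (trans (sym (combination-assoc c C b i)) (sum-zero (λ p → 0*≈0 (e p))))) j)

    -- This is how equations bound a tangent space from above: with fewer than `d` coordinates, some
    -- nontrivial combination of the basis would vanish at all of them.
    coordinates-bound : (φ : Fin m → ι) → (∀ v → v ∈ W → (∀ a → v (φ a) ≈ 0#) → v ≋ (λ _ → 0#)) → d ℕ.≤ m
    coordinates-bound φ inj = ℕ.≮⇒≥ λ m<d →
      let (c , (j , cj≉0) , e) = dependent m<d (λ j a → b j (φ a))
      in cj≉0 (independent c (inj _ (from _ (c , λ _ → refl)) e) j)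

  abstract
    dimension-unique : ∀ {W : Pred (ι → 𝕂) ℓ} {d d′} → HasDimension W d → HasDimension W d′ → d ≡ d′
    dimension-unique H H′ = ℕ.≤-antisym
      (independent-bound H′ (HasDimension.basis H) (basis∈ H) (HasDimension.independent H))
      (independent-bound H (HasDimension.basis H′) (basis∈ H′) (HasDimension.independent H′))

-- Reduced bases of a subspace and pivoting.

module Bases {K : CommutativeRing 0ℓ 0ℓ} (F : ClassicalField K) where
  open LinearAlgebra F public

  private variable
    ℓ : Level
    k n : ℕ

  ∈⇒lookup : ∀ {S : Subset n} {l} → l ∈ₛ S → lookup S l ≡ true
  ∈⇒lookup = Vec.[]=⇒lookup

  lookup⇒∈ : ∀ {S : Subset n} {l} → lookup S l ≡ true → l ∈ₛ S
  lookup⇒∈ {S = S} {l} = Vec.lookup⇒[]= l S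

  elements∈ : (S : Subset n) → ∀ j → lookup S (elements S j) ≡ true
  elements∈ (true  ∷ S) zero    = ≡.refl
  elements∈ (true  ∷ S) (suc j) = elements∈ S j
  elements∈ (false ∷ S) j       = elements∈ S j

  elements-surjective : (S : Subset n) → ∀ l → lookup S l ≡ true → ∃[ j ] elements S j ≡ l
  elements-surjective (true  ∷ S) zero    _ = zero , ≡.refl
  elements-surjective (true  ∷ S) (suc l) p = let (j , e) = elements-surjective S l p in suc j , ≡.cong suc e
  elements-surjective (false ∷ S) (suc l) p = let (j , e) = elements-surjective S l p in j , ≡.cong suc e

  elements-injective : (S : Subset n) → ∀ {i j} → elements S i ≡ elements S j → i ≡ j
  elements-injective (true  ∷ S) {zero}  {zero}  _ = ≡.refl
  elements-injective (true  ∷ S) {suc i} {suc j} e = ≡.cong suc (elements-injective S (Fin.suc-injective e))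
  elements-injective (false ∷ S)                 e = elements-injective S (Fin.suc-injective e)

  δ-elements : (S : Subset n) → ∀ i j → δ (elements S i) (elements S j) ≈ δ i j
  δ-elements S i j with i Fin.≟ j
  ... | yes ≡.refl = δ-same (elements S i)
  ... | no  i≢j    = δ-≢ (i≢j ∘ elements-injective S)

  sum-elements : (S : Subset n) (f : Fin n → 𝕂) → (∀ l → lookup S l ≡ false → f l ≈ 0#) →
    sum (f ∘ elements S) ≈ sum f
  sum-elements []          f e = refl
  sum-elements (true  ∷ S) f e = +-congˡ (sum-elements S (f ∘ suc) (e ∘ suc))
  sum-elements (false ∷ S) f e = trans (sum-elements S (f ∘ suc) (e ∘ suc))
    (sym (0+≈ (e zero ≡.refl)))

  prod-elements : (S : Subset n) (t : Fin n → 𝕂) →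
    prod (t ∘ elements S) ≈ prod (λ l → if lookup S l then t l else 1#)
  prod-elements []          t = refl
  prod-elements (true  ∷ S) t = *-congˡ (prod-elements S (t ∘ suc))
  prod-elements (false ∷ S) t = trans (prod-elements S (t ∘ suc)) (sym (*-identityˡ _))

  -- Rows outside S are kept zero, so that expansions are sums over all indices.
  record Reduced (W : Pred (Fin n → 𝕂) ℓ) (S : Subset n) : Set ℓ where
    field
      row        : Fin n → Fin n → 𝕂
      row∈       : ∀ b → row b ∈ W
      row-out    : ∀ b → lookup S b ≡ false → row b ≋ (λ _ → 0#)
      row-δ      : ∀ b b′ → lookup S b ≡ true → lookup S b′ ≡ true → row b b′ ≈ δ b b′
      determined : ∀ v → v ∈ W → (∀ b → lookup S b ≡ true → v b ≈ 0#) → v ≋ (λ _ → 0#)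

    row-diag : ∀ b → lookup S b ≡ true → row b b ≈ 1#
    row-diag b p = trans (row-δ b b p p) (δ-same b)

    row-off : ∀ b b′ → lookup S b′ ≡ true → b ≢ b′ → row b b′ ≈ 0#
    row-off b b′ p b≢b′ with lookup S b in eq
    ... | true  = trans (row-δ b b′ eq p) (δ-≢ b≢b′)
    ... | false = row-out b eq b′

  true≢false : ∀ {b} → b ≡ true → b ≢ false
  true≢false ≡.refl ()

  module _ {W : Pred (Fin n → 𝕂) ℓ} (W-closed : Closed W) where

    closed-zero : (λ _ → 0#) ∈ W
    closed-zero = W-closed {0} (λ ()) (λ ()) (λ ()) _ (λ _ → refl)

    closed-+ : ∀ {u v} a b → u ∈ W → v ∈ W → (λ l → a * u l + b * v l) ∈ W
    closed-+ {u} {v} a b u∈ v∈ = W-closed {2} (λ { zero → a ; (suc _) → b }) (λ { zero → u ; (suc _) → v })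
      (λ { zero → u∈ ; (suc zero) → v∈ }) _ (λ l → +-congˡ (sym (+-identityʳ _)))

    closed-≋ : ∀ {u v} → u ≋ v → u ∈ W → v ∈ W
    closed-≋ {u} {v} e u∈ = W-closed {1} (λ _ → 1#) (λ _ → u) (λ _ → u∈) v
      (λ l → sym (trans (+-identityʳ _) (trans (*-identityˡ _) (e l))))

    closed-difference : ∀ {u v} → u ∈ W → v ∈ W → (λ l → u l - v l) ∈ W
    closed-difference {u} {v} u∈ v∈ = closed-≋ (λ l → +-cong (*-identityˡ _)
      (trans (sym (-‿distribˡ-* 1# _)) (-‿cong (*-identityˡ _)))) (closed-+ 1# (- 1#) u∈ v∈)

    mkReduced : ∀ S (row : Fin n → Fin n → 𝕂) →
      (∀ b → lookup S b ≡ true → row b ∈ W) →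
      (∀ b b′ → lookup S b ≡ true → lookup S b′ ≡ true → row b b′ ≈ δ b b′) →
      (∀ v → v ∈ W → (∀ b → lookup S b ≡ true → v b ≈ 0#) → v ≋ (λ _ → 0#)) →
      Reduced W S
    mkReduced S row row∈ row-δ determined = record
      { row = λ b → mask (lookup S b) b
      ; row∈ = λ b → mask∈ b
      ; row-out = λ b e l → reflexive (≡.cong (λ x → mask x b l) e)
      ; row-δ = λ b b′ p q → trans (reflexive (≡.cong (λ x → mask x b b′) p)) (row-δ b b′ p q)
      ; determined = determined }
      where
      mask : Bool → Fin n → Fin n → 𝕂
      mask true  b = row b
      mask false b = λ _ → 0#
      mask∈ : ∀ b → mask (lookup S b) b ∈ W
      mask∈ b with lookup S b in eq
      ... | true  = row∈ b eq
      ... | false = closed-zero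

    module _ {S : Subset n} (R : Reduced W S) where
      open Reduced R

      expansion-at : ∀ (v : Fin n → 𝕂) b → lookup S b ≡ true → combination v row b ≈ v b
      expansion-at v b p = trans (sum-single _ b (λ c c≢b → *0≈0 (row-off c b p c≢b)))
        (*1≈ (row-diag b p))

      expansion : ∀ v → v ∈ W → v ≋ combination v row
      expansion v v∈ l = x-y≈0⇒x≈y (determined (λ l → v l - combination v row l)
        (closed-difference v∈ (W-closed v row row∈ _ (λ _ → refl)))
        (λ b p → trans (+-congˡ (-‿cong (expansion-at v b p))) (-‿inverseʳ _)) l)

      reduced⇒dimension : HasDimension W ∣ S ∣
      reduced⇒dimension = record
        { basis = row ∘ elements S
        ; independent = λ c e j → trans (sym (at c j)) (e (elements S j))
        ; spans = λ v → mk⇔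
            (λ v∈ → v ∘ elements S , λ l → trans (expansion v v∈ l) (sym (sum-elements S _
               (λ b p → *0≈0 (row-out b p l)))))
            (λ (c , e) → W-closed c _ (λ j → row∈ _) v e) }
        where
        at : ∀ c j → combination c (row ∘ elements S) (elements S j) ≈ c j
        at c j = trans (sum-cong-≋ (λ i → *-congˡ {c i} (trans
          (row-δ _ _ (elements∈ S i) (elements∈ S j)) (δ-elements S i j)))) (sum-δ c j)

  ⁅_≔_⁆ : Subset n → Fin n → Subset n
  ⁅_≔_⁆ S l = tabulate (λ x → if does (x Fin.≟ l) then true else lookup S x)

  swap : Subset n → Fin n → Fin n → Subset n
  swap S b l = tabulate (λ x → if does (x Fin.≟ l) then true else (if does (x Fin.≟ b) then false else lookup S x))

  module _ (S : Subset n) {b l : Fin n} where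
    private
      lookup-swap : ∀ x → lookup (swap S b l) x ≡
        (if does (x Fin.≟ l) then true else (if does (x Fin.≟ b) then false else lookup S x))
      lookup-swap = Vec.lookup∘tabulate _

    swap-new : lookup (swap S b l) l ≡ true
    swap-new with l Fin.≟ l | lookup-swap l
    ... | yes _ | e = e
    ... | no  n | e = contradiction ≡.refl n

    swap-old : b ≢ l → lookup (swap S b l) b ≡ false
    swap-old b≢l with b Fin.≟ l | b Fin.≟ b | lookup-swap b
    ... | yes e | _     | _ = contradiction e b≢l
    ... | no  _ | yes _ | e = e
    ... | no  _ | no  n | _ = contradiction ≡.refl n

    swap-other : ∀ {x} → x ≢ l → x ≢ b → lookup (swap S b l) x ≡ lookup S x
    swap-other {x} x≢l x≢b with x Fin.≟ l | x Fin.≟ b | lookup-swap x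
    ... | yes e | _     | _ = contradiction e x≢l
    ... | no  _ | yes e | _ = contradiction e x≢b
    ... | no  _ | no  _ | e = e

  insert-new : (S : Subset n) (l : Fin n) → lookup ⁅ S ≔ l ⁆ l ≡ true
  insert-new S l with l Fin.≟ l | Vec.lookup∘tabulate (λ x → if does (x Fin.≟ l) then true else lookup S x) l
  ... | yes _ | e = e
  ... | no  n | e = contradiction ≡.refl n

  insert-other : (S : Subset n) {l x : Fin n} → x ≢ l → lookup ⁅ S ≔ l ⁆ x ≡ lookup S x
  insert-other S {l} {x} x≢l with x Fin.≟ l | Vec.lookup∘tabulate (λ x → if does (x Fin.≟ l) then true else lookup S x) x
  ... | yes e | _ = contradiction e x≢l
  ... | no  _ | e = e

  -- Rows are named after their pivot columns, so the normalised row `u` is stored at the index `l`.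
  -- The factor `1#` gives the other rows the shape required by `closed-+`.
  eliminate : (row : Fin n → Fin n → 𝕂) (u : Fin n → 𝕂) → Fin n → Fin n → Fin n → 𝕂
  eliminate row u l x = if does (x Fin.≟ l) then u else (λ y → 1# * row x y + - row x l * u y)

  module _ (row : Fin n → Fin n → 𝕂) (u : Fin n → 𝕂) (l : Fin n) where

    eliminate-pivot : eliminate row u l l ≡ u
    eliminate-pivot with l Fin.≟ l
    ... | yes _ = ≡.refl
    ... | no  n = contradiction ≡.refl n

    eliminate-other : ∀ {x} → x ≢ l → ∀ y → eliminate row u l x y ≈ row x y - row x l * u y
    eliminate-other {x} x≢l y with x Fin.≟ l
    ... | yes e = contradiction e x≢l
    ... | no  _ = +-cong (*-identityˡ _) (sym (-‿distribˡ-* _ _))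

    -- `P` stands for the new index set, so that one computation serves both the exchange of an
    -- index in `pivot` and the addition of one in `grow`.
    eliminate-δ : u l ≈ 1# → (P : Fin n → Set) →
      (∀ y → P y → y ≢ l → u y ≈ 0#) →
      (∀ x y → P x → P y → x ≢ l → y ≢ l → row x y ≈ δ x y) →
      ∀ x y → P x → P y → eliminate row u l x y ≈ δ x y
    eliminate-δ ul P u-off row-δ x y px py = by-cases (x Fin.≟ l) (y Fin.≟ l)
      where
      by-cases : Dec (x ≡ l) → Dec (y ≡ l) → eliminate row u l x y ≈ δ x y
      by-cases (yes ≡.refl) (yes ≡.refl) = trans (reflexive (≡.cong (λ f → f l) eliminate-pivot)) (trans ul (sym (δ-same l)))
      by-cases (yes ≡.refl) (no y≢l) = trans (reflexive (≡.cong (λ f → f y) eliminate-pivot))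
        (trans (u-off y py y≢l) (sym (δ-≢ (y≢l ∘ ≡.sym))))
      by-cases (no x≢l) (yes ≡.refl) = trans (eliminate-other x≢l l)
        (trans (+-congˡ (-‿cong (*1≈ ul))) (trans (-‿inverseʳ _) (sym (δ-≢ x≢l))))
      by-cases (no x≢l) (no y≢l) = trans (eliminate-other x≢l y)
        (trans (+-congˡ (-0≈0 (*0≈0 (u-off y py y≢l))))
          (trans (+-identityʳ _) (row-δ x y px py x≢l y≢l)))

  eliminate∈ : {W : Pred (Fin n → 𝕂) ℓ} → Closed W → ∀ (row : Fin n → Fin n → 𝕂) {u} l x →
    u ∈ W → (x ≢ l → row x ∈ W) → eliminate row u l x ∈ W
  eliminate∈ W-closed row l x u∈ row∈ with x Fin.≟ l
  ... | yes _   = u∈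
  ... | no  x≢l = closed-+ W-closed 1# (- row x l) (row∈ x≢l) u∈

  -- The summand 0 * 0 gives the row the shape required by closed-+.
  normalise : (u : Fin n → 𝕂) {l : Fin n} → u l ≉ 0# → Fin n → 𝕂
  normalise u {l} ul≉0 y = u l ⁻¹[ ul≉0 ] * u y + 0# * 0#

  normalise-≈ : (u : Fin n → 𝕂) {l : Fin n} (ul≉0 : u l ≉ 0#) → ∀ y → normalise u ul≉0 y ≈ u l ⁻¹[ ul≉0 ] * u y
  normalise-≈ u ul≉0 y = +0≈ (zeroˡ 0#)

  normalise-1 : (u : Fin n → 𝕂) {l : Fin n} (ul≉0 : u l ≉ 0#) → normalise u ul≉0 l ≈ 1#
  normalise-1 u ul≉0 = trans (normalise-≈ u ul≉0 _) (trans (*-comm _ _) (*-inv ul≉0))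

  normalise-0 : (u : Fin n → 𝕂) {l : Fin n} (ul≉0 : u l ≉ 0#) → ∀ {y} → u y ≈ 0# → normalise u ul≉0 y ≈ 0#
  normalise-0 u ul≉0 {y} e = trans (normalise-≈ u ul≉0 y) (*0≈0 e)

  module _ {W : Pred (Fin n → 𝕂) ℓ} (W-closed : Closed W) where

    -- A vector that vanishes on the new index set vanishes on `S` except perhaps at `b`; its
    -- expansion at `l` then reduces to `v b * row b l`, which forces `v b` to vanish as well.
    pivot : ∀ {S} (R : Reduced W S) {b l} → lookup S b ≡ true → lookup S l ≡ false →
      (≉0 : Reduced.row R b l ≉ 0#) → Reduced W (swap S b l)
    pivot {S} R {b} {l} pb pl ≉0 = mkReduced W-closed (swap S b l) (eliminate row u l)
      (λ x _ → eliminate∈ W-closed row l x (closed-+ W-closed _ _ (row∈ b) (closed-zero W-closed)) (λ _ → row∈ x))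
      (eliminate-δ row u l (normalise-1 (row b) ≉0) (λ x → lookup (swap S b l) x ≡ true)
        (λ y p y≢l → normalise-0 (row b) ≉0 (row-off b y (old p y≢l) (λ e → ≢b p y≢l (≡.sym e))))
        (λ x y p q x≢l y≢l → row-δ x y (old p x≢l) (old q y≢l)))
      det′
      where
      open Reduced R
      u = normalise (row b) ≉0
      b≢l : b ≢ l
      b≢l ≡.refl = true≢false pb pl
      ≢b : ∀ {x} → lookup (swap S b l) x ≡ true → x ≢ l → x ≢ b
      ≢b p _ ≡.refl = true≢false p (swap-old S b≢l)
      old : ∀ {x} → lookup (swap S b l) x ≡ true → x ≢ l → lookup S x ≡ true
      old p x≢l = ≡.trans (≡.sym (swap-other S x≢l (≢b p x≢l))) p
      det′ : ∀ v → v ∈ W → (∀ x → lookup (swap S b l) x ≡ true → v x ≈ 0#) → v ≋ (λ _ → 0#)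
      det′ v v∈ e = determined v v∈ on-S
        where
        others : ∀ x → lookup S x ≡ true → x ≢ b → v x ≈ 0#
        others x p x≢b = e x (≡.trans (swap-other S (λ { ≡.refl → true≢false p pl }) x≢b) p)
        term : ∀ x → x ≢ b → v x * row x l ≈ 0#
        term x x≢b with lookup S x in eq
        ... | true  = 0*≈0 (others x eq x≢b)
        ... | false = *0≈0 (row-out x eq l)
        vb : v b ≈ 0#
        vb = *-cancel-0 ≉0 (trans (*-comm _ _) (trans (sym (sum-single (λ x → v x * row x l) b term))
          (trans (sym (expansion W-closed R v v∈ l)) (e l (swap-new S)))))
        on-S : ∀ x → lookup S x ≡ true → v x ≈ 0#
        on-S x p with x Fin.≟ b
        ... | yes ≡.refl = vb
        ... | no  x≢b    = others x p x≢b

    module _ {S} (R : Reduced W S) {b l} (pb : lookup S b ≡ true) (pl : lookup S l ≡ false)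
      (≉0 : Reduced.row R b l ≉ 0#) where
      open Reduced R
      private
        R′ = pivot R pb pl ≉0
        S′ = swap S b l

        unmask : ∀ {x} → lookup S′ x ≡ true → ∀ y → Reduced.row R′ x y ≡ eliminate row (normalise (row b) ≉0) l x y
        unmask {x} p y with lookup S′ x | p
        ... | .true | ≡.refl = ≡.refl

      pivot-row-new : ∀ y → Reduced.row R′ l y ≈ row b l ⁻¹[ ≉0 ] * row b y
      pivot-row-new y = trans (reflexive (≡.trans (unmask (swap-new S) y)
        (≡.cong (λ f → f y) (eliminate-pivot row _ l)))) (normalise-≈ (row b) ≉0 y)

      pivot-row-other : ∀ {x} → lookup S x ≡ true → x ≢ b → ∀ y →
        Reduced.row R′ x y ≈ row x y - row x l * (row b l ⁻¹[ ≉0 ] * row b y)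
      pivot-row-other {x} p x≢b y = trans
        (trans (reflexive (unmask (≡.trans (swap-other S x≢l x≢b) p) y)) (eliminate-other row _ l x≢l y))
        (+-congˡ (-‿cong (*-congˡ (normalise-≈ (row b) ≉0 y))))
        where
        x≢l : x ≢ l
        x≢l ≡.refl = true≢false p pl

  module _ {W : Pred (Fin n → 𝕂) 0ℓ} (W-closed : Closed W) where
    private
      Free : Subset n → Set
      Free S = ∃[ v ] v ∈ W × (∀ b → lookup S b ≡ true → v b ≈ 0#) × ∃[ l ] v l ≉ 0#

      -- As long as a nonzero vector of `W` vanishes on `S`, it can be normalised at a nonzero
      -- coordinate `l`, and `l` joins `S`. The old rows only have to be cleared at `l`, since the
      -- new one is already zero on `S`.
      grow : ∀ S → Acc _⊃_ S → (row : Fin n → Fin n → 𝕂) → (∀ b → lookup S b ≡ true → row b ∈ W) →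
        (∀ b b′ → lookup S b ≡ true → lookup S b′ ≡ true → row b b′ ≈ δ b b′) → ∃[ S ] Reduced W S
      grow S (acc rec) row row∈ row-δ with em (Free S)
      ... | no ¬free = S , mkReduced W-closed S row row∈ row-δ λ v v∈ v0 l →
              by-contradiction (λ vl≉0 → ¬free (v , v∈ , v0 , l , vl≉0))
      ... | yes (v , v∈ , v0 , l , vl≉0) = grow S′ (rec (S⊆S′ , l , lookup⇒∈ (insert-new S l) , l∉S)) (eliminate row u l)
              (λ x p → eliminate∈ W-closed row l x (closed-+ W-closed _ _ v∈ (closed-zero W-closed))
                (λ x≢l → row∈ x (old p x≢l)))
              (eliminate-δ row u l (normalise-1 v vl≉0) (λ x → lookup S′ x ≡ true)
                (λ y p y≢l → normalise-0 v vl≉0 (v0 y (old p y≢l)))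
                (λ x y p q x≢l y≢l → row-δ x y (old p x≢l) (old q y≢l)))
        where
        S′ = ⁅ S ≔ l ⁆
        u = normalise v vl≉0
        l∉S : ¬ l ∈ₛ S
        l∉S l∈S = vl≉0 (v0 l (∈⇒lookup l∈S))
        old : ∀ {x} → lookup S′ x ≡ true → x ≢ l → lookup S x ≡ true
        old p x≢l = ≡.trans (≡.sym (insert-other S x≢l)) p
        S⊆S′ : ∀ {x} → x ∈ₛ S → x ∈ₛ S′
        S⊆S′ {x} x∈S with x Fin.≟ l
        ... | yes ≡.refl = contradiction x∈S l∉S
        ... | no  x≢l    = lookup⇒∈ (≡.trans (insert-other S x≢l) (∈⇒lookup x∈S))

    abstract
      reduced-exists : ∃[ S ] Reduced W S
      reduced-exists = grow Subset.⊥ (⊃-wellFounded _) (λ _ _ → 0#)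
        (λ b p → contradiction (lookup⇒∈ {S = Subset.⊥ {n}} {l = b} p) Subset.∉⊥)
        (λ b _ p → contradiction (lookup⇒∈ {S = Subset.⊥ {n}} {l = b} p) Subset.∉⊥)

-- Alternating multilinear forms.

module Determinants {K : CommutativeRing 0ℓ 0ℓ} (F : ClassicalField K) where
  open Bases F public

  private variable
    k m n : ℕ
    ι : Set

  module _ {V : Set} where

    _◂_ : V → (Fin k → V) → Fin (suc k) → V
    (v ◂ u) zero    = v
    (v ◂ u) (suc i) = u i

  Repeats : ((Fin (suc k) → ι → 𝕂) → 𝕂) → Set
  Repeats {zero}  D = ⊤
  Repeats {suc k} D = ∀ v u → D (v ◂ (v ◂ u)) ≈ 0#

  -- Linearity and the vanishing on repetitions are only required of the first
  -- arguments, and recursively of the form that remains once they are fixed.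
  Alternating : ((Fin k → ι → 𝕂) → 𝕂) → Set
  Alternating {zero}  D = ⊤
  Alternating {suc k} {ι} D =
    (∀ a v b w u → D ((λ i → a * v i + b * w i) ◂ u) ≈ a * D (v ◂ u) + b * D (w ◂ u)) ×
    (∀ v → Alternating (λ u → D (v ◂ u))) ×
    Repeats D

  -- Replaces extensionality: families rebuilt with `◂` agree with the given ones only pointwise.
  Congruent : ((Fin k → ι → 𝕂) → 𝕂) → Set
  Congruent D = ∀ {u w} → (∀ i → u i ≋ w i) → D u ≈ D w

  ◂-cong : {v v′ : ι → 𝕂} {u u′ : Fin k → ι → 𝕂} → v ≋ v′ → (∀ i → u i ≋ u′ i) → ∀ i → (v ◂ u) i ≋ (v′ ◂ u′) i
  ◂-cong e e′ zero    = e
  ◂-cong e e′ (suc i) = e′ i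

  ◂-eta : (u : Fin (suc k) → ι → 𝕂) → ∀ i → u i ≋ (u zero ◂ (u ∘ suc)) i
  ◂-eta u zero    j = refl
  ◂-eta u (suc i) j = refl

  ≋-refl : {v : ι → 𝕂} → v ≋ v
  ≋-refl i = refl

  tail-congruent : {D : (Fin (suc k) → ι → 𝕂) → 𝕂} → Congruent D → ∀ v → Congruent (λ u → D (v ◂ u))
  tail-congruent C v e = C (◂-cong ≋-refl e)

  module _ (D : (Fin (suc (suc k)) → ι → 𝕂) → 𝕂) (C : Congruent D) (A : Alternating D) where
    private
      linear₀ = proj₁ A
      linear₁ : ∀ x a v b w u → D (x ◂ ((λ i → a * v i + b * w i) ◂ u)) ≈ a * D (x ◂ (v ◂ u)) + b * D (x ◂ (w ◂ u))
      linear₁ x = proj₁ (proj₁ (proj₂ A) x)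
      repeat = proj₂ (proj₂ A)

    alternating-swap : ∀ v w u → D (v ◂ (w ◂ u)) ≈ - D (w ◂ (v ◂ u))
    alternating-swap v w u = begin
      vw                    ≈⟨ solve 2 (λ x y → x := x :+ y :- y) refl vw wv ⟩
      (vw + wv) - wv        ≈⟨ +-congʳ vw+wv ⟩
      0# - wv               ≈⟨ +-identityˡ _ ⟩
      - wv                  ∎
      where
      open ≈-Reasoning
      vw = D (v ◂ (w ◂ u))
      wv = D (w ◂ (v ◂ u))
      s = λ i → 1# * v i + 1# * w i
      vw+wv : vw + wv ≈ 0#
      vw+wv = begin
        vw + wv
          ≈⟨ +-cong (trans (sym (*-identityˡ _)) (sym (0+≈ (*0≈0 (repeat v u)))))
                    (trans (sym (*-identityˡ _)) (sym (+0≈ (*0≈0 (repeat w u))))) ⟩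
        (1# * D (v ◂ (v ◂ u)) + 1# * vw) + (1# * wv + 1# * D (w ◂ (w ◂ u)))
          ≈⟨ +-cong (sym (linear₁ v 1# v 1# w u)) (sym (linear₁ w 1# v 1# w u)) ⟩
        D (v ◂ (s ◂ u)) + D (w ◂ (s ◂ u))
          ≈⟨ +-cong (sym (*-identityˡ _)) (sym (*-identityˡ _)) ⟩
        1# * D (v ◂ (s ◂ u)) + 1# * D (w ◂ (s ◂ u))
          ≈⟨ linear₀ 1# v 1# w (s ◂ u) ⟨
        D (s ◂ (s ◂ u))
          ≈⟨ repeat s u ⟩
        0# ∎

  -‿^ : ∀ j x → (- 1#) ^ suc j * x ≈ - ((- 1#) ^ j * x)
  -‿^ j x = trans (*-assoc _ _ _) (trans (sym (-‿distribˡ-* 1# _)) (-‿cong (*-identityˡ _)))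

  removeAt-suc : (u : Fin (suc (suc k)) → ι → 𝕂) (j : Fin (suc k)) → ∀ i →
    (u ∘ punchIn (suc j)) i ≋ (u zero ◂ (u ∘ suc ∘ punchIn j)) i
  removeAt-suc u j zero    = ≋-refl
  removeAt-suc u j (suc i) = ≋-refl

  alternating-move : (D : (Fin (suc k) → ι → 𝕂) → 𝕂) → Congruent D → Alternating D → ∀ u j →
    D (u j ◂ (u ∘ punchIn j)) ≈ (- 1#) ^ toℕ j * D u
  alternating-move D C A u zero = trans (C (λ { zero → ≋-refl ; (suc i) → ≋-refl })) (sym (*-identityˡ _))
  alternating-move {suc k} D C A u (suc j) = begin
    D (u (suc j) ◂ (u ∘ punchIn (suc j)))
      ≈⟨ C (◂-cong ≋-refl (removeAt-suc u j)) ⟩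
    D (u (suc j) ◂ (u zero ◂ (u ∘ suc ∘ punchIn j)))
      ≈⟨ alternating-swap D C A _ _ _ ⟩
    - D (u zero ◂ (u (suc j) ◂ (u ∘ suc ∘ punchIn j)))
      ≈⟨ -‿cong (alternating-move (λ w → D (u zero ◂ w)) (tail-congruent C _) (proj₁ (proj₂ A) _) (u ∘ suc) j) ⟩
    - ((- 1#) ^ toℕ j * D (u zero ◂ (u ∘ suc)))
      ≈⟨ -‿cong (*-congˡ (C (λ i → λ l → sym (◂-eta u i l)))) ⟩
    - ((- 1#) ^ toℕ j * D u)
      ≈⟨ -‿^ (toℕ j) (D u) ⟨
    (- 1#) ^ toℕ (suc j) * D u ∎
    where open ≈-Reasoning

  alternating-repeat : (D : (Fin (suc k) → ι → 𝕂) → 𝕂) → Congruent D → Alternating D → ∀ u p → D (u p ◂ u) ≈ 0#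
  alternating-repeat {suc k} D C A u zero = trans (C (◂-cong ≋-refl (◂-eta u))) (proj₂ (proj₂ A) _ _)
  alternating-repeat {suc k} D C A u (suc p) = begin
    D (u (suc p) ◂ u)                              ≈⟨ C (◂-cong ≋-refl (◂-eta u)) ⟩
    D (u (suc p) ◂ (u zero ◂ (u ∘ suc)))           ≈⟨ alternating-swap D C A _ _ _ ⟩
    - D (u zero ◂ (u (suc p) ◂ (u ∘ suc)))
      ≈⟨ -‿cong (alternating-repeat (λ w → D (u zero ◂ w)) (tail-congruent C _) (proj₁ (proj₂ A) _) (u ∘ suc) p) ⟩
    - 0#                                           ≈⟨ -0#≈0# ⟩
    0#                                             ∎
    where open ≈-Reasoning

  -- In the second place a multiple of `v` creates a repetition and can be removed; swapping that
  -- argument to the front leaves `v` leading among the rest, ready for the next step.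
  alternating-shear : (D : (Fin (suc k) → ι → 𝕂) → 𝕂) → Congruent D → Alternating D → ∀ v u (c : Fin k → 𝕂) →
    D (v ◂ (λ p i → u p i + c p * v i)) ≈ D (v ◂ u)
  alternating-shear {zero}  D C A v u c = C (◂-cong ≋-refl (λ ()))
  alternating-shear {suc k} D C A v u c = begin
    D (v ◂ u′)
      ≈⟨ C (◂-cong ≋-refl (λ { zero i → +-congʳ (sym (*-identityˡ _)) ; (suc p) i → refl })) ⟩
    D (v ◂ ((λ i → 1# * u zero i + c zero * v i) ◂ (u′ ∘ suc)))
      ≈⟨ proj₁ (proj₁ (proj₂ A) v) 1# (u zero) (c zero) v (u′ ∘ suc) ⟩
    1# * D (v ◂ (u zero ◂ (u′ ∘ suc))) + c zero * D (v ◂ (v ◂ (u′ ∘ suc)))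
      ≈⟨ +-cong (*-identityˡ _) (*0≈0 (proj₂ (proj₂ A) _ _)) ⟩
    D (v ◂ (u zero ◂ (u′ ∘ suc))) + 0#
      ≈⟨ trans (+-identityʳ _) (alternating-swap D C A _ _ _) ⟩
    - D (u zero ◂ (v ◂ (u′ ∘ suc)))
      ≈⟨ -‿cong (alternating-shear (λ w → D (u zero ◂ w)) (tail-congruent C _) (proj₁ (proj₂ A) _) v (u ∘ suc) (c ∘ suc)) ⟩
    - D (u zero ◂ (v ◂ (u ∘ suc)))
      ≈⟨ alternating-swap D C A _ _ _ ⟨
    D (v ◂ (u zero ◂ (u ∘ suc)))
      ≈⟨ C (◂-cong ≋-refl (λ i l → sym (◂-eta u i l))) ⟩
    D (v ◂ u) ∎
    where
    open ≈-Reasoning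
    u′ = λ p i → u p i + c p * v i

  alternating-sum : (D : (Fin (suc k) → ι → 𝕂) → 𝕂) → Congruent D → Alternating D → ∀ (c : Fin m → 𝕂) w u →
    D (combination c w ◂ u) ≈ sum (λ j → c j * D (w j ◂ u))
  alternating-sum {m = zero} D C A c w u = begin
    D ((λ _ → 0#) ◂ u)
      -- The zero vector is rewritten as a combination with zero coefficients, to which linearity
      -- applies.
      ≈⟨ C (◂-cong (λ i → sym (trans (+-congʳ (zeroˡ _)) (trans (+-identityˡ _) (zeroˡ _)))) (λ _ → ≋-refl)) ⟩
    D ((λ _ → 0# * 0# + 0# * 0#) ◂ u)                            ≈⟨ proj₁ A 0# (λ _ → 0#) 0# (λ _ → 0#) u ⟩
    0# * D ((λ _ → 0#) ◂ u) + 0# * D ((λ _ → 0#) ◂ u)            ≈⟨ trans (+-cong (zeroˡ _) (zeroˡ _)) (+-identityˡ _) ⟩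
    0#                                                           ∎
    where open ≈-Reasoning
  alternating-sum {m = suc m} D C A c w u = begin
    D ((λ i → c zero * w zero i + rest i) ◂ u)
      ≈⟨ C (◂-cong (λ i → +-congˡ (sym (*-identityˡ _))) (λ _ → ≋-refl)) ⟩
    D ((λ i → c zero * w zero i + 1# * rest i) ◂ u)
      ≈⟨ proj₁ A (c zero) (w zero) 1# rest u ⟩
    c zero * D (w zero ◂ u) + 1# * D (rest ◂ u)
      ≈⟨ +-congˡ (trans (*-identityˡ _) (alternating-sum D C A (c ∘ suc) (w ∘ suc) u)) ⟩
    c zero * D (w zero ◂ u) + sum (λ j → c (suc j) * D (w (suc j) ◂ u)) ∎
    where
    open ≈-Reasoning
    rest = combination (c ∘ suc) (w ∘ suc)

  det-cong : {A B : Fin n → Fin n → 𝕂} → (∀ i j → A i j ≈ B i j) → det A ≈ det B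
  det-cong {zero}  e = refl
  det-cong {suc n} e = sum-cong-≋ (λ j → *-congˡ {(- 1#) ^ toℕ j} (*-cong (e zero j) (det-cong (λ p q → e (suc p) (punchIn j q)))))

  -- One induction yields both the change of basis (`D` a minor) and multiplicativity (`D` equal to
  -- `det`). After expansion of the first row, the multiples of `u j` in the other rows are sheared
  -- off, which leaves the minor without column `j`.
  alternating-det : (D : (Fin k → ι → 𝕂) → 𝕂) → Congruent D → Alternating D → ∀ (A : Fin k → Fin k → 𝕂) u →
    D (λ i → combination (A i) u) ≈ det A * D u
  alternating-det {zero}  D C alt A u = trans (C (λ ())) (sym (*-identityˡ _))
  alternating-det {suc k} D C alt A u = begin
    D (λ i → combination (A i) u)
      ≈⟨ C (◂-eta _) ⟩
    D (combination (A zero) u ◂ (λ p → combination (A (suc p)) u))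
      ≈⟨ alternating-sum D C alt (A zero) u _ ⟩
    sum (λ j → A zero j * D (u j ◂ (λ p → combination (A (suc p)) u)))
      ≈⟨ sum-cong-≋ expand ⟩
    sum (λ j → ((- 1#) ^ toℕ j * (A zero j * minor j)) * D u)
      ≈⟨ *-distribʳ-sum (D u) (λ j → (- 1#) ^ toℕ j * (A zero j * minor j)) ⟨
    det A * D u ∎
    where
    open ≈-Reasoning
    minor : Fin (suc k) → 𝕂
    minor j = det (λ p q → A (suc p) (punchIn j q))
    expand : ∀ j → A zero j * D (u j ◂ (λ p → combination (A (suc p)) u)) ≈ ((- 1#) ^ toℕ j * (A zero j * minor j)) * D u
    expand j = begin
      A zero j * D (u j ◂ (λ p → combination (A (suc p)) u))
        ≈⟨ *-congˡ (C (◂-cong ≋-refl (λ p i → trans (sum-remove {i = j} (λ q → A (suc p) q * u q i)) (+-comm _ _)))) ⟩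
      A zero j * D (u j ◂ (λ p i → combination (A (suc p) ∘ punchIn j) (u ∘ punchIn j) i + A (suc p) j * u j i))
        ≈⟨ *-congˡ (alternating-shear D C alt (u j) _ (λ p → A (suc p) j)) ⟩
      A zero j * D (u j ◂ (λ p → combination (A (suc p) ∘ punchIn j) (u ∘ punchIn j)))
        ≈⟨ *-congˡ (alternating-det (λ w → D (u j ◂ w)) (tail-congruent C _) (proj₁ (proj₂ alt) _) _ (u ∘ punchIn j)) ⟩
      A zero j * (minor j * D (u j ◂ (u ∘ punchIn j)))
        ≈⟨ *-congˡ (*-congˡ (alternating-move D C alt u j)) ⟩
      A zero j * (minor j * ((- 1#) ^ toℕ j * D u))
        ≈⟨ solve 4 (λ a m s d → a :* (m :* (s :* d)) := (s :* (a :* m)) :* d) refl (A zero j) (minor j) ((- 1#) ^ toℕ j) (D u) ⟩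
      ((- 1#) ^ toℕ j * (A zero j * minor j)) * D u ∎

-- Determinants and minors by Laplace expansion.

module Minors {K : CommutativeRing 0ℓ 0ℓ} (F : ClassicalField K) where
  open Determinants F public

  private variable
    ℓ : Level
    k m n : ℕ
    ι : Set

  sign : Fin n → 𝕂
  sign j = (- 1#) ^ toℕ j

  combination-of-alternating : (s c : Fin m → 𝕂) (D : Fin m → (Fin k → ι → 𝕂) → 𝕂) → (∀ j → Alternating (D j)) →
    Alternating (λ u → sum (λ j → s j * (c j * D j u)))
  combination-of-alternating {k = zero}  s c D A = tt
  combination-of-alternating {k = suc k} s c D A =
    (λ a v b w u → begin
      sum (λ j → s j * (c j * D j ((λ i → a * v i + b * w i) ◂ u)))
        ≈⟨ sum-cong-≋ (λ j → trans (*-congˡ (*-congˡ (proj₁ (A j) a v b w u)))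
             (solve 6 (λ s c a x b y → s :* (c :* (a :* x :+ b :* y)) := a :* (s :* (c :* x)) :+ b :* (s :* (c :* y))) refl
               (s j) (c j) a (D j (v ◂ u)) b (D j (w ◂ u)))) ⟩
      sum (λ j → a * (s j * (c j * D j (v ◂ u))) + b * (s j * (c j * D j (w ◂ u))))
        ≈⟨ ∑-distrib-+ (λ j → a * (s j * (c j * D j (v ◂ u)))) (λ j → b * (s j * (c j * D j (w ◂ u)))) ⟩
      sum (λ j → a * (s j * (c j * D j (v ◂ u)))) + sum (λ j → b * (s j * (c j * D j (w ◂ u))))
        ≈⟨ +-cong (*-distribˡ-sum a (λ j → s j * (c j * D j (v ◂ u)))) (*-distribˡ-sum b (λ j → s j * (c j * D j (w ◂ u)))) ⟨
      a * sum (λ j → s j * (c j * D j (v ◂ u))) + b * sum (λ j → s j * (c j * D j (w ◂ u))) ∎) ,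
    (λ v → combination-of-alternating s c (λ j u → D j (v ◂ u)) (λ j → proj₁ (proj₂ (A j)) v)) ,
    repeats k D A
    where
    open ≈-Reasoning
    repeats : ∀ k (D : Fin _ → (Fin (suc k) → _ → 𝕂) → 𝕂) → (∀ j → Alternating (D j)) →
      Repeats (λ u → sum (λ j → s j * (c j * D j u)))
    repeats zero    D A = tt
    repeats (suc k) D A v u = sum-zero (λ j → *0≈0 (*0≈0 (proj₂ (proj₂ (A j)) v u)))

  -- In a twofold Laplace expansion with equal first rows, removing column j and
  -- then l cancels against removing the same two columns in the other order.
  laplace-cancel : ∀ m (v : Fin (suc (suc m)) → 𝕂) (g : (Fin m → Fin (suc (suc m))) → 𝕂) →
    (∀ h h′ → (∀ q → h q ≡ h′ q) → g h ≈ g h′) →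
    sum (λ j → sign j * (v j * sum (λ l → sign l * (v (punchIn j l) * g (λ q → punchIn j (punchIn l q)))))) ≈ 0#
  laplace-cancel m v g g-cong = begin
    1# * (v zero * sum (λ l → first l)) + sum (λ j → sign (suc j) * (v (suc j) * (1# * (v zero * G j) + rest j)))
      ≈⟨ +-cong (trans (*-identityˡ _) (*-distribˡ-sum (v zero) first))
           (trans (sum-cong-≋ (λ j → split j (sign (suc j)) (rest j)))
             (∑-distrib-+ (λ j → sign (suc j) * (v (suc j) * (v zero * G j))) (λ j → sign (suc j) * (v (suc j) * rest j)))) ⟩
    sum (λ l → v zero * first l) +
      (sum (λ j → sign (suc j) * (v (suc j) * (v zero * G j))) + sum (λ j → sign (suc j) * (v (suc j) * rest j)))
      ≈⟨ +-congˡ (+-cong (trans (sum-cong-≋ negate) (sum-neg (λ l → v zero * first l))) (rest-zero m v g g-cong)) ⟩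
    sum (λ l → v zero * first l) + (- sum (λ l → v zero * first l) + 0#)
      ≈⟨ trans (+-congˡ (+-identityʳ _)) (-‿inverseʳ _) ⟩
    0# ∎
    where
    open ≈-Reasoning
    G : Fin (suc m) → 𝕂
    G l = g (λ q → suc (punchIn l q))
    first : Fin (suc m) → 𝕂
    first l = sign l * (v (suc l) * G l)
    inner : ∀ m → (Fin (suc (suc m)) → 𝕂) → ((Fin m → Fin (suc (suc m))) → 𝕂) → Fin (suc m) → 𝕂
    inner m v g j = sum (λ l → sign (suc l) * (v (suc (punchIn j l)) * g (λ q → punchIn (suc j) (punchIn (suc l) q))))
    rest = inner m v g
    split : ∀ j s r → s * (v (suc j) * (1# * (v zero * G j) + r)) ≈ s * (v (suc j) * (v zero * G j)) + s * (v (suc j) * r)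
    split j s r = trans (*-congˡ (*-congˡ (+-congʳ (*-identityˡ _))))
      (solve 4 (λ s v x r → s :* (v :* (x :+ r)) := s :* (v :* x) :+ s :* (v :* r)) refl s (v (suc j)) (v zero * G j) r)
    negate : ∀ j → sign (suc j) * (v (suc j) * (v zero * G j)) ≈ - (v zero * first j)
    negate j = trans (-‿^ (toℕ j) _) (-‿cong
      (solve 4 (λ s a b g → s :* (a :* (b :* g)) := b :* (s :* (a :* g))) refl (sign j) (v (suc j)) (v zero) (G j)))
    -- Neither removed column is now the column zero: the sum is the one for `v ∘ suc`, with column
    -- zero moved into `g` by `lift`. Passing from `suc j` and `suc l` to `j` and `l` changes the
    -- sign twice.
    rest-zero : ∀ m (v : Fin (suc (suc m)) → 𝕂) (g : (Fin m → Fin (suc (suc m))) → 𝕂) →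
      (∀ h h′ → (∀ q → h q ≡ h′ q) → g h ≈ g h′) →
      sum (λ j → sign (suc j) * (v (suc j) * inner m v g j)) ≈ 0#
    rest-zero zero    v g g-cong = sum-zero {f = λ j → sign (suc j) * (v (suc j) * inner zero v g j)}
      (λ j → *0≈0 (zeroʳ _))
    rest-zero (suc m) v g g-cong = trans (sum-cong-≋ step)
      (laplace-cancel m (v ∘ suc) g′ (λ h h′ e → g-cong (lift h) (lift h′) (λ { zero → ≡.refl ; (suc q) → ≡.cong suc (e q) })))
      where
      lift : (Fin m → Fin (suc (suc m))) → Fin (suc m) → Fin (suc (suc (suc m)))
      lift h zero    = zero
      lift h (suc q) = suc (h q)
      g′ : (Fin m → Fin (suc (suc m))) → 𝕂
      g′ h = g (lift h)
      term : ∀ j l → 𝕂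
      term j l = sign l * (v (suc (punchIn j l)) * g′ (λ q → punchIn j (punchIn l q)))
      negated : ∀ j → inner (suc m) v g j ≈ - sum (term j)
      negated j = trans (sum-cong-≋ (λ l → trans (-‿^ (toℕ l) _) (-‿cong (*-congˡ {sign l}
        (*-congˡ {v (suc (punchIn j l))} (g-cong (λ q → punchIn (suc j) (punchIn (suc l) q)) (lift (λ q → punchIn j (punchIn l q))) (λ { zero → ≡.refl ; (suc q) → ≡.refl }))))))) (sum-neg (term j))
      step : ∀ j → sign (suc j) * (v (suc j) * inner (suc m) v g j) ≈ sign j * (v (suc j) * sum (term j))
      step j = trans (-‿^ (toℕ j) _) (trans (-‿cong (*-congˡ (*-congˡ (negated j))))
        (solve 3 (λ s a x → :- (s :* (a :* (:- x))) := s :* (a :* x)) refl (sign j) (v (suc j)) (sum (term j))))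

  minor : (Fin k → ι) → (Fin k → ι → 𝕂) → 𝕂
  minor e u = det (λ i j → u i (e j))

  minor-congruent : (e : Fin k → ι) → Congruent (minor e)
  minor-congruent e E = det-cong (λ i j → E i (e j))

  minor-alternating : (e : Fin k → ι) → Alternating (minor e)
  minor-alternating {zero}  e = tt
  minor-alternating {suc k} e =
    (λ a v b w u → begin
      sum (λ j → sign j * ((a * v (e j) + b * w (e j)) * M u j))
        ≈⟨ sum-cong-≋ (λ j → solve 6 (λ s a v b w x → s :* ((a :* v :+ b :* w) :* x) := a :* (s :* (v :* x)) :+ b :* (s :* (w :* x)))
             refl (sign j) a (v (e j)) b (w (e j)) (M u j)) ⟩
      sum (λ j → a * (sign j * (v (e j) * M u j)) + b * (sign j * (w (e j) * M u j)))
        ≈⟨ ∑-distrib-+ (λ j → a * (sign j * (v (e j) * M u j))) (λ j → b * (sign j * (w (e j) * M u j))) ⟩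
      sum (λ j → a * (sign j * (v (e j) * M u j))) + sum (λ j → b * (sign j * (w (e j) * M u j)))
        ≈⟨ +-cong (*-distribˡ-sum a (λ j → sign j * (v (e j) * M u j))) (*-distribˡ-sum b (λ j → sign j * (w (e j) * M u j))) ⟨
      a * minor e (v ◂ u) + b * minor e (w ◂ u) ∎) ,
    (λ v → combination-of-alternating sign (v ∘ e) (λ j → minor (e ∘ punchIn j)) (λ j → minor-alternating _)) ,
    repeats k e
    where
    open ≈-Reasoning
    M : (Fin k → _ → 𝕂) → Fin (suc k) → 𝕂
    M u j = minor (e ∘ punchIn j) u
    repeats : ∀ k (e : Fin (suc k) → _) → Repeats (minor e)
    repeats zero    e = tt
    repeats (suc k) e v u = laplace-cancel k (v ∘ e) (λ h → minor (e ∘ h) u)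
      (λ h h′ E → det-cong (λ i j → reflexive (≡.cong (λ x → u i (e x)) (E j))))

  det-identity : ∀ n {A : Fin n → Fin n → 𝕂} → (∀ i j → A i j ≈ δ i j) → det A ≈ 1#
  det-identity zero    e = refl
  det-identity (suc n) {A} e = trans (sum-single (λ j → sign j * (A zero j * det (λ p q → A (suc p) (punchIn j q)))) zero (λ
      { zero    0≢0 → contradiction ≡.refl 0≢0
      ; (suc j) _   → *0≈0 (0*≈0 (e zero (suc j))) }))
    (trans (*-identityˡ _) (trans (*-cong (e zero zero) (det-identity n (λ i j → e (suc i) (suc j)))) (*-identityˡ _)))

  det-columns : ∀ {n} (A : Fin n → Fin n → 𝕂) (t : Fin n → 𝕂) → det (λ i j → A i j * t j) ≈ prod t * det A
  det-columns {zero}  A t = sym (*-identityˡ _)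
  det-columns {suc n} A t = trans (sum-cong-≋ (λ j → begin
      sign j * (A zero j * t j * det (λ p q → A (suc p) (punchIn j q) * t (punchIn j q)))
        ≈⟨ *-congˡ (*-congˡ (det-columns (λ p q → A (suc p) (punchIn j q)) (t ∘ punchIn j))) ⟩
      sign j * (A zero j * t j * (prod (t ∘ punchIn j) * M j))
        ≈⟨ solve 5 (λ s a t p m → s :* (a :* t :* (p :* m)) := (t :* p) :* (s :* (a :* m))) refl
             (sign j) (A zero j) (t j) (prod (t ∘ punchIn j)) (M j) ⟩
      (t j * prod (t ∘ punchIn j)) * (sign j * (A zero j * M j))
        ≈⟨ *-congʳ (sym (Π.sum-remove {i = j} t)) ⟩
      prod t * (sign j * (A zero j * M j)) ∎))
    (sym (*-distribˡ-sum (prod t) (λ j → sign j * (A zero j * M j))))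
    where
    open ≈-Reasoning
    M : Fin (suc n) → 𝕂
    M j = det (λ p q → A (suc p) (punchIn j q))

  det-rows : ∀ {n} (A : Fin n → Fin n → 𝕂) (ρ : Fin n → 𝕂) → det (λ i j → ρ i * A i j) ≈ prod ρ * det A
  det-rows {zero}  A ρ = sym (*-identityˡ _)
  det-rows {suc n} A ρ = trans (sum-cong-≋ (λ j → trans
      (*-congˡ (*-congˡ (det-rows (λ p q → A (suc p) (punchIn j q)) (ρ ∘ suc))))
      (solve 5 (λ s a t p m → s :* (t :* a :* (p :* m)) := (t :* p) :* (s :* (a :* m))) refl
             (sign j) (A zero j) (ρ zero) (prod (ρ ∘ suc)) (M j))))
    (sym (*-distribˡ-sum (prod ρ) (λ j → sign j * (A zero j * M j))))
    where
    M : Fin (suc n) → 𝕂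
    M j = det (λ p q → A (suc p) (punchIn j q))

  -- With row `j` moved to the front, `c j * D j` equals the sum of all `c i * D i`, because the
  -- other terms repeat a row; by linearity that sum is `det` with a zero first row.
  det-singular : (A : Fin n → Fin n → 𝕂) (c : Fin n → 𝕂) → ∃[ j ] c j ≉ 0# → combination c A ≋ (λ _ → 0#) → det A ≈ 0#
  det-singular {suc n} A c (j , cj≉0) e = *-cancel-0 (-‿^≉0 (toℕ j)) (*-cancel-0 cj≉0 (begin
    c j * (sign j * det A)
      ≈⟨ *-congˡ (sym (alternating-move det C alt A j)) ⟩
    c j * D j
      ≈⟨ sum-single (λ i → c i * D i) j (λ i i≢j → *0≈0 (repeated i i≢j)) ⟨
    sum (λ i → c i * D i)
      ≈⟨ alternating-sum det C alt c A R ⟨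
    det (combination c A ◂ (A ∘ punchIn j))
      ≈⟨ C {combination c A ◂ R} {(λ i → 0# * A j i + 0# * A j i) ◂ R} (◂-cong (λ i → trans (e i) (sym (trans (+-congʳ (zeroˡ _)) (trans (+-identityˡ _) (zeroˡ _))))) (λ _ → ≋-refl)) ⟩
    det ((λ i → 0# * A j i + 0# * A j i) ◂ (A ∘ punchIn j))
      ≈⟨ proj₁ alt 0# (A j) 0# (A j) R ⟩
    0# * D j + 0# * D j
      ≈⟨ trans (+-cong (zeroˡ _) (zeroˡ _)) (+-identityˡ _) ⟩
    0# ∎))
    where
    open ≈-Reasoning
    C : Congruent {suc n} det
    C {u} {w} = minor-congruent (id {A = Fin (suc n)}) {u} {w}
    alt = minor-alternating (id {A = Fin (suc n)})
    R = A ∘ punchIn j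
    D : Fin (suc n) → 𝕂
    D i = det (A i ◂ R)
    repeated : ∀ i → i ≢ j → D i ≈ 0#
    repeated i i≢j = trans (C {A i ◂ R} {R (punchOut (i≢j ∘ ≡.sym)) ◂ R} (◂-cong (λ l → reflexive (≡.cong (λ x → A x l)
        (≡.sym (Fin.punchIn-punchOut (i≢j ∘ ≡.sym))))) (λ _ → ≋-refl)))
      (alternating-repeat det C alt (A ∘ punchIn j) (punchOut (i≢j ∘ ≡.sym)))
    -‿^≉0 : ∀ k → (- 1#) ^ k ≉ 0#
    -‿^≉0 zero    = 1≉0
    -‿^≉0 (suc k) = *-≉0 (-‿≉0 1≉0) (-‿^≉0 k)

  module _ {W : Pred (ι → 𝕂) ℓ} (H H′ : HasDimension W k) where
    private
      b = HasDimension.basis H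
      b′ = HasDimension.basis H′
      A = λ j → proj₁ (Equivalence.to (HasDimension.spans H (b′ j)) (basis∈ H′ j))
      A-≋ = λ j → proj₂ (Equivalence.to (HasDimension.spans H (b′ j)) (basis∈ H′ j))
      B = λ j → proj₁ (Equivalence.to (HasDimension.spans H′ (b j)) (basis∈ H j))
      B-≋ = λ j → proj₂ (Equivalence.to (HasDimension.spans H′ (b j)) (basis∈ H j))
      BA : ∀ i j → combination (B i) A j ≈ δ i j
      BA i = coefficients-unique H (combination (B i) A) (δ i) (λ l → begin
        combination (combination (B i) A) b l               ≈⟨ combination-assoc (B i) A b l ⟩
        combination (B i) (λ j → combination (A j) b) l     ≈⟨ combination-cong {c = B i} (λ _ → refl) A-≋ l ⟨
        combination (B i) b′ l                              ≈⟨ B-≋ i l ⟨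
        b i l
          ≈⟨ trans (sum-single _ i (λ p p≢i → 0*≈0 (δ-≢ (p≢i ∘ ≡.sym))))
               (1*≈ (δ-same i)) ⟨
        combination (δ i) b l                               ∎)
        where open ≈-Reasoning

    -- The matrices that express the two bases in each other multiply to the identity, so `det A`
    -- has an inverse.
    minor-change-of-basis : ∃[ c ] c ≉ 0# × (∀ e → minor e b′ ≈ c * minor e b)
    minor-change-of-basis = det A , detA≉0 , λ e → trans (minor-congruent e A-≋)
      (alternating-det (minor e) (minor-congruent e) (minor-alternating e) A b)
      where
      detA≉0 : det A ≉ 0#
      detA≉0 = ≉0-factorʳ {det B} (≉0-cong (sym (trans
        (sym (alternating-det det (minor-congruent id) (minor-alternating id) B A)) (det-identity _ BA))) 1≉0)

-- Plücker coordinates, torus weights and change of basis.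

module PlückerCoordinates {K : CommutativeRing 0ℓ 0ℓ} (F : ClassicalField K) where
  open Minors F public

  private variable
    ℓ : Level
    k m n : ℕ
    ι : Set

  -- Defined for families that need not come from a `Gr`, so that rows and columns can be scaled
  -- freely.
  plü : (Fin k → Fin n → 𝕂) → KSubset k n → 𝕂
  plü u (S , ≡.refl) = minor (elements S) u

  plücker≡plü : (Y : Gr k (Fin n)) → ∀ I → plücker Y I ≡ plü (basis Y) I
  plücker≡plü Y (S , ≡.refl) = ≡.refl

  -- The character through which `t` acts on the coordinate `S`. Zero entries are allowed, as in the
  -- indicator vector that produces a torus-fixed point.
  weight : (Fin n → 𝕂) → Subset n → 𝕂
  weight t S = prod (λ l → if lookup S l then t l else 1#)

  if-cong : ∀ b {x y z w : 𝕂} → x ≈ y → z ≈ w → (if b then x else z) ≈ (if b then y else w)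
  if-cong true  e _ = e
  if-cong false _ e = e

  if-≉0 : ∀ b {x y : 𝕂} → x ≉ 0# → y ≉ 0# → (if b then x else y) ≉ 0#
  if-≉0 true  e _ = e
  if-≉0 false _ e = e

  weight-≉0 : {t : Fin n → 𝕂} → (∀ l → t l ≉ 0#) → ∀ S → weight t S ≉ 0#
  weight-≉0 e S = prod-≉0 (λ l → if-≉0 (lookup S l) (e l) 1≉0)

  plü-cong : {u u′ : Fin k → Fin n → 𝕂} → (∀ i → u i ≋ u′ i) → ∀ I → plü u I ≈ plü u′ I
  plü-cong e (S , ≡.refl) = minor-congruent (elements S) e

  plü-columns : (u : Fin k → Fin n → 𝕂) (t : Fin n → 𝕂) → ∀ I →
    plü (λ i l → u i l * t l) I ≈ weight t (proj₁ I) * plü u I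
  plü-columns u t (S , ≡.refl) = trans (det-columns (λ i j → u i (elements S j)) (t ∘ elements S)) (*-congʳ (prod-elements S t))

  plü-rows : (u : Fin k → Fin n → 𝕂) (ρ : Fin k → 𝕂) → ∀ I → plü (λ i l → ρ i * u i l) I ≈ prod ρ * plü u I
  plü-rows u ρ (S , ≡.refl) = det-rows (λ i j → u i (elements S j)) ρ

  plü-change-of-basis : {W : Pred (Fin n → 𝕂) ℓ} (H H′ : HasDimension W k) →
    ∃[ c ] c ≉ 0# × (∀ I → plü (HasDimension.basis H′) I ≈ c * plü (HasDimension.basis H) I)
  plü-change-of-basis H H′ = let (c , c≉0 , e) = minor-change-of-basis H H′ in
    c , c≉0 , λ { (S , ≡.refl) → e (elements S) }

  module _ {W : Pred (Fin n → 𝕂) ℓ} (H : HasDimension W k) where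
    private W-closed = closed H

    abstract
      reduced-size : ∀ {S} → Reduced W S → ∣ S ∣ ≡ k
      reduced-size R = dimension-unique (reduced⇒dimension W-closed R) H

    reduced⇒plü≉0 : ∀ {S} → Reduced W S → ∀ e → plü (HasDimension.basis H) (S , e) ≉ 0#
    reduced⇒plü≉0 {S} R ≡.refl p≈0 = 1≉0 (begin
      1#                                    ≈⟨ det-identity ∣ S ∣ (λ i j → trans (row-δ _ _ (elements∈ S i) (elements∈ S j)) (δ-elements S i j)) ⟨
      minor (elements S) (row ∘ elements S)  ≈⟨ proj₂ (proj₂ change) (S , ≡.refl) ⟩
      c * plü (HasDimension.basis H) (S , ≡.refl)  ≈⟨ trans (*-congˡ p≈0) (zeroʳ c) ⟩
      0#                                    ∎)
      where
      open ≈-Reasoning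
      open Reduced R
      change = plü-change-of-basis H (reduced⇒dimension W-closed R)
      c = proj₁ change

    -- The rows of the inverse matrix come from linear dependence: `δ j` and the rows of the
    -- nonsingular matrix `N` are one vector too many, and the coefficient of `δ j` in a relation
    -- cannot vanish.
    plü≉0⇒reduced : ∀ {S} e → plü (HasDimension.basis H) (S , e) ≉ 0# → Reduced W S
    plü≉0⇒reduced {S} ≡.refl detN≉0 = mkReduced W-closed S row row∈ row-δ determined
      where
      b = HasDimension.basis H
      N : Fin ∣ S ∣ → Fin ∣ S ∣ → 𝕂
      N i j = b i (elements S j)
      no-relation : ∀ c → combination c N ≋ (λ _ → 0#) → ∀ j → c j ≈ 0#
      no-relation c e j = by-contradiction (λ cj≉0 → detN≉0 (det-singular N c (j , cj≉0) e))
      determined : ∀ v → v ∈ W → (∀ b → lookup S b ≡ true → v b ≈ 0#) → v ≋ (λ _ → 0#)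
      determined v v∈ v0 l = trans (e l) (sum-zero {f = λ i → c i * b i l} (λ i → 0*≈0 (c0 i)))
        where
        c = proj₁ (Equivalence.to (HasDimension.spans H v) v∈)
        e = proj₂ (Equivalence.to (HasDimension.spans H v) v∈)
        c0 = no-relation c (λ j → trans (sym (e (elements S j))) (v0 _ (elements∈ S j)))
      module _ (j : Fin ∣ S ∣) where
        A : Fin (suc ∣ S ∣) → Fin ∣ S ∣ → 𝕂
        A zero    = δ j
        A (suc i) = N i
        relation = dependent ℕ.≤-refl A
        c = proj₁ relation
        c₀≉0 : c zero ≉ 0#
        c₀≉0 c₀≈0 = proj₂ (proj₁ (proj₂ relation)) (all-zero (proj₁ (proj₁ (proj₂ relation))))
          where
          all-zero : ∀ i → c i ≈ 0#
          all-zero zero    = c₀≈0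
          all-zero (suc i) = no-relation (c ∘ suc) (λ q → trans (sym (0+≈ (0*≈0 c₀≈0)))
            (proj₂ (proj₂ relation) q)) i
        c₀⁻¹ = c zero ⁻¹[ c₀≉0 ]
        row-of : Fin n → 𝕂
        row-of = combination (λ i → - c₀⁻¹ * c (suc i)) b
        row-of-δ : ∀ q → row-of (elements S q) ≈ δ j q
        row-of-δ q = begin
          sum (λ i → - c₀⁻¹ * c (suc i) * N i q)
            ≈⟨ trans (sum-cong-≋ (λ i → *-assoc (- c₀⁻¹) (c (suc i)) (N i q))) (sym (*-distribˡ-sum (- c₀⁻¹) (λ i → c (suc i) * N i q))) ⟩
          - c₀⁻¹ * s
            ≈⟨ solve 4 (λ r c d s → (:- r) :* s := (:- r) :* (c :* d :+ s) :+ (c :* r) :* d) refl c₀⁻¹ (c zero) (δ j q) s ⟩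
          - c₀⁻¹ * (c zero * δ j q + s) + (c zero * c₀⁻¹) * δ j q
            ≈⟨ +-cong (*0≈0 (proj₂ (proj₂ relation) q)) (1*≈ (*-inv c₀≉0)) ⟩
          0# + δ j q
            ≈⟨ +-identityˡ _ ⟩
          δ j q ∎
          where
          open ≈-Reasoning
          s = sum (λ i → c (suc i) * N i q)
      find : ∀ l → Dec (lookup S l ≡ true)
      find l = lookup S l Bool.≟ true
      index : ∀ l → lookup S l ≡ true → Fin ∣ S ∣
      index l p = proj₁ (elements-surjective S l p)
      elements-index : ∀ l p → elements S (index l p) ≡ l
      elements-index l p = proj₂ (elements-surjective S l p)
      row : Fin n → Fin n → 𝕂
      row l with find l
      ... | yes p = row-of (index l p)
      ... | no  _ = λ _ → 0#
      row∈ : ∀ l → lookup S l ≡ true → row l ∈ W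
      row∈ l p with find l
      ... | yes q = W-closed _ b (basis∈ H) _ (λ _ → refl)
      ... | no ¬q = contradiction p ¬q
      row-δ : ∀ l l′ → lookup S l ≡ true → lookup S l′ ≡ true → row l l′ ≈ δ l l′
      row-δ l l′ p p′ with find l
      ... | no ¬q = contradiction p ¬q
      ... | yes q = trans (reflexive (≡.cong (row-of (index l q)) (≡.sym (elements-index l′ p′))))
                      (trans (row-of-δ (index l q) (index l′ p′)) (trans (sym (δ-elements S _ _))
                        (reflexive (≡.cong₂ δ (elements-index l q) (elements-index l′ p′)))))

  module _ (X : Gr k (Fin n)) where

    X-closed : Closed (subspace X)
    X-closed = closed (dimension X)

    coordinate≉0 : ∃[ I ] plücker X I ≉ 0#
    coordinate≉0 = I , λ e → reduced⇒plü≉0 (dimension X) R (proj₂ I) (trans (sym (reflexive (plücker≡plü X I))) e)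
      where
      R = proj₂ (reduced-exists X-closed)
      I = proj₁ (reduced-exists X-closed) , reduced-size (dimension X) R

    translate : Torus n → Gr k (Fin n)
    translate T@(t , t≉0) = record
      { subspace = T · X
      ; dimension = record
        { basis = λ i l → t l * b i l
        ; independent = λ c e → independent c (λ l → *-cancel-0 (t≉0 l) (trans (sym (scaled c l)) (e l)))
        ; spans = λ v → mk⇔
            (λ (x , x∈ , e) → let (c , e′) = Equivalence.to (spans x) x∈ in
               c , λ l → trans (e l) (trans (*-congˡ (e′ l)) (sym (scaled c l))))
            (λ (c , e) → combination c b , Equivalence.from (spans _) (c , λ _ → refl) , λ l → trans (e l) (scaled c l)) } }
      where
      open HasDimension (dimension X) using (independent; spans) renaming (basis to b)
      scaled : ∀ c l → combination c (λ i l → t l * b i l) l ≈ t l * combination c b l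
      scaled c l = trans (sum-cong-≋ (λ i → solve 3 (λ c t b → c :* (t :* b) := t :* (c :* b)) refl (c i) (t l) (b i l)))
        (sym (*-distribˡ-sum (t l) (λ i → c i * b i l)))

    plücker-translate : ∀ T I → plücker (translate T) I ≈ weight (proj₁ T) (proj₁ I) * plücker X I
    plücker-translate T I = trans (reflexive (plücker≡plü (translate T) I))
      (trans (plü-cong (λ i l → *-comm _ _) I) (trans (plü-columns (basis X) (proj₁ T) I)
        (*-congˡ (sym (reflexive (plücker≡plü X I))))))

  subspace-determines-plücker : (Y Y′ : Gr k (Fin n)) → subspace Y ≐ subspace Y′ → plücker Y ∝ plücker Y′
  subspace-determines-plücker Y Y′ (Y⊆Y′ , Y′⊆Y) =
    let (c , c≉0 , e) = plü-change-of-basis (dimension Y′) H in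
    c , c≉0 , λ I → trans (reflexive (plücker≡plü Y I)) (trans (e I) (*-congˡ (sym (reflexive (plücker≡plü Y′ I)))))
    where
    open HasDimension (dimension Y)
    H : HasDimension (subspace Y′) _
    H = record { basis = HasDimension.basis (dimension Y) ; independent = independent ; spans = λ v → mk⇔
      (λ v∈ → Equivalence.to (spans v) (Y′⊆Y v∈)) (λ e → Y⊆Y′ (Equivalence.from (spans v) e)) }

  ∝-sym : {u v : ι → 𝕂} → u ∝ v → v ∝ u
  ∝-sym {u = u} {v} (c , c≉0 , e) = c ⁻¹[ c≉0 ] , inv≉0 c≉0 , λ i → sym (begin
    c ⁻¹[ c≉0 ] * u i        ≈⟨ *-congˡ (e i) ⟩
    c ⁻¹[ c≉0 ] * (c * v i)  ≈⟨ solve 3 (λ r c v → r :* (c :* v) := c :* r :* v) refl (c ⁻¹[ c≉0 ]) c (v i) ⟩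
    c * c ⁻¹[ c≉0 ] * v i    ≈⟨ 1*≈ (*-inv c≉0) ⟩
    v i                      ∎)
    where open ≈-Reasoning

  ∝-trans : {u v w : ι → 𝕂} → u ∝ v → v ∝ w → u ∝ w
  ∝-trans (c , c≉0 , e) (d , d≉0 , e′) = c * d , *-≉0 c≉0 d≉0 , λ i → trans (e i) (trans (*-congˡ (e′ i)) (sym (*-assoc _ _ _)))

  ≋⇒∝ : {u v : ι → 𝕂} → u ≋ v → u ∝ v
  ≋⇒∝ e = 1# , 1≉0 , λ i → trans (e i) (sym (*-identityˡ _))

-- One-variable polynomials, density, and Taylor expansion along a curve.

module Polynomials {K : CommutativeRing 0ℓ 0ℓ} (F : ClassicalField K) where
  open PlückerCoordinates F public

  private variable
    k m n : ℕ
    ι : Set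

  horner : Vec 𝕂 n → 𝕂 → 𝕂
  horner []      s = 0#
  horner (a ∷ p) s = a + s * horner p s

  quotient : Vec 𝕂 (suc n) → 𝕂 → Vec 𝕂 n
  quotient {zero}  _       r = []
  quotient {suc n} (a ∷ p) r = horner p r ∷ quotient p r

  factor-theorem : (p : Vec 𝕂 (suc n)) → ∀ r s → horner p s ≈ horner p r + (s - r) * horner (quotient p r) s
  factor-theorem {zero}  (a ∷ []) r s = trans (+-congˡ (zeroʳ s))
    (sym (trans (+-cong (+-congˡ (zeroʳ r)) (zeroʳ _)) (+-identityʳ _)))
  factor-theorem {suc n} (a ∷ p)  r s = trans (+-congˡ (*-congˡ (factor-theorem p r s)))
    (solve 5 (λ a s r x q → a :+ s :* (x :+ (s :- r) :* q) := (a :+ r :* x) :+ (s :- r) :* (x :+ s :* q)) refl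
      a s r (horner p r) (horner (quotient p r) s))

  _∈≈_ : 𝕂 → List 𝕂 → Set
  s ∈≈ R = Any (s ≈_) R

  -- Dividing out a root shortens the coefficient vector by one. Leading coefficients may vanish,
  -- hence the alternative that the function is zero.
  finitely-many-roots : (p : Vec 𝕂 n) → (∀ s → horner p s ≈ 0#) ⊎ (∃[ R ] ∀ s → horner p s ≈ 0# → s ∈≈ R)
  finitely-many-roots {zero}  [] = inj₁ (λ _ → refl)
  finitely-many-roots {suc n} p with em (∃[ r ] horner p r ≈ 0#)
  ... | no ¬root = inj₂ ([] , λ s e → contradiction (s , e) ¬root)
  ... | yes (r , root) with finitely-many-roots (quotient p r)
  ...   | inj₁ zero-quotient = inj₁ (λ s → trans (factor-theorem p r s)
            (trans (+-cong root (*0≈0 (zero-quotient s))) (+-identityʳ _)))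
  ...   | inj₂ (R , roots) = inj₂ (r ∷ R , λ s e → case em (s ≈ r) of λ
            { (yes s≈r) → here s≈r
            ; (no s≉r) → there (roots s (*-cancel-0 (λ e → s≉r (x-y≈0⇒x≈y e))
                (trans (sym (0+≈ root)) (trans (sym (factor-theorem p r s)) e)))) })

  natural : ℕ → 𝕂
  natural zero    = 0#
  natural (suc n) = 1# + natural n

  natural-injective : ∀ m n → natural m ≈ natural n → m ≡ n
  natural-injective zero    zero    e = ≡.refl
  natural-injective zero    (suc n) e = contradiction (trans (reflexive (natural-× (suc n))) (sym e)) (char0 n)
    where
    natural-× : ∀ n → Mult._×_ semiring n 1# ≡ natural n
    natural-× zero    = ≡.refl
    natural-× (suc n) = ≡.cong (1# +_) (natural-× n)
  natural-injective (suc m) zero    e = ≡.sym (natural-injective zero (suc m) (sym e))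
  natural-injective (suc m) (suc n) e = ≡.cong suc (natural-injective m n
    (trans (cancel (natural m)) (trans (+-congʳ e) (sym (cancel (natural n))))))
    where
    cancel : ∀ x → x ≈ (1# + x) - 1#
    cancel x = solve 2 (λ o x → x := (o :+ x) :- o) refl 1# x

  eventually-avoids : ∀ R → ∃[ m ] ∀ i → m ℕ.≤ i → ¬ natural i ∈≈ R
  eventually-avoids []      = 0 , λ _ _ ()
  eventually-avoids (r ∷ R) with eventually-avoids R
  ... | m , avoids with em (∃[ i ] m ℕ.≤ i × natural i ≈ r)
  ...   | no ¬hit = m , λ { i m≤i (here e) → ¬hit (i , m≤i , e) ; i m≤i (there e) → avoids i m≤i e }
  ...   | yes (j , m≤j , e) = suc j , λ
            { i j<i (here e′) → ℕ.<-irrefl (natural-injective j i (trans e (sym e′))) j<i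
            ; i j<i (there e′) → avoids i (ℕ.≤-trans m≤j (ℕ.<⇒≤ j<i)) e′ }

  avoid : ∀ R → ∃[ s ] ¬ s ∈≈ R
  avoid R = let (m , p) = eventually-avoids R in natural m , p m ℕ.≤-refl

  record Polynomial (g : 𝕂 → 𝕂) : Set where
    constructor polynomial
    field
      {size}       : ℕ
      coefficients : Vec 𝕂 size
      represents   : ∀ s → g s ≈ horner coefficients s
  open Polynomial

  -- If the roots were confined to a finite list, some natural number would avoid both this list and
  -- `R`; there the polynomial vanishes by assumption, so the number is a root after all.
  density : ∀ {g} → Polynomial g → ∀ R → (∀ s → ¬ s ∈≈ R → g s ≈ 0#) → ∀ s → g s ≈ 0#
  density P R e s with finitely-many-roots (coefficients P)
  ... | inj₁ z = trans (represents P s) (z s)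
  ... | inj₂ (R′ , roots) with avoid (R List.++ R′)
  ...   | t , t∉ = contradiction (Any.++⁺ʳ R (roots t (trans (sym (represents P t)) (e t (t∉ ∘ Any.++⁺ˡ))))) t∉

  private
    add : Vec 𝕂 m → Vec 𝕂 n → ∃ (Vec 𝕂)
    add []      q       = _ , q
    add (a ∷ p) []      = _ , a ∷ p
    add (a ∷ p) (b ∷ q) = _ , a + b ∷ proj₂ (add p q)

    horner-add : (p : Vec 𝕂 m) (q : Vec 𝕂 n) → ∀ s → horner (proj₂ (add p q)) s ≈ horner p s + horner q s
    horner-add []      q       s = sym (+-identityˡ _)
    horner-add (a ∷ p) []      s = sym (+-identityʳ _)
    horner-add (a ∷ p) (b ∷ q) s = trans (+-congˡ (*-congˡ (horner-add p q s)))
      (solve 5 (λ a b s x y → a :+ b :+ s :* (x :+ y) := (a :+ s :* x) :+ (b :+ s :* y)) refl a b s (horner p s) (horner q s))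

    horner-scale : ∀ c (p : Vec 𝕂 n) s → horner (Vec.map (c *_) p) s ≈ c * horner p s
    horner-scale c []      s = sym (zeroʳ c)
    horner-scale c (a ∷ p) s = trans (+-congˡ (*-congˡ (horner-scale c p s)))
      (solve 4 (λ c a s x → c :* a :+ s :* (c :* x) := c :* (a :+ s :* x)) refl c a s (horner p s))

    mul : Vec 𝕂 m → Vec 𝕂 n → ∃ (Vec 𝕂)
    mul []      q = _ , []
    mul (a ∷ p) q = add (Vec.map (a *_) q) (0# ∷ proj₂ (mul p q))

    horner-mul : (p : Vec 𝕂 m) (q : Vec 𝕂 n) → ∀ s → horner (proj₂ (mul p q)) s ≈ horner p s * horner q s
    horner-mul []      q s = sym (zeroˡ _)
    horner-mul (a ∷ p) q s = trans (horner-add (Vec.map (a *_) q) (0# ∷ proj₂ (mul p q)) s)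
      (trans (+-cong (horner-scale a q s) (trans (+-identityˡ _) (*-congˡ (horner-mul p q s))))
        (solve 4 (λ a s x y → a :* y :+ s :* (x :* y) := (a :+ s :* x) :* y) refl a s (horner p s) (horner q s)))

  poly-const : ∀ c → Polynomial (λ _ → c)
  poly-const c = polynomial (c ∷ []) (λ s → sym (trans (+-congˡ (zeroʳ s)) (+-identityʳ c)))

  poly-var : Polynomial (λ s → s)
  poly-var = polynomial (0# ∷ 1# ∷ []) (λ s → sym (trans (+-identityˡ _)
    (trans (*-congˡ (trans (+-congˡ (zeroʳ s)) (+-identityʳ 1#))) (*-identityʳ s))))

  poly-+ : ∀ {g h} → Polynomial g → Polynomial h → Polynomial (λ s → g s + h s)
  poly-+ (polynomial p e) (polynomial q e′) = polynomial (proj₂ (add p q)) (λ s →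
    trans (+-cong (e s) (e′ s)) (sym (horner-add p q s)))

  poly-* : ∀ {g h} → Polynomial g → Polynomial h → Polynomial (λ s → g s * h s)
  poly-* (polynomial p e) (polynomial q e′) = polynomial (proj₂ (mul p q)) (λ s →
    trans (*-cong (e s) (e′ s)) (sym (horner-mul p q s)))

  poly-cong : ∀ {g h} → (∀ s → g s ≈ h s) → Polynomial g → Polynomial h
  poly-cong e (polynomial p e′) = polynomial p (λ s → trans (sym (e s)) (e′ s))

  poly-neg : ∀ {g} → Polynomial g → Polynomial (λ s → - g s)
  poly-neg P = poly-cong (λ s → trans (sym (-‿distribˡ-* 1# _)) (-‿cong (*-identityˡ _))) (poly-* (poly-const (- 1#)) P)

  poly-if : ∀ b {g h} → Polynomial g → Polynomial h → Polynomial (λ s → if b then g s else h s)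
  poly-if true  P Q = P
  poly-if false P Q = Q

  poly-sum : {g : Fin n → 𝕂 → 𝕂} → (∀ i → Polynomial (g i)) → Polynomial (λ s → sum (λ i → g i s))
  poly-sum {zero}  P = poly-const 0#
  poly-sum {suc n} P = poly-+ (P zero) (poly-sum (P ∘ suc))

  poly-prod : {g : Fin n → 𝕂 → 𝕂} → (∀ i → Polynomial (g i)) → Polynomial (λ s → prod (λ i → g i s))
  poly-prod {zero}  P = poly-const 1#
  poly-prod {suc n} P = poly-* (P zero) (poly-prod (P ∘ suc))

  poly-det : {A : Fin n → Fin n → 𝕂 → 𝕂} → (∀ i j → Polynomial (A i j)) → Polynomial (λ s → det (λ i j → A i j s))
  poly-det {zero}  P = poly-const 1#
  poly-det {suc n} P = poly-sum (λ j → poly-* (poly-const (sign j)) (poly-* (P zero j) (poly-det (λ p q → P (suc p) (punchIn j q)))))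

  poly-plü : {u : 𝕂 → Fin k → Fin n → 𝕂} → (∀ i l → Polynomial (λ s → u s i l)) → ∀ I → Polynomial (λ s → plü (u s) I)
  poly-plü P (S , ≡.refl) = poly-det (λ i j → P i (elements S j))

  poly-weight : {t : 𝕂 → Fin n → 𝕂} → (∀ l → Polynomial (λ s → t s l)) → ∀ S → Polynomial (λ s → weight (t s) S)
  poly-weight P S = poly-prod (λ l → poly-if (lookup S l) (P l) (poly-const 1#))

  private variable
    r : ℕ
    I : Fin r → Set

  evalMonomial-cong : (M : Monomial I) {x y : ∀ a → I a → 𝕂} → (∀ a i → x a i ≈ y a i) → evalMonomial M x ≈ evalMonomial M y
  evalMonomial-cong []            e = refl
  evalMonomial-cong ((a , i) ∷ M) e = *-cong (e a i) (evalMonomial-cong M e)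

  eval-cong : (f : Poly I) {x y : ∀ a → I a → 𝕂} → (∀ a i → x a i ≈ y a i) → eval f x ≈ eval f y
  eval-cong []            e = refl
  eval-cong ((c , M) ∷ f) e = +-cong (*-congˡ (evalMonomial-cong M e)) (eval-cong f e)

  poly-evalMonomial : (M : Monomial I) {x : 𝕂 → ∀ a → I a → 𝕂} → (∀ a i → Polynomial (λ s → x s a i)) →
    Polynomial (λ s → evalMonomial M (x s))
  poly-evalMonomial []            P = poly-const 1#
  poly-evalMonomial ((a , i) ∷ M) P = poly-* (P a i) (poly-evalMonomial M P)

  poly-eval : (f : Poly I) {x : 𝕂 → ∀ a → I a → 𝕂} → (∀ a i → Polynomial (λ s → x s a i)) → Polynomial (λ s → eval f (x s))
  poly-eval []            P = poly-const 0#
  poly-eval ((c , M) ∷ f) P = poly-+ (poly-* (poly-const c) (poly-evalMonomial M P)) (poly-eval f P)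

  evalMonomial-scale : ∀ d (M : Monomial {1} (λ _ → ι)) (c : 𝕂) x → multidegree M zero ≡ d →
    evalMonomial M (λ _ i → c * x i) ≈ c ^ d * evalMonomial M (λ _ → x)
  evalMonomial-scale zero    []               c x e = sym (*-identityˡ _)
  evalMonomial-scale zero    ((zero , i) ∷ M) c x ()
  evalMonomial-scale (suc d) ((zero , i) ∷ M) c x e = trans (*-congˡ (evalMonomial-scale d M c x (ℕ.suc-injective e)))
    (solve 4 (λ c x p m → (c :* x) :* (p :* m) := (c :* p) :* (x :* m)) refl c (x i) (c ^ d) (evalMonomial M (λ _ → x)))

  eval-scale : ∀ (d : Fin 1 → ℕ) (f : Poly {1} (λ _ → ι)) → Homogeneous d f → ∀ (c : 𝕂) x →
    eval f (λ _ i → c * x i) ≈ c ^ d zero * eval f (λ _ → x)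
  eval-scale d []            []      c x = sym (zeroʳ _)
  eval-scale d ((a , M) ∷ f) (h ∷ H) c x = trans (+-cong (*-congˡ (evalMonomial-scale (d zero) M c x (h zero))) (eval-scale d f H c x))
    (solve 4 (λ a p m z → a :* (p :* m) :+ p :* z := p :* (a :* m :+ z)) refl
      a (c ^ d zero) (evalMonomial M (λ _ → x)) (eval f (λ _ → x)))

  ^-≉0 : ∀ {c} → c ≉ 0# → ∀ d → c ^ d ≉ 0#
  ^-≉0 c≉0 zero    = 1≉0
  ^-≉0 c≉0 (suc d) = *-≉0 c≉0 (^-≉0 c≉0 d)

  vanishes-∝ : (f : Form {1} (λ _ → ι)) {x y : ι → 𝕂} → y ∝ x → eval (poly f) (λ _ → x) ≈ 0# → eval (poly f) (λ _ → y) ≈ 0#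
  vanishes-∝ f (c , _ , e) p = trans (eval-cong (poly f) (λ _ → e))
    (trans (eval-scale (degree f) (poly f) (homogeneous f) c _) (*0≈0 p))

  module _ {ι : Set} (p v : ι → 𝕂) (u : 𝕂 → ι → 𝕂) (u-poly : ∀ i → Polynomial (λ s → u s i)) where

    curve : 𝕂 → ι → 𝕂
    curve s i = p i + s * (v i + s * u s i)

    -- The part of second order only enters the remainder `h`, which is again polynomial and can be
    -- evaluated at zero.
    taylorMonomial : (M : Monomial {1} (λ _ → ι)) → Σ[ h ∈ (𝕂 → 𝕂) ] Polynomial h × (∀ s →
      evalMonomial M (λ _ → curve s) ≈ evalMonomial M (λ _ → p) + s * (diffMonomial M (λ _ → p) (λ _ → v) + s * h s))
    taylorMonomial [] = (λ _ → 0#) , poly-const 0# , λ s →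
      sym (+0≈ (trans (*-congˡ (trans (+-identityˡ _) (zeroʳ s))) (zeroʳ s)))
    taylorMonomial ((a , i) ∷ M) = let (h , h-poly , e) = taylorMonomial M in
      (λ s → p i * h s + v i * (D + s * h s) + u s i * (E + s * (D + s * h s))) ,
      poly-+ (poly-+ (poly-* (poly-const (p i)) h-poly) (poly-* (poly-const (v i)) (poly-+ (poly-const D) (poly-* poly-var h-poly))))
        (poly-* (u-poly i) (poly-+ (poly-const E) (poly-* poly-var (poly-+ (poly-const D) (poly-* poly-var h-poly))))) ,
      λ s → trans (*-congˡ (e s))
        (solve 7 (λ p v u s E D h → (p :+ s :* (v :+ s :* u)) :* (E :+ s :* (D :+ s :* h)) :=
            p :* E :+ s :* ((v :* E :+ p :* D) :+ s :* (p :* h :+ v :* (D :+ s :* h) :+ u :* (E :+ s :* (D :+ s :* h))))) refl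
          (p i) (v i) (u s i) s E D (h s))
      where
      E = evalMonomial M (λ _ → p)
      D = diffMonomial M (λ _ → p) (λ _ → v)

    taylor : (f : Poly {1} (λ _ → ι)) → Σ[ h ∈ (𝕂 → 𝕂) ] Polynomial h × (∀ s →
      eval f (λ _ → curve s) ≈ eval f (λ _ → p) + s * (diff f (λ _ → p) (λ _ → v) + s * h s))
    taylor [] = (λ _ → 0#) , poly-const 0# , λ s →
      sym (+0≈ (trans (*-congˡ (trans (+-identityˡ _) (zeroʳ s))) (zeroʳ s)))
    taylor ((c , M) ∷ f) = let (h , h-poly , e) = taylorMonomial M
                               (h′ , h′-poly , e′) = taylor f in
      (λ s → c * h s + h′ s) , poly-+ (poly-* (poly-const c) h-poly) h′-poly ,
      λ s → trans (+-cong (*-congˡ (e s)) (e′ s))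
        (solve 8 (λ c s E D h E′ D′ h′ → c :* (E :+ s :* (D :+ s :* h)) :+ (E′ :+ s :* (D′ :+ s :* h′)) :=
            (c :* E :+ E′) :+ s :* ((c :* D :+ D′) :+ s :* (c :* h :+ h′))) refl
          c s (evalMonomial M (λ _ → p)) (diffMonomial M (λ _ → p) (λ _ → v)) (h s)
          (eval f (λ _ → p)) (diff f (λ _ → p) (λ _ → v)) (h′ s))

    -- The substitute for a limit. Density extends the vanishing to `s = 0`, which gives the value
    -- at `p`; then a factor `s` is cancelled away from zero, and density applied to the quotient
    -- gives the differential.
    derivative-vanishes : (f : Poly {1} (λ _ → ι)) → ∀ R → (∀ s → ¬ s ∈≈ R → eval f (λ _ → curve s) ≈ 0#) →
      eval f (λ _ → p) ≈ 0# × diff f (λ _ → p) (λ _ → v) ≈ 0#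
    derivative-vanishes f R e = E≈0 , D≈0
      where
      open ≈-Reasoning
      h = proj₁ (taylor f)
      h-poly = proj₁ (proj₂ (taylor f))
      expand = proj₂ (proj₂ (taylor f))
      E = eval f (λ _ → p)
      D = diff f (λ _ → p) (λ _ → v)
      curve-poly : ∀ i → Polynomial (λ s → curve s i)
      curve-poly i = poly-+ (poly-const (p i)) (poly-* poly-var (poly-+ (poly-const (v i)) (poly-* poly-var (u-poly i))))
      vanishes : ∀ s → eval f (λ _ → curve s) ≈ 0#
      vanishes = density (poly-eval f (λ _ → curve-poly)) R e
      at-0 : ∀ x y → x ≈ x + 0# * y
      at-0 x y = sym (trans (+-congˡ (zeroˡ y)) (+-identityʳ x))
      E≈0 : E ≈ 0#
      E≈0 = trans (at-0 E _) (trans (sym (expand 0#)) (vanishes 0#))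
      D≈0 : D ≈ 0#
      D≈0 = trans (at-0 D (h 0#)) (density (poly-+ (poly-const D) (poly-* poly-var h-poly)) (0# ∷ [])
        (λ s s∉ → *-cancel-0 (s∉ ∘ here) (begin
          s * (D + s * h s)       ≈⟨ +-identityˡ _ ⟨
          0# + s * (D + s * h s)  ≈⟨ +-congʳ E≈0 ⟨
          E + s * (D + s * h s)   ≈⟨ expand s ⟨
          eval f (λ _ → curve s)  ≈⟨ vanishes s ⟩
          0#                      ∎)) 0#)

-- Forms on the orbit closure, tangent vectors and basis exchange.

module OrbitClosures {K : CommutativeRing 0ℓ 0ℓ} (F : ClassicalField K) where
  open Polynomials F public

  private variable
    k n : ℕ

  subset-ext : {S S′ : Subset n} → (∀ l → lookup S l ≡ lookup S′ l) → S ≡ S′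
  subset-ext {S = S} {S′} e = ≡.trans (≡.sym (Vec.tabulate∘lookup S))
    (≡.trans (Vec.tabulate-cong e) (Vec.tabulate∘lookup S′))

  KSubset-≡ : {I J : KSubset k n} → proj₁ I ≡ proj₁ J → I ≡ J
  KSubset-≡ {I = S , p} {.S , q} ≡.refl = ≡.cong (S ,_) (ℕ.≡-irrelevant p q)

  not-true : ∀ {b} → b ≢ true → b ≡ false
  not-true {true}  ¬p = contradiction ≡.refl ¬p
  not-true {false} _  = ≡.refl

  not-false : ∀ {b} → b ≢ false → b ≡ true
  not-false {true}  _  = ≡.refl
  not-false {false} ¬p = contradiction ≡.refl ¬p

  -- Each index occurs in `I` and `J` together as often as in `K` and `L`. This is the source of the
  -- binomial relations between Plücker coordinates on the orbit.
  weight-exchange : (I J K L : Subset n) →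
    (∀ l → (lookup I l ≡ lookup K l × lookup J l ≡ lookup L l) ⊎ (lookup I l ≡ lookup L l × lookup J l ≡ lookup K l)) →
    ∀ t → weight t I * weight t J ≈ weight t K * weight t L
  weight-exchange I J K L e t = trans (sym (Π.∑-distrib-+ (f I) (f J))) (trans (prod-cong step) (Π.∑-distrib-+ (f K) (f L)))
    where
    f : Subset _ → Fin _ → 𝕂
    f S l = if lookup S l then t l else 1#
    f-cong : ∀ S S′ l → lookup S l ≡ lookup S′ l → f S l ≈ f S′ l
    f-cong S S′ l p = reflexive (≡.cong (λ b → if b then t l else 1#) p)
    step : ∀ l → f I l * f J l ≈ f K l * f L l
    step l with e l
    ... | inj₁ (p , q) = *-cong (f-cong I K l p) (f-cong J L l q)
    ... | inj₂ (p , q) = trans (*-cong (f-cong I L l p) (f-cong J K l q)) (*-comm _ _)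

  module Closure (X : Gr k (Fin n)) where

    x : KSubset k n → 𝕂
    x = plücker X

    orbit-point : Torus n → KSubset k n → 𝕂
    orbit-point (t , _) I = weight t (proj₁ I) * x I

    -- The orbit is described by the torus instead of by subspaces with bases; homogeneity makes up
    -- for the factor by which the two descriptions differ.
    VanishesOnOrbit : Form {1} (λ _ → KSubset k n) → Set
    VanishesOnOrbit f = ∀ T → eval (poly f) (λ _ → orbit-point T) ≈ 0#

    orbit-plücker : ∀ T Y → subspace Y ≐ (T · X) → plücker Y ∝ orbit-point T
    orbit-plücker T Y e = ∝-trans (subspace-determines-plücker Y (translate X T) e) (≋⇒∝ (plücker-translate X T))

    closure-elim : ∀ {Y} → OrbitClosure X Y → ∀ f → VanishesOnOrbit f → eval (poly f) (λ _ → plücker Y) ≈ 0#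
    closure-elim Y∈ f vanishes = Y∈ f (λ Y′ (T , e) → vanishes-∝ f (orbit-plücker T Y′ e) (vanishes T))

    closure-intro : ∀ {Y} → (∀ f → VanishesOnOrbit f → eval (poly f) (λ _ → plücker Y) ≈ 0#) → OrbitClosure X Y
    closure-intro h f vanishes = h f (λ T → trans (eval-cong (poly f) (λ _ I → sym (plücker-translate X T I)))
      (vanishes (translate X T) (T , id , id)))

    X∈closure : OrbitClosure X X
    X∈closure f vanishes = vanishes X (((λ _ → 1#) , λ _ → 1≉0) ,
      (λ {v} v∈ → v , v∈ , λ l → sym (*-identityˡ _)) ,
      (λ {v} (u , u∈ , e) → closed-≋ (X-closed X) (λ l → sym (trans (e l) (*-identityˡ _))) u∈))

    Z = Plücker (OrbitClosure X)

    point : (c : KSubset k n → 𝕂) → ∃[ I ] c I ≉ 0# → ℙ (KSubset k n)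
    point c c≉0 = record { coords = λ _ → c ; nonzero = λ _ → c≉0 }

    Z-vanishes : ∀ f → VanishesOnOrbit f → ∀ q → q ∈ Z → eval (poly f) (coords q) ≈ 0#
    Z-vanishes f vanishes q (Y , Y∈ , e) = trans (eval-cong (poly f) (λ { zero I → refl }))
      (vanishes-∝ f e (closure-elim {Y} Y∈ f vanishes))

    vanishes-on-orbit : ∀ f → (∀ q → q ∈ Z → eval (poly f) (coords q) ≈ 0#) → VanishesOnOrbit f
    vanishes-on-orbit f h T@(t , t≉0) = h (point (orbit-point T) (I , *-≉0 (weight-≉0 t≉0 (proj₁ I)) xI≉0))
      (translate X T , (λ g vanishes → vanishes (translate X T) (T , id , id)) , ∝-sym (≋⇒∝ (plücker-translate X T)))
      where
      I = proj₁ (coordinate≉0 X)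
      xI≉0 = proj₂ (coordinate≉0 X)

    Tangent : ∀ c → ∃[ I ] c I ≉ 0# → Pred (KSubset k n → 𝕂) _
    Tangent c c≉0 = ConeTangentSpace Z (point c c≉0)

    tangent-intro : ∀ {c c≉0 v} → (∀ f → VanishesOnOrbit f → diff (poly f) (λ _ → c) (λ _ → v) ≈ 0#) → v ∈ Tangent c c≉0
    tangent-intro h f vanishes = h f (vanishes-on-orbit f vanishes)

    tangent-elim : ∀ {c c≉0 v} → v ∈ Tangent c c≉0 → ∀ f → VanishesOnOrbit f → diff (poly f) (λ _ → c) (λ _ → v) ≈ 0#
    tangent-elim v∈ f vanishes = v∈ f (Z-vanishes f vanishes)

    module AtX {v} (v∈ : v ∈ Tangent x (coordinate≉0 X)) where

      -- The coordinate `I` is itself a form that vanishes on the orbit, and it is its own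
      -- differential.
      tangent-non-basis : ∀ I → x I ≈ 0# → v I ≈ 0#
      tangent-non-basis I xI≈0 = trans (sym simplify) (tangent-elim {x} {coordinate≉0 X} {v} v∈ f vanishes)
        where
        f : Form {1} (λ _ → KSubset k n)
        f = record { degree = λ _ → 1 ; poly = (1# , (zero , I) ∷ []) ∷ [] ; homogeneous = (λ { zero → ≡.refl }) ∷ [] }
        vanishes : VanishesOnOrbit f
        vanishes T = trans (+-identityʳ _) (trans (*-identityˡ _) (trans (*-identityʳ _) (*0≈0 xI≈0)))
        simplify : 1# * (v I * 1# + x I * 0#) + 0# ≈ v I
        simplify = trans (+-identityʳ _) (trans (*-identityˡ _) (trans (+-cong (*-identityʳ _) (zeroʳ _)) (+-identityʳ _)))

      -- The relation x_K x_L p_I p_J = x_I x_J p_K p_L holds on the orbit closure.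
      tangent-quadric : ∀ I J K L → (∀ t → weight t (proj₁ I) * weight t (proj₁ J) ≈ weight t (proj₁ K) * weight t (proj₁ L)) →
        x J ≉ 0# → x K ≉ 0# → x L ≉ 0# → v J ≈ 0# → v K ≈ 0# → v L ≈ 0# → v I ≈ 0#
      tangent-quadric I J K L e xJ≉0 xK≉0 xL≉0 vJ vK vL =
        *-cancel-0 xJ≉0 (*-cancel-0 (*-≉0 xK≉0 xL≉0) (trans (sym simplify) (tangent-elim {x} {coordinate≉0 X} {v} v∈ f vanishes)))
        where
        open ≈-Reasoning
        f : Form {1} (λ _ → KSubset k n)
        f = record
          { degree = λ _ → 2
          ; poly = (x K * x L , (zero , I) ∷ (zero , J) ∷ []) ∷ (- (x I * x J) , (zero , K) ∷ (zero , L) ∷ []) ∷ []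
          ; homogeneous = (λ { zero → ≡.refl }) ∷ (λ { zero → ≡.refl }) ∷ [] }
        vanishes : VanishesOnOrbit f
        vanishes T@(t , _) = begin
          x K * x L * (wI * x I * (wJ * x J * 1#)) + (- (x I * x J) * (wK * x K * (wL * x L * 1#)) + 0#)
            ≈⟨ +-cong (*-congˡ (*-congˡ (*-identityʳ _))) (trans (+-identityʳ _) (*-congˡ (*-congˡ (*-identityʳ _)))) ⟩
          x K * x L * (wI * x I * (wJ * x J)) + - (x I * x J) * (wK * x K * (wL * x L))
            ≈⟨ solve 8 (λ i j k l a b c d → k :* l :* (a :* i :* (b :* j)) :+ (:- (i :* j)) :* (c :* k :* (d :* l)) :=
                 (i :* j :* k :* l) :* (a :* b :- c :* d)) refl (x I) (x J) (x K) (x L) wI wJ wK wL ⟩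
          (x I * x J * x K * x L) * (wI * wJ - wK * wL)
            ≈⟨ *0≈0 (trans (+-congʳ (e t)) (-‿inverseʳ _)) ⟩
          0# ∎
          where
          wI = weight t (proj₁ I)
          wJ = weight t (proj₁ J)
          wK = weight t (proj₁ K)
          wL = weight t (proj₁ L)
        product : ∀ {y} a b → y ≈ 0# → v a ≈ y → v b ≈ 0# → v a * (x b * 1#) + x a * (v b * 1# + x b * 0#) ≈ 0#
        product a b y≈0 va vb = trans (+-cong (0*≈0 (trans va y≈0))
          (*0≈0 (trans (+-cong (0*≈0 vb) (zeroʳ _)) (+-identityʳ _)))) (+-identityʳ _)
        simplify : diff (poly f) (λ _ → x) (λ _ → v) ≈ (x K * x L) * (x J * v I)
        simplify = begin
          x K * x L * (v I * (x J * 1#) + x I * (v J * 1# + x J * 0#)) +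
            (- (x I * x J) * (v K * (x L * 1#) + x K * (v L * 1# + x L * 0#)) + 0#)
            ≈⟨ +-cong (*-congˡ (+-cong (trans (*-congˡ (*-identityʳ _)) (*-comm _ _))
                   (*0≈0 (trans (+-cong (0*≈0 vJ) (zeroʳ _)) (+-identityʳ _)))))
                 (trans (+-identityʳ _) (*0≈0 (product K L vK refl vL))) ⟩
          x K * x L * (x J * v I + 0#) + 0#
            ≈⟨ trans (+-identityʳ _) (*-congˡ (+-identityʳ _)) ⟩
          (x K * x L) * (x J * v I) ∎

    private
      H = dimension X
      W-closed = X-closed X

    basis-index : ∀ {S} → Reduced (subspace X) S → KSubset k n
    basis-index {S} R = S , reduced-size H R

    x-basis≉0 : ∀ {S} (R : Reduced (subspace X) S) e → x (S , e) ≉ 0#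
    x-basis≉0 {S} R e p = reduced⇒plü≉0 H R e (trans (sym (reflexive (plücker≡plü X (S , e)))) p)

    x≉0⇒reduced : ∀ I → x I ≉ 0# → Reduced (subspace X) (proj₁ I)
    x≉0⇒reduced (S , e) p = plü≉0⇒reduced H e (≉0-cong (reflexive (plücker≡plü X (S , e))) p)

    -- The reduced row of `S′` at an index outside `S` would vanish on `S` and hence be zero,
    -- although its entry at that index is 1.
    bases-⊆ : ∀ {S S′} → Reduced (subspace X) S → Reduced (subspace X) S′ →
      (∀ l → lookup S l ≡ true → lookup S′ l ≡ true) → S ≡ S′
    bases-⊆ {S} {S′} R R′ S⊆S′ = subset-ext pointwise
      where
      pointwise : ∀ l → lookup S l ≡ lookup S′ l
      pointwise l with lookup S l in p | lookup S′ l in q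
      ... | true  | true  = ≡.refl
      ... | false | false = ≡.refl
      ... | true  | false = contradiction (≡.trans (≡.sym (S⊆S′ l p)) q) (λ ())
      ... | false | true  = contradiction (trans (sym (Reduced.row-diag R′ l q))
              (Reduced.determined R (Reduced.row R′ l) (Reduced.row∈ R′ l)
                (λ b b∈S → Reduced.row-off R′ l b (S⊆S′ b b∈S) (λ { ≡.refl → true≢false b∈S p })) l)) 1≉0

    abstract
      -- Expanding row `j` of `I` in the rows of `B` at the coordinate `j` writes 1 as the sum of
      -- all `u j b * w b j`. A nonzero term allows both exchanges at once: `b` for `j` in `I`, and
      -- `j` for `b` in `B`.
      symmetric-exchange : ∀ {I B} (R : Reduced (subspace X) I) (R′ : Reduced (subspace X) B) j →
        lookup I j ≡ true → lookup B j ≡ false →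
        ∃[ b ] lookup B b ≡ true × lookup I b ≡ false × Reduced.row R j b ≉ 0# × Reduced.row R′ b j ≉ 0#
      symmetric-exchange {I} {B} R R′ j j∈I j∉B = b , b∈B , b∉I , ≉0-factorˡ term≉0 , ≉0-factorʳ term≉0
        where
        open Reduced R using () renaming (row to u)
        open Reduced R′ using () renaming (row to w)
        found : ∃[ b ] u j b * w b j ≉ 0#
        found = sum-≉0 (λ b → u j b * w b j) (≉0-cong (expansion W-closed R′ (u j) (Reduced.row∈ R j) j)
          (≉0-cong (sym (Reduced.row-diag R j j∈I)) 1≉0))
        b : Fin n
        b = proj₁ found
        term≉0 : u j b * w b j ≉ 0#
        term≉0 = proj₂ found
        b∈B : lookup B b ≡ true
        b∈B = not-false (λ b∉B → ≉0-factorʳ term≉0 (Reduced.row-out R′ b b∉B j))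
        b∉I : lookup I b ≡ false
        b∉I = not-true (λ b∈I → ≉0-factorˡ term≉0 (Reduced.row-off R j b b∈I (λ j≡b → true≢false (≡.trans (≡.cong (lookup B) j≡b) b∈B) j∉B)))

-- The tangent space at X, and curves out of the torus-fixed points.

module FourCycles {K : CommutativeRing 0ℓ 0ℓ} (F : ClassicalField K) where
  open OrbitClosures F public

  private variable
    k n : ℕ

  prod-extract : (f : Fin n → 𝕂) → ∀ l → prod f ≈ f l * prod (λ m → if does (m Fin.≟ l) then 1# else f m)
  prod-extract f l = trans (prod-cong step) (trans (Π.∑-distrib-+ g _) (*-congʳ
    (trans (prod-single g l off) (reflexive (at-l (l Fin.≟ l))))))
    where
    g : Fin _ → 𝕂
    g m = if does (m Fin.≟ l) then f m else 1#
    step : ∀ m → f m ≈ g m * (if does (m Fin.≟ l) then 1# else f m)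
    step m with m Fin.≟ l
    ... | yes _ = sym (*-identityʳ _)
    ... | no  _ = sym (*-identityˡ _)
    off : ∀ m → m ≢ l → g m ≈ 1#
    off m m≢l with m Fin.≟ l
    ... | yes e = contradiction e m≢l
    ... | no  _ = refl
    at-l : (d : Dec (l ≡ l)) → (if does d then f l else 1#) ≡ f l
    at-l (yes _) = ≡.refl
    at-l (no ¬p) = contradiction ≡.refl ¬p

  ∈≢∉ : {S : Subset n} → ∀ {i j} → lookup S i ≡ true → lookup S j ≡ false → i ≢ j
  ∈≢∉ p q ≡.refl = true≢false p q

  weight-swap : (I B : Subset n) → ∀ {j b} → lookup I j ≡ true → lookup B j ≡ false → lookup B b ≡ true → lookup I b ≡ false →
    ∀ t → weight t I * weight t B ≈ weight t (swap I j b) * weight t (swap B b j)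
  weight-swap I B {j} {b} j∈I j∉B b∈B b∉I = weight-exchange I B (swap I j b) (swap B b j) (λ l → pointwise l (l Fin.≟ b) (l Fin.≟ j))
    where
    b≢j = ∈≢∉ {S = B} b∈B j∉B
    pointwise : ∀ l → Dec (l ≡ b) → Dec (l ≡ j) →
      (lookup I l ≡ lookup (swap I j b) l × lookup B l ≡ lookup (swap B b j) l) ⊎
      (lookup I l ≡ lookup (swap B b j) l × lookup B l ≡ lookup (swap I j b) l)
    pointwise l (yes ≡.refl) _            = inj₂ (≡.trans b∉I (≡.sym (swap-old B b≢j)) , ≡.trans b∈B (≡.sym (swap-new I)))
    pointwise l (no _)       (yes ≡.refl) = inj₂ (≡.trans j∈I (≡.sym (swap-new B)) , ≡.trans j∉B (≡.sym (swap-old I (b≢j ∘ ≡.sym))))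
    pointwise l (no l≢b)     (no l≢j)     = inj₁ (≡.sym (swap-other I l≢b l≢j) , ≡.sym (swap-other B l≢j l≢b))

  module _ {B : Subset n} where
    -- The measure for the induction that moves a basis `I` towards `B` by exchanges.
    beyond : Subset n → Subset n
    beyond I = tabulate (λ l → if lookup B l then false else lookup I l)

    lookup-beyond : ∀ I l → lookup (beyond I) l ≡ (if lookup B l then false else lookup I l)
    lookup-beyond I = Vec.lookup∘tabulate _

    beyond⇒ : ∀ I l → lookup (beyond I) l ≡ true → lookup B l ≡ false × lookup I l ≡ true
    beyond⇒ I l p with lookup B l | lookup-beyond I l
    ... | true  | e = contradiction e (true≢false p)
    ... | false | e = ≡.refl , ≡.trans (≡.sym e) p

    ⇒beyond : ∀ I l → lookup B l ≡ false → lookup I l ≡ true → lookup (beyond I) l ≡ true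
    ⇒beyond I l p q with lookup B l | lookup-beyond I l
    
    ... | false | e = ≡.trans e q

    beyond-shrinks : ∀ I {j b} → lookup I j ≡ true → lookup B j ≡ false → lookup B b ≡ true →
      beyond (swap I j b) Subset.⊂ beyond I
    beyond-shrinks I {j} {b} j∈I j∉B b∈B =
      (λ {l} l∈ → lookup⇒∈ (let (l∉B , l∈I′) = beyond⇒ (swap I j b) l (∈⇒lookup l∈) in
        ⇒beyond I l l∉B (≡.trans (≡.sym (swap-other I (∈≢∉ {S = B} b∈B l∉B ∘ ≡.sym)
          (λ { ≡.refl → true≢false l∈I′ (swap-old I j≢b) }))) l∈I′))) ,
      j , lookup⇒∈ (⇒beyond I j j∉B j∈I) ,
      λ j∈ → true≢false (proj₂ (beyond⇒ (swap I j b) j (∈⇒lookup j∈))) (swap-old I j≢b)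
      where
      j≢b : j ≢ b
      j≢b = ∈≢∉ {S = B} b∈B j∉B ∘ ≡.sym

  module _ (X : Gr k (Fin n)) {B : Subset n} (R : Reduced (subspace X) B) where
    open Closure X
    open Reduced R
    private
      H = dimension X
      W-closed = X-closed X
      IB = basis-index R

    Edge : Fin n → Fin n → Set
    Edge i j = lookup B i ≡ true × lookup B j ≡ false × row i j ≉ 0#

    edge-basis : ∀ {i j} → Edge i j → Reduced (subspace X) (swap B i j)
    edge-basis (i∈B , j∉B , ≉0) = pivot W-closed R i∈B j∉B ≉0

    edge-set : ∀ {i j} → Edge i j → KSubset k n
    edge-set e = basis-index (edge-basis e)

    swap-injective : ∀ {i j i′ j′} → Edge i j → Edge i′ j′ → swap B i j ≡ swap B i′ j′ → i ≡ i′ × j ≡ j′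
    swap-injective {i} {j} {i′} {j′} (i∈ , j∉ , _) (i′∈ , j′∉ , _) e = i≡i′ , j≡j′
      where
      i≡i′ : i ≡ i′
      i≡i′ with i Fin.≟ i′
      ... | yes p = p
      ... | no ¬p = contradiction (≡.trans (≡.sym (≡.trans (≡.sym (≡.cong (λ S → lookup S i) e)) (swap-old B (∈≢∉ {S = B} i∈ j∉))))
              (≡.trans (swap-other B (∈≢∉ {S = B} i∈ j′∉) ¬p) i∈)) (λ ())
      j≡j′ : j ≡ j′
      j≡j′ with j Fin.≟ j′
      ... | yes p = p
      ... | no ¬p = contradiction (≡.trans (≡.sym (≡.trans (≡.sym (≡.cong (λ S → lookup S j) e)) (swap-new B)))
              (≡.trans (swap-other B ¬p (∈≢∉ {S = B} i′∈ j∉ ∘ ≡.sym)) j∉)) (λ ())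

    swap≢ : ∀ {i j} → Edge i j → B ≢ swap B i j
    swap≢ {i} {j} (i∈ , j∉ , _) e = true≢false (≡.trans (≡.cong (λ S → lookup S j) e) (swap-new B)) j∉

    module _ {v} (v∈ : v ∈ Tangent x (coordinate≉0 X)) (vB : v IB ≈ 0#)
      (v-edge : ∀ {i j} (e : Edge i j) → v (edge-set e) ≈ 0#) where
      open AtX v∈
      private
        v-≡ : ∀ I J → proj₁ I ≡ proj₁ J → v I ≈ v J
        v-≡ I J e = reflexive (≡.cong v (KSubset-≡ {I = I} {J} e))

        exchange-step : ∀ I (Q : Reduced (subspace X) (proj₁ I)) {j b} (j∈I : lookup (proj₁ I) j ≡ true) →
          lookup B b ≡ true → (b∉I : lookup (proj₁ I) b ≡ false) → (≉0 : Reduced.row Q j b ≉ 0#) → (e : Edge b j) →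
          v (basis-index (pivot W-closed Q j∈I b∉I ≉0)) ≈ 0# → v I ≈ 0#
        exchange-step I Q {j} {b} j∈I b∈B b∉I ≉0 e vI′ = tangent-quadric I IB (basis-index Q′) (edge-set e)
          (weight-swap (proj₁ I) B j∈I (proj₁ (proj₂ e)) b∈B b∉I)
          (x-basis≉0 R (proj₂ IB)) (x-basis≉0 Q′ (proj₂ (basis-index Q′))) (x-basis≉0 (edge-basis e) (proj₂ (edge-set e)))
          vB vI′ (v-edge e)
          where
          Q′ = pivot W-closed Q j∈I b∉I ≉0

        -- A symmetric exchange of an element `j` of `I` outside `B` against `b` yields a basis
        -- closer to `B` and an edge `b — j`. The quadric relating `I` and `B` to these two sets
        -- makes the coordinate at `I` vanish once the other three do.
        tangent-vanishes : ∀ I → Acc Subset._⊂_ (beyond {B = B} (proj₁ I)) → Reduced (subspace X) (proj₁ I) → v I ≈ 0#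
        tangent-vanishes I (acc rec) Q = by-cases (em _)
          where
          step : ∀ {j} → lookup B j ≡ false → (j∈I : lookup (proj₁ I) j ≡ true) →
            ∃[ b ] lookup B b ≡ true × lookup (proj₁ I) b ≡ false × Reduced.row Q j b ≉ 0# × row b j ≉ 0# → v I ≈ 0#
          step j∉B j∈I (b , b∈B , b∉I , ≉0 , ≉0′) = exchange-step I Q j∈I b∈B b∉I ≉0 (b∈B , j∉B , ≉0′)
            (tangent-vanishes (basis-index (pivot W-closed Q j∈I b∉I ≉0))
              (rec (beyond-shrinks {B = B} (proj₁ I) j∈I j∉B b∈B)) (pivot W-closed Q j∈I b∉I ≉0))
          by-cases : Dec (∃[ j ] lookup B j ≡ false × lookup (proj₁ I) j ≡ true) → v I ≈ 0#
          by-cases (no ¬p) = trans (v-≡ I IB (bases-⊆ Q R (λ l l∈I → not-false (λ l∉B → ¬p (l , l∉B , l∈I))))) vB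
          by-cases (yes (j , j∉B , j∈I)) = step j∉B j∈I (symmetric-exchange Q R j j∈I j∉B)

      tangent-determined : v ≋ (λ _ → 0#)
      tangent-determined I = by-cases (em _)
        where
        by-cases : Dec (x I ≈ 0#) → v I ≈ 0#
        by-cases (yes xI≈0) = tangent-non-basis I xI≈0
        by-cases (no  xI≉0) = tangent-vanishes I (⊂-wellFounded _) (x≉0⇒reduced I xI≉0)

    -- The coordinate vector of `S`, scaled by `x` at `S`: with this scaling it is literally a
    -- coefficient of the torus curve through `x`.
    dirac : Subset n → KSubset k n → 𝕂
    dirac S I = if does (em (proj₁ I ≡ S)) then x I else 0#

    dirac-at : ∀ S I → proj₁ I ≡ S → dirac S I ≈ x I
    dirac-at S I e with em (proj₁ I ≡ S)
    ... | yes _ = refl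
    ... | no ¬e = contradiction e ¬e

    dirac-off : ∀ S I → proj₁ I ≢ S → dirac S I ≈ 0#
    dirac-off S I ¬e with em (proj₁ I ≡ S)
    ... | yes e = contradiction e ¬e
    ... | no  _ = refl

    dirac≉0 : dirac B IB ≉ 0#
    dirac≉0 = ≉0-cong (sym (dirac-at B IB ≡.refl)) (x-basis≉0 R (proj₂ IB))

    -- The torus curve whose weights are 0 on B ∖ {i}, 1 at i, 2 at j and 3 elsewhere
    -- leaves the fixed point of B in the direction of the edge (i , j).
    module Curve {i j} (e : Edge i j) where
      private
        i∈B = proj₁ e
        j∉B = proj₁ (proj₂ e)
        i≢j = ∈≢∉ {S = B} i∈B j∉B
        S = swap B i j

      t : 𝕂 → Fin n → 𝕂
      t s l = if lookup B l then (if does (l Fin.≟ i) then s else 1#)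
              else (if does (l Fin.≟ j) then s * s else s * s * s)

      t-poly : ∀ l → Polynomial (λ s → t s l)
      t-poly l = poly-if (lookup B l) (poly-if (does (l Fin.≟ i)) poly-var (poly-const 1#))
        (poly-if (does (l Fin.≟ j)) (poly-* poly-var poly-var) (poly-* (poly-* poly-var poly-var) poly-var))

      t-≉0 : ∀ {s} → s ≉ 0# → ∀ l → t s l ≉ 0#
      t-≉0 s≉0 l = if-≉0 (lookup B l) (if-≉0 (does (l Fin.≟ i)) s≉0 1≉0)
        (if-≉0 (does (l Fin.≟ j)) (*-≉0 s≉0 s≉0) (*-≉0 (*-≉0 s≉0 s≉0) s≉0))

      t-i : ∀ s → t s i ≈ s
      t-i s with lookup B i | i∈B | i Fin.≟ i
      ... | .true | ≡.refl | yes _ = refl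
      ... | .true | ≡.refl | no ¬p = contradiction ≡.refl ¬p

      t-j : ∀ s → t s j ≈ s * s
      t-j s with lookup B j | j∉B | j Fin.≟ j
      ... | .false | ≡.refl | yes _ = refl
      ... | .false | ≡.refl | no ¬p = contradiction ≡.refl ¬p

      t-B : ∀ s l → lookup B l ≡ true → l ≢ i → t s l ≈ 1#
      t-B s l l∈B l≢i with lookup B l | l∈B | l Fin.≟ i
      ... | .true | ≡.refl | yes p = contradiction p l≢i
      ... | .true | ≡.refl | no  _ = refl

      t-out : ∀ s l → lookup B l ≡ false → l ≢ j → t s l ≈ s * s * s
      t-out s l l∉B l≢j with lookup B l | l∉B | l Fin.≟ j
      ... | .false | ≡.refl | yes p = contradiction p l≢j
      ... | .false | ≡.refl | no  _ = refl

      private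
        factor : Subset n → 𝕂 → Fin n → 𝕂
        factor I s l = if lookup I l then t s l else 1#

        factor-in : ∀ I s l → lookup I l ≡ true → factor I s l ≈ t s l
        factor-in I s l p = reflexive (≡.cong (λ b → if b then t s l else 1#) p)

        factor-one : ∀ I s l → (lookup I l ≡ true → t s l ≈ 1#) → factor I s l ≈ 1#
        factor-one I s l h with lookup I l
        ... | true  = h ≡.refl
        ... | false = refl

        factor-poly : ∀ I l → Polynomial (λ s → factor I s l)
        factor-poly I l = poly-if (lookup I l) (t-poly l) (poly-const 1#)

        weight-B : ∀ s → weight (t s) B ≈ s
        weight-B s = trans (prod-single (factor B s) i (λ l l≢i → factor-one B s l (λ l∈B → t-B s l l∈B l≢i)))
          (trans (factor-in B s i i∈B) (t-i s))

        S⊆ : ∀ l → lookup S l ≡ true → l ≢ j → lookup B l ≡ true × l ≢ i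
        S⊆ l l∈S l≢j = ≡.trans (≡.sym (swap-other B l≢j l≢i)) l∈S , l≢i
          where
          l≢i : l ≢ i
          l≢i ≡.refl = true≢false l∈S (swap-old B i≢j)

        weight-S : ∀ s → weight (t s) S ≈ s * s
        weight-S s = trans (prod-single (factor S s) j (λ l l≢j → factor-one S s l
            (λ l∈S → let (l∈B , l≢i) = S⊆ l l∈S l≢j in t-B s l l∈B l≢i)))
          (trans (factor-in S s j (swap-new B)) (t-j s))

        -- One coordinate of the curve, with the factor `s`, the weight of `B`, pulled out: what is
        -- left starts at `dirac B` with velocity `dirac S`.
        Remainder : KSubset k n → Set
        Remainder I = Σ[ u ∈ (𝕂 → 𝕂) ] Polynomial u ×
          (∀ s → weight (t s) (proj₁ I) * x I ≈ s * (dirac B I + s * (dirac S I + s * u s)))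

        cubic : ∀ I → proj₁ I ≢ B → proj₁ I ≢ S → (u : 𝕂 → 𝕂) → Polynomial u →
          (∀ s → weight (t s) (proj₁ I) * x I ≈ s * s * s * u s) → Remainder I
        cubic I I≢B I≢S u u-poly h = u , u-poly , λ s → trans (h s) (sym (trans
          (*-congˡ (+-cong (dirac-off B I I≢B) (*-congˡ (+-congʳ (dirac-off S I I≢S)))))
          (trans (*-congˡ (trans (+-identityˡ _) (*-congˡ (+-identityˡ _))))
            (solve 2 (λ s u → s :* (s :* (s :* u)) := s :* s :* s :* u) refl s (u s)))))

        remainder : ∀ I → Dec (proj₁ I ≡ B) → Dec (proj₁ I ≡ S) → Dec (x I ≈ 0#) →
          Dec (∃[ l ] lookup (proj₁ I) l ≡ true × lookup B l ≡ false × l ≢ j) → Remainder I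
        remainder I (yes I≡B) _ _ _ = (λ _ → 0#) , poly-const 0# , λ s → begin
          weight (t s) (proj₁ I) * x I     ≈⟨ *-cong (trans (reflexive (≡.cong (weight (t s)) I≡B)) (weight-B s)) (sym (dirac-at B I I≡B)) ⟩
          s * dirac B I                    ≈⟨ *-congˡ (sym (+0≈ (trans (*-congˡ (trans (+-cong
                                                (dirac-off S I (λ I≡S → swap≢ e (≡.trans (≡.sym I≡B) I≡S))) (zeroʳ s))
                                                (+-identityˡ 0#))) (zeroʳ s)))) ⟩
          s * (dirac B I + s * (dirac S I + s * 0#)) ∎
          where open ≈-Reasoning
        remainder I (no I≢B) (yes I≡S) _ _ = (λ _ → 0#) , poly-const 0# , λ s → begin
          weight (t s) (proj₁ I) * x I     ≈⟨ *-cong (trans (reflexive (≡.cong (weight (t s)) I≡S)) (weight-S s)) (sym (dirac-at S I I≡S)) ⟩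
          s * s * dirac S I                ≈⟨ *-assoc _ _ _ ⟩
          s * (s * dirac S I)              ≈⟨ *-congˡ (sym (trans (+-cong (dirac-off B I I≢B) (*-congˡ
                                                (+0≈ (zeroʳ s)))) (+-identityˡ _))) ⟩
          s * (dirac B I + s * (dirac S I + s * 0#)) ∎
          where open ≈-Reasoning
        remainder I (no I≢B) (no I≢S) (yes xI≈0) _ = cubic I I≢B I≢S (λ _ → 0#) (poly-const 0#)
          (λ s → trans (*0≈0 xI≈0) (sym (zeroʳ _)))
        -- An element outside `B` other than `j` contributes the factor `s * s * s` alone.
        remainder I (no I≢B) (no I≢S) (no xI≉0) (yes (l , l∈I , l∉B , l≢j)) =
          cubic I I≢B I≢S (λ s → rest s * x I)
            (poly-* (poly-prod (λ m → poly-if (does (m Fin.≟ l)) (poly-const 1#) (factor-poly (proj₁ I) m))) (poly-const (x I)))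
            (λ s → trans (*-congʳ (trans (prod-extract (factor (proj₁ I) s) l)
              (*-congʳ (trans (factor-in (proj₁ I) s l l∈I) (t-out s l l∉B l≢j))))) (*-assoc _ _ _))
          where
          rest : 𝕂 → 𝕂
          rest s = prod (λ m → if does (m Fin.≟ l) then 1# else factor (proj₁ I) s m)
        -- All elements lie in `B` or equal `j`. A basis other than `B` then contains `j`, one other
        -- than `S` contains `i`, and these two contribute `s * s` and `s`.
        remainder I (no I≢B) (no I≢S) (no xI≉0) (no ¬p) =
          cubic I I≢B I≢S (λ s → rest s * x I)
            (poly-* (poly-prod (λ m → poly-if (does (m Fin.≟ j)) (poly-const 1#)
              (poly-if (does (m Fin.≟ i)) (poly-const 1#) (factor-poly (proj₁ I) m)))) (poly-const (x I)))
            (λ s → trans (*-congʳ (trans (prod-extract (factor (proj₁ I) s) i) (*-cong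
                (trans (factor-in (proj₁ I) s i i∈I) (t-i s))
                (trans (prod-extract (λ m → if does (m Fin.≟ i) then 1# else factor (proj₁ I) s m) j)
                  (*-congʳ (trans (skip-i s) (trans (factor-in (proj₁ I) s j j∈I) (t-j s))))))))
              (solve 3 (λ s r x → s :* (s :* s :* r) :* x := s :* s :* s :* (r :* x)) refl s (rest s) (x I)))
          where
          Q = x≉0⇒reduced I xI≉0
          within : ∀ l → lookup (proj₁ I) l ≡ true → l ≢ j → lookup B l ≡ true
          within l l∈I l≢j = not-false (λ l∉B → ¬p (l , l∈I , l∉B , l≢j))
          j∈I : lookup (proj₁ I) j ≡ true
          j∈I = not-false (λ j∉I → I≢B (bases-⊆ Q R (λ l l∈I → within l l∈I (λ { ≡.refl → true≢false l∈I j∉I }))))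
          i∈I : lookup (proj₁ I) i ≡ true
          i∈I = not-false (λ i∉I → I≢S (bases-⊆ Q (edge-basis e) (λ l l∈I → case l Fin.≟ j of λ
            { (yes ≡.refl) → swap-new B
            ; (no l≢j) → ≡.trans (swap-other B l≢j (λ { ≡.refl → true≢false l∈I i∉I })) (within l l∈I l≢j) })))
          rest : 𝕂 → 𝕂
          rest s = prod (λ m → if does (m Fin.≟ j) then 1# else (if does (m Fin.≟ i) then 1# else factor (proj₁ I) s m))
          skip-i : ∀ s → (if does (j Fin.≟ i) then 1# else factor (proj₁ I) s j) ≈ factor (proj₁ I) s j
          skip-i s with j Fin.≟ i
          ... | yes p = contradiction (≡.sym p) i≢j
          ... | no  _ = refl

        remainders : ∀ I → Remainder I
        remainders I = remainder I (em _) (em _) (em _) (em _)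

      curve-vanishes : ∀ f → VanishesOnOrbit f →
        eval (poly f) (λ _ → dirac B) ≈ 0# × diff (poly f) (λ _ → dirac B) (λ _ → dirac S) ≈ 0#
      curve-vanishes f vanishes = derivative-vanishes (dirac B) (dirac S) (λ s I → proj₁ (remainders I) s)
        (λ I → proj₁ (proj₂ (remainders I))) (poly f) (0# ∷ [])
        -- The factor `s` pulled out of the curve changes the value of the form by a power of `s`,
        -- by homogeneity.
        (λ s s∉ → let s≉0 = s∉ ∘ here in *-cancel-0 (^-≉0 s≉0 (degree f zero))
          (trans (sym (eval-scale (degree f) (poly f) (homogeneous f) s _))
            (trans (eval-cong (poly f) (λ _ I → sym (proj₂ (proj₂ (remainders I)) s))) (vanishes (t s , t-≉0 s≉0)))))

-- Comparison of tangent dimensions: no four-cycles.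

module TangentDimensions {K : CommutativeRing 0ℓ 0ℓ} (F : ClassicalField K) where
  open FourCycles F public

  private variable
    ℓ : Level
    k n : ℕ

  indicator : Subset n → Fin n → 𝕂
  indicator B l = if lookup B l then 1# else 0#

  indicator-in : ∀ (B : Subset n) {l} → lookup B l ≡ true → indicator B l ≈ 1#
  indicator-in B e = reflexive (≡.cong (λ b → if b then 1# else 0#) e)

  indicator-out : ∀ (B : Subset n) {l} → lookup B l ≡ false → indicator B l ≈ 0#
  indicator-out B e = reflexive (≡.cong (λ b → if b then 1# else 0#) e)

  -- Multiplying the columns of the reduced rows by the indicator of `B`, a degenerate torus
  -- element, gives a basis of the coordinate subspace of `B`; the scaling formula for columns then
  -- computes its Plücker coordinates.
  coordinate-subspace : {W : Pred (Fin n → 𝕂) ℓ} (H : HasDimension W k) {B : Subset n} (R : Reduced W B) → ∣ B ∣ ≡ k →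
    Σ[ Y ∈ Gr k (Fin n) ] plücker Y ∝ (λ I → weight (indicator B) (proj₁ I) * plü (HasDimension.basis H) I)
  coordinate-subspace {n} H {B} R ≡.refl = Y , c , c≉0 , λ I → begin
    plücker Y I                                                   ≡⟨ plücker≡plü Y I ⟩
    plü (λ i l → row (elements B i) l * indicator B l) I            ≈⟨ plü-columns (row ∘ elements B) (indicator B) I ⟩
    weight (indicator B) (proj₁ I) * plü (row ∘ elements B) I       ≈⟨ *-congˡ (c-≈ I) ⟩
    weight (indicator B) (proj₁ I) * (c * plü b I)
      ≈⟨ solve 3 (λ w c p → w :* (c :* p) := c :* (w :* p)) refl (weight (indicator B) (proj₁ I)) c (plü b I) ⟩
    c * (weight (indicator B) (proj₁ I) * plü b I)                  ∎
    where
    open ≈-Reasoning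
    open Reduced R
    b = HasDimension.basis H
    change = plü-change-of-basis H (reduced⇒dimension (closed H) R)
    c = proj₁ change
    c≉0 = proj₁ (proj₂ change)
    c-≈ = proj₂ (proj₂ change)
    e : Fin ∣ B ∣ → Fin n → 𝕂
    e i l = row (elements B i) l * indicator B l
    at : ∀ c j → combination c e (elements B j) ≈ c j
    at c j = trans (sum-cong-≋ (λ i → *-congˡ {c i} (trans
      (*-cong (row-δ _ _ (elements∈ B i) (elements∈ B j)) (indicator-in B (elements∈ B j)))
      (trans (*-identityʳ _) (δ-elements B i j))))) (sum-δ c j)
    outside : ∀ c l → lookup B l ≡ false → combination c e l ≈ 0#
    outside c l l∉ = sum-zero {f = λ i → c i * e i l}
      (λ i → *0≈0 (*0≈0 (indicator-out B l∉)))
    agrees : ∀ (v : Fin n → 𝕂) → (∀ l → lookup B l ≡ false → v l ≈ 0#) → ∀ l b → lookup B l ≡ b →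
      v l ≈ combination (v ∘ elements B) e l
    agrees v v0 l false p = trans (v0 l p) (sym (outside _ l p))
    agrees v v0 l true  p = let (j , e′) = elements-surjective B l p in
      ≡.subst (λ l → v l ≈ combination (v ∘ elements B) e l) e′ (sym (at (v ∘ elements B) j))
    Y : Gr ∣ B ∣ (Fin n)
    Y = record
      { subspace = λ v → ∀ l → lookup B l ≡ false → v l ≈ 0#
      ; dimension = record
        { basis = e
        ; independent = λ c z j → trans (sym (at c j)) (z (elements B j))
        ; spans = λ v → mk⇔ (λ v∈ → v ∘ elements B , λ l → agrees v v∈ l (lookup B l) ≡.refl)
            (λ (c , z) l p → trans (z l) (outside c l p)) } }

  module _ (X : Gr k (Fin n)) {D : ℕ}
    (smooth : ∀ p → p ∈ Plücker (OrbitClosure X) → HasDimension (ConeTangentSpace (Plücker (OrbitClosure X)) p) D)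
    {B : Subset n} (R : Reduced (subspace X) B) where
    open Closure X
    private
      H = dimension X
      IB = basis-index R
      E = Edge X R
      δᴮ = dirac X R

      -- The weight vanishes unless `I ⊆ B`, and a basis contained in `B` equals `B`.
      weight-dirac : ∀ I → weight (indicator B) (proj₁ I) * x I ≈ δᴮ B I
      weight-dirac I = by-cases (em _) (em _) (em _)
        where
        by-cases : Dec (proj₁ I ≡ B) → Dec (x I ≈ 0#) → Dec (∃[ l ] lookup (proj₁ I) l ≡ true × lookup B l ≡ false) →
          weight (indicator B) (proj₁ I) * x I ≈ δᴮ B I
        by-cases (yes I≡B) _ _ = trans (*-congʳ (trans (reflexive (≡.cong (weight (indicator B)) I≡B)) (prod-one one)))
          (trans (*-identityˡ _) (sym (dirac-at X R B I I≡B)))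
          where
          one : ∀ l → (if lookup B l then indicator B l else 1#) ≈ 1#
          one l with lookup B l
          ... | true  = refl
          ... | false = refl
        by-cases (no I≢B) (yes xI≈0) _ = trans (*-congˡ xI≈0) (trans (zeroʳ _) (sym (dirac-off X R B I I≢B)))
        by-cases (no I≢B) (no xI≉0) (no ¬p) = contradiction
          (bases-⊆ (x≉0⇒reduced I xI≉0) R (λ l l∈I → not-false (λ l∉B → ¬p (l , l∈I , l∉B)))) I≢B
        by-cases (no I≢B) (no xI≉0) (yes (l , l∈I , l∉B)) = trans (*-congʳ (trans
          (prod-extract (λ l → if lookup (proj₁ I) l then indicator B l else 1#) l)
          (0*≈0 (trans (reflexive (≡.cong (λ b → if b then indicator B l else 1#) l∈I)) (indicator-out B l∉B)))))
          (trans (zeroˡ _) (sym (dirac-off X R B I I≢B)))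

      fixed-point : Σ[ Y ∈ Gr k (Fin n) ] plücker Y ∝ δᴮ B
      fixed-point = let (Y , e) = coordinate-subspace H R (reduced-size H R) in
        Y , ∝-trans e (≋⇒∝ (λ I → trans (*-congˡ (sym (reflexive (plücker≡plü X I)))) (weight-dirac I)))

      -- The curve of any edge runs into this point; hence the edge among the arguments.
      fixed∈Z : ∀ {i j} → E i j → point (δᴮ B) (IB , dirac≉0 X R) ∈ Z
      fixed∈Z e = proj₁ fixed-point ,
        closure-intro {proj₁ fixed-point} (λ f vanishes → vanishes-∝ f (proj₂ fixed-point) (proj₁ (Curve.curve-vanishes X R e f vanishes))) ,
        ∝-sym (proj₂ fixed-point)

      T₀ = Tangent (δᴮ B) (IB , dirac≉0 X R)
      T₁ = Tangent x (coordinate≉0 X)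

      edge-tangent : ∀ {i j} → E i j → δᴮ (swap B i j) ∈ T₀
      edge-tangent e = tangent-intro {δᴮ B} {IB , dirac≉0 X R} {δᴮ (swap B _ _)} (λ f vanishes → proj₂ (Curve.curve-vanishes X R e f vanishes))

      -- A cone contains the line through each of its points: here the curve is `(1 + s) * p`.
      radial-tangent : ∀ {i j} → E i j → δᴮ B ∈ T₀
      radial-tangent e = tangent-intro {δᴮ B} {IB , dirac≉0 X R} {δᴮ B} (λ f vanishes → proj₂ (derivative-vanishes (δᴮ B) (δᴮ B)
        (λ _ _ → 0#) (λ _ → poly-const 0#) (poly f) []
        (λ s _ → trans (eval-cong (poly f) (λ _ I → radial s (δᴮ B I)))
          (trans (eval-scale (degree f) (poly f) (homogeneous f) (1# + s) (δᴮ B))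
            (*0≈0 (proj₁ (Curve.curve-vanishes X R e f vanishes)))))))
        where
        radial : ∀ s p → p + s * (p + s * 0#) ≈ (1# + s) * p
        radial s p = trans (+-cong (sym (*-identityˡ p)) (*-congˡ (trans (+-congˡ (zeroʳ s)) (+-identityʳ p)))) (sym (distribʳ p 1# s))

      -- Edges are coded as numbers below `n * n`, so that sets of edges are subsets and can be
      -- counted.
      E′ : Fin (n ℕ.* n) → Set
      E′ q = E (proj₁ (remQuot {n} n q)) (proj₂ (remQuot {n} n q))

      E⇒E′ : ∀ {i j} → E i j → E′ (combine i j)
      E⇒E′ {i} {j} = ≡.subst (λ p → E (proj₁ p) (proj₂ p)) (≡.sym (Fin.remQuot-combine i j))

      edges-except : Fin (n ℕ.* n) → Subset (n ℕ.* n)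
      edges-except q₀ = tabulate (λ q → does (em (E′ q × q ≢ q₀)))

      in-edges : ∀ q₀ q → lookup (edges-except q₀) q ≡ true → E′ q × q ≢ q₀
      in-edges q₀ q e = by-cases (em _) (≡.trans (≡.sym (Vec.lookup∘tabulate _ q)) e)
        where
        by-cases : (d : Dec (E′ q × q ≢ q₀)) → does d ≡ true → E′ q × q ≢ q₀
        by-cases (yes p) _ = p

      edges-in : ∀ q₀ q → E′ q → q ≢ q₀ → lookup (edges-except q₀) q ≡ true
      edges-in q₀ q e q≢ = ≡.trans (Vec.lookup∘tabulate _ q) (by-cases (em _))
        where
        by-cases : (d : Dec (E′ q × q ≢ q₀)) → does d ≡ true
        by-cases (yes _) = ≡.refl
        by-cases (no ¬p) = contradiction (e , q≢) ¬p

    module _ {i₁ i₂ j₁ j₂ : Fin n} (i₁≢i₂ : i₁ ≢ i₂) (j₁≢j₂ : j₁ ≢ j₂)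
      (e₁₁ : E i₁ j₁) (e₁₂ : E i₁ j₂) (e₂₁ : E i₂ j₁) (e₂₂ : E i₂ j₂) where
      private
        -- The edge whose coordinate turns out redundant at X; `N` counts the remaining edges.
        q₀ = combine i₂ j₂
        others = edges-except q₀
        N = ∣ others ∣

        arrow : Fin (suc N) → Fin (n ℕ.* n)
        arrow zero    = q₀
        arrow (suc a) = elements others a

        arrow-edge : ∀ a → E′ (arrow a)
        arrow-edge zero    = E⇒E′ e₂₂
        arrow-edge (suc a) = proj₁ (in-edges q₀ _ (elements∈ others a))

        arrow-injective : ∀ a b → arrow a ≡ arrow b → a ≡ b
        arrow-injective zero    zero    _ = ≡.refl
        arrow-injective zero    (suc b) e = contradiction (≡.sym e) (proj₂ (in-edges q₀ _ (elements∈ others b)))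
        arrow-injective (suc a) zero    e = contradiction e (proj₂ (in-edges q₀ _ (elements∈ others a)))
        arrow-injective (suc a) (suc b) e = ≡.cong suc (elements-injective others e)

        node : Fin (suc (suc N)) → KSubset k n
        node zero    = IB
        node (suc a) = edge-set X R (arrow-edge a)

        node-injective : ∀ a b → proj₁ (node a) ≡ proj₁ (node b) → a ≡ b
        node-injective zero    zero    _ = ≡.refl
        node-injective zero    (suc b) e = contradiction e (swap≢ X R (arrow-edge b))
        node-injective (suc a) zero    e = contradiction (≡.sym e) (swap≢ X R (arrow-edge a))
        node-injective (suc a) (suc b) e = ≡.cong suc (arrow-injective a b (let (p , q) = swap-injective X R (arrow-edge a) (arrow-edge b) e in
          ≡.trans (≡.sym (Fin.combine-remQuot {n} n (arrow a))) (≡.trans (≡.cong₂ combine p q) (Fin.combine-remQuot {n} n (arrow b)))))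

        x-node≉0 : ∀ a → x (node a) ≉ 0#
        x-node≉0 zero    = x-basis≉0 R (proj₂ IB)
        x-node≉0 (suc a) = x-basis≉0 (edge-basis X R (arrow-edge a)) (proj₂ (node (suc a)))

        u : Fin (suc (suc N)) → KSubset k n → 𝕂
        u a = δᴮ (proj₁ (node a))

        u∈ : ∀ a → u a ∈ T₀
        u∈ zero    = radial-tangent e₁₁
        u∈ (suc a) = edge-tangent (arrow-edge a)

        u-independent : ∀ c → combination c u ≋ (λ _ → 0#) → ∀ a → c a ≈ 0#
        u-independent c e a = *-cancel-0 (x-node≉0 a) (trans (*-comm _ _) (trans
          (sym (trans (sum-single (λ b → c b * u b (node a)) a (λ b b≢a →
              *0≈0 (dirac-off X R (proj₁ (node b)) (node a) (λ p → b≢a (≡.sym (node-injective a b p))))))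
            (*-congˡ (dirac-at X R (proj₁ (node a)) (node a) ≡.refl)))) (e (node a))))

        -- At the fixed point the radial direction and the `1 + N` edge directions are independent.
        lower : suc (suc N) ℕ.≤ D
        lower = independent-bound (smooth (point (δᴮ B) (IB , dirac≉0 X R)) (fixed∈Z e₁₁)) u u∈ u-independent

        φ : Fin (suc N) → KSubset k n
        φ zero    = IB
        φ (suc a) = node (suc (suc a))

        module _ (v : KSubset k n → 𝕂) (v∈ : v ∈ T₁) (v0 : ∀ a → v (φ a) ≈ 0#) where
          v-≡ : ∀ I J → proj₁ I ≡ proj₁ J → v I ≈ v J
          v-≡ I J e = reflexive (≡.cong v (KSubset-≡ {I = I} {J} e))

          v-other : ∀ {i j} (e : E i j) → combine i j ≢ q₀ → v (edge-set X R e) ≈ 0#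
          v-other {i} {j} e ≢q₀ = trans (v-≡ (edge-set X R e) (φ (suc a)) sets) (v0 (suc a))
            where
            found : ∃[ a ] elements others a ≡ combine i j
            found = elements-surjective others (combine i j) (edges-in q₀ _ (E⇒E′ e) ≢q₀)
            a = proj₁ found
            sets : swap B i j ≡ swap B (proj₁ (remQuot {n} n (elements others a))) (proj₂ (remQuot {n} n (elements others a)))
            sets = ≡.sym (≡.cong (λ p → swap B (proj₁ p) (proj₂ p)) (≡.trans (≡.cong (remQuot {n} n) (proj₂ found)) (Fin.remQuot-combine i j)))

          ≢q₀ : ∀ {i j} → (i , j) ≢ (i₂ , j₂) → combine i j ≢ q₀
          ≢q₀ {i} {j} p q = let (a , b) = Fin.combine-injective i j i₂ j₂ q in p (≡.cong₂ _,_ a b)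

          -- The exchanges along the opposite edges `e₂₂` and `e₁₁` move the same elements as those
          -- along `e₁₂` and `e₂₁`, so a quadric relates the four coordinates.
          v-last : v (edge-set X R e₂₂) ≈ 0#
          v-last = AtX.tangent-quadric v∈ (edge-set X R e₂₂) (edge-set X R e₁₁) (edge-set X R e₁₂) (edge-set X R e₂₁)
            (weight-exchange (swap B i₂ j₂) (swap B i₁ j₁) (swap B i₁ j₂) (swap B i₂ j₁)
              (λ l → pointwise l (l Fin.≟ i₁) (l Fin.≟ i₂) (l Fin.≟ j₁) (l Fin.≟ j₂)))
            (x-basis≉0 (edge-basis X R e₁₁) (proj₂ (edge-set X R e₁₁))) (x-basis≉0 (edge-basis X R e₁₂) (proj₂ (edge-set X R e₁₂)))
            (x-basis≉0 (edge-basis X R e₂₁) (proj₂ (edge-set X R e₂₁)))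
            (v-other e₁₁ (≢q₀ (i₁≢i₂ ∘ ≡.cong proj₁))) (v-other e₁₂ (≢q₀ (i₁≢i₂ ∘ ≡.cong proj₁))) (v-other e₂₁ (≢q₀ (j₁≢j₂ ∘ ≡.cong proj₂)))
            where
            i₁∈ = proj₁ e₁₁
            i₂∈ = proj₁ e₂₂
            j₁∉ = proj₁ (proj₂ e₁₁)
            j₂∉ = proj₁ (proj₂ e₂₂)
            sw = swap B
            pointwise : ∀ l → Dec (l ≡ i₁) → Dec (l ≡ i₂) → Dec (l ≡ j₁) → Dec (l ≡ j₂) →
              (lookup (sw i₂ j₂) l ≡ lookup (sw i₁ j₂) l × lookup (sw i₁ j₁) l ≡ lookup (sw i₂ j₁) l) ⊎
              (lookup (sw i₂ j₂) l ≡ lookup (sw i₂ j₁) l × lookup (sw i₁ j₁) l ≡ lookup (sw i₁ j₂) l)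
            pointwise l (yes ≡.refl) _ _ _ = inj₂
              ( ≡.trans (swap-other B (∈≢∉ {S = B} i₁∈ j₂∉) i₁≢i₂) (≡.sym (swap-other B (∈≢∉ {S = B} i₁∈ j₁∉) i₁≢i₂))
              , ≡.trans (swap-old B (∈≢∉ {S = B} i₁∈ j₁∉)) (≡.sym (swap-old B (∈≢∉ {S = B} i₁∈ j₂∉))) )
            pointwise l (no _) (yes ≡.refl) _ _ = inj₂
              ( ≡.trans (swap-old B (∈≢∉ {S = B} i₂∈ j₂∉)) (≡.sym (swap-old B (∈≢∉ {S = B} i₂∈ j₁∉)))
              , ≡.trans (swap-other B (∈≢∉ {S = B} i₂∈ j₁∉) (i₁≢i₂ ∘ ≡.sym)) (≡.sym (swap-other B (∈≢∉ {S = B} i₂∈ j₂∉) (i₁≢i₂ ∘ ≡.sym))) )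
            pointwise l (no l≢i₁) (no l≢i₂) (yes ≡.refl) _ = inj₁
              ( ≡.trans (swap-other B j₁≢j₂ l≢i₂) (≡.sym (swap-other B j₁≢j₂ l≢i₁))
              , ≡.trans (swap-new B) (≡.sym (swap-new B)) )
            pointwise l (no l≢i₁) (no l≢i₂) (no l≢j₁) (yes ≡.refl) = inj₁
              ( ≡.trans (swap-new B) (≡.sym (swap-new B))
              , ≡.trans (swap-other B l≢j₁ l≢i₁) (≡.sym (swap-other B l≢j₁ l≢i₂)) )
            pointwise l (no l≢i₁) (no l≢i₂) (no l≢j₁) (no l≢j₂) = inj₁
              ( ≡.trans (swap-other B l≢j₂ l≢i₂) (≡.sym (swap-other B l≢j₂ l≢i₁))
              , ≡.trans (swap-other B l≢j₁ l≢i₁) (≡.sym (swap-other B l≢j₁ l≢i₂)) )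

          v-edge : ∀ {i j} (e : E i j) → v (edge-set X R e) ≈ 0#
          v-edge {i} {j} e = by-cases (em _)
            where
            by-cases : Dec (combine i j ≡ q₀) → v (edge-set X R e) ≈ 0#
            by-cases (no ≢q₀) = v-other e ≢q₀
            by-cases (yes q)  = trans (v-≡ (edge-set X R e) (edge-set X R e₂₂)
              (let (a , b) = Fin.combine-injective i j i₂ j₂ q in ≡.cong₂ (swap B) a b)) v-last

          v-determined : v ≋ (λ _ → 0#)
          v-determined = tangent-determined X R v∈ (v0 zero) v-edge

        -- At X the coordinates at `B` and at the `N` edges other than `q₀` determine a tangent
        -- vector.
        upper : D ℕ.≤ suc N
        upper = coordinates-bound (smooth (point x (coordinate≉0 X)) (X , X∈closure , ≋⇒∝ (λ _ → refl))) φ v-determined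

      no-four-cycle : ⊥
      no-four-cycle = ℕ.<-irrefl ≡.refl (ℕ.≤-trans lower upper)

-- From the absence of four-cycles to stars.

module Centers {K : CommutativeRing 0ℓ 0ℓ} (F : ClassicalField K) where
  open TangentDimensions F public

  private variable
    k n : ℕ

  module _ (X : Gr k (Fin n)) {D : ℕ}
    (smooth : ∀ p → p ∈ Plücker (OrbitClosure X) → HasDimension (ConeTangentSpace (Plücker (OrbitClosure X)) p) D)
    {B : Subset n} (R : Reduced (subspace X) B) where

    -- If row i₂ vanishes at j₁, pivoting on (i₁ , j₂) turns the path into a four-cycle.
    no-path : ∀ {i₁ i₂ j₁ j₂} → Edge X R i₁ j₁ → Edge X R i₁ j₂ → Edge X R i₂ j₂ → i₁ ≢ i₂ → j₁ ≢ j₂ → ⊥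
    no-path {i₁} {i₂} {j₁} {j₂} e₁₁@(i₁∈ , j₁∉ , r₁₁) e₁₂@(_ , j₂∉ , r₁₂) e₂₂@(i₂∈ , _ , r₂₂) i₁≢i₂ j₁≢j₂ = by-cases (em _)
      where
      open Reduced R
      by-cases : Dec (row i₂ j₁ ≈ 0#) → ⊥
      by-cases (no r₂₁) = no-four-cycle X smooth R i₁≢i₂ j₁≢j₂ e₁₁ e₁₂ (i₂∈ , j₁∉ , r₂₁) e₂₂
      by-cases (yes r₂₁) = no-four-cycle X smooth R′ (∈≢∉ {S = B} i₂∈ j₂∉ ∘ ≡.sym) (∈≢∉ {S = B} i₁∈ j₁∉)
          (swap-new B , i₁∉′ , new i₁ (≉0-cong (sym (row-diag i₁ i₁∈)) 1≉0))
          (swap-new B , j₁∉′ , new j₁ r₁₁)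
          (i₂∈′ , i₁∉′ , other i₁ (row-off i₂ i₁ i₁∈ (i₁≢i₂ ∘ ≡.sym)) (≉0-cong (sym (row-diag i₁ i₁∈)) 1≉0))
          (i₂∈′ , j₁∉′ , other j₁ r₂₁ r₁₁)
        where
        R′ = edge-basis X R e₁₂
        i₁∉′ = swap-old B (∈≢∉ {S = B} i₁∈ j₂∉)
        j₁∉′ = ≡.trans (swap-other B j₁≢j₂ (∈≢∉ {S = B} i₁∈ j₁∉ ∘ ≡.sym)) j₁∉
        i₂∈′ = ≡.trans (swap-other B (∈≢∉ {S = B} i₂∈ j₂∉) (i₁≢i₂ ∘ ≡.sym)) i₂∈
        new : ∀ y → row i₁ y ≉ 0# → Reduced.row R′ j₂ y ≉ 0#
        new y p = ≉0-cong (sym (pivot-row-new (X-closed X) R i₁∈ j₂∉ r₁₂ y)) (*-≉0 (inv≉0 r₁₂) p)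
        -- Row `i₂` loses a nonzero multiple of row `i₁`; at `i₁` and `j₁` it was zero before, so
        -- its new entries there are nonzero.
        other : ∀ y → row i₂ y ≈ 0# → row i₁ y ≉ 0# → Reduced.row R′ i₂ y ≉ 0#
        other y z p = ≉0-cong (sym (trans (pivot-row-other (X-closed X) R i₁∈ j₂∉ r₁₂ i₂∈ (i₁≢i₂ ∘ ≡.sym) y)
          (0+≈ z))) (-‿≉0 (*-≉0 r₂₂ (*-≉0 (inv≉0 r₁₂) p)))

  -- A bipartite graph between B and its complement without paths of length three
  -- is a disjoint union of stars; center maps a vertex to the center of its star.
  module Stars {B : Subset n} (_—_ : Fin n → Fin n → Set)
    (—-ends : ∀ {i j} → i — j → lookup B i ≡ true × lookup B j ≡ false)
    (no-path : ∀ {i₁ i₂ j₁ j₂} → i₁ — j₁ → i₁ — j₂ → i₂ — j₂ → i₁ ≢ i₂ → j₁ ≢ j₂ → ⊥) where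

    -- Leaves lie outside `B` and branches inside; a branch is a vertex whose star is centered
    -- outside `B`. A star with a single edge has its center in `B`, because its other end is a
    -- leaf.
    Leaf : Fin n → Set
    Leaf j = ∃[ i ] i — j × (∀ i′ → i′ — j → i′ ≡ i)

    Branch : Fin n → Set
    Branch i = ∃[ j ] i — j × ¬ Leaf j

    private
      center-by : ∀ {l} → Dec (Leaf l) → Dec (Branch l) → Fin n
      center-by     (yes (i , _)) _             = i
      center-by     (no _)        (yes (j , _)) = j
      center-by {l} (no _)        (no _)        = l

    center : Fin n → Fin n
    center l = center-by (em (Leaf l)) (em (Branch l))

    another : ∀ {i j} → i — j → ¬ Leaf j → ∃[ i′ ] i′ — j × i ≢ i′
    another {i} {j} e ¬leaf = by-cases (em _)
      where
      by-cases : Dec (∃[ i′ ] i′ — j × i ≢ i′) → ∃[ i′ ] i′ — j × i ≢ i′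
      by-cases (yes p) = p
      by-cases (no ¬p) = contradiction (i , e , λ i′ e′ → case i′ Fin.≟ i of λ
        { (yes p) → p ; (no p) → contradiction (i′ , e′ , p ∘ ≡.sym) ¬p }) ¬leaf

    not-leaf : ∀ {i j} → i — j → ¬ Leaf i
    not-leaf e (_ , e′ , _) = true≢false (proj₁ (—-ends e)) (proj₂ (—-ends e′))

    not-branch : ∀ {i j} → i — j → ¬ Branch j
    not-branch e (_ , e′ , _) = true≢false (proj₁ (—-ends e′)) (proj₂ (—-ends e))

    -- If the two values differed, `i` would have two neighbours, one of which has a second
    -- neighbour: a path of length three.
    center-edge : ∀ {i j} → i — j → center i ≡ center j
    center-edge {i} {j} e = by-cases (em (Leaf i)) (em (Branch i)) (em (Leaf j)) (em (Branch j))
      where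
      by-cases : (a : Dec (Leaf i)) (b : Dec (Branch i)) (c : Dec (Leaf j)) (d : Dec (Branch j)) → center-by a b ≡ center-by c d
      by-cases (yes p) _ _ _ = contradiction p (not-leaf e)
      by-cases (no _) _ (no _) (yes p) = contradiction p (not-branch e)
      by-cases (no _) (yes (j′ , e′ , ¬leaf)) (yes leaf) _ = let (i′ , e″ , i≢i′) = another e′ ¬leaf in
        ⊥-elim (no-path e e′ e″ i≢i′ (λ { ≡.refl → ¬leaf leaf }))
      by-cases (no _) (no _) (yes (i′ , _ , unique)) _ = unique i e
      by-cases (no _) (no ¬p) (no ¬leaf) (no _) = contradiction (j , e , ¬leaf) ¬p
      by-cases (no _) (yes (j′ , e′ , ¬leaf′)) (no ¬leaf) (no _) with j′ Fin.≟ j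
      ... | yes p = p
      ... | no  p = let (i′ , e″ , i≢i′) = another e ¬leaf in ⊥-elim (no-path e′ e e″ i≢i′ p)

    center-cases : ∀ l → center l ≡ l ⊎ (center l — l ⊎ l — center l)
    center-cases l = by-cases (em (Leaf l)) (em (Branch l))
      where
      by-cases : (a : Dec (Leaf l)) (b : Dec (Branch l)) → center-by a b ≡ l ⊎ (center-by a b — l ⊎ l — center-by a b)
      by-cases (yes (i , e , _)) _               = inj₂ (inj₁ e)
      by-cases (no _)            (yes (j , e , _)) = inj₂ (inj₂ e)
      by-cases (no _)            (no _)          = inj₁ ≡.refl

    center-idempotent : ∀ l → center (center l) ≡ center l
    center-idempotent l with center-cases l
    ... | inj₁ p        = ≡.cong center p
    ... | inj₂ (inj₁ e) = center-edge e
    ... | inj₂ (inj₂ e) = ≡.sym (center-edge e)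

    center-∈ : ∀ {l} → lookup B l ≡ true → l ≢ center l → l — center l
    center-∈ {l} l∈ ≢ with center-cases l
    ... | inj₁ p        = contradiction (≡.sym p) ≢
    ... | inj₂ (inj₁ e) = contradiction (proj₂ (—-ends e)) (true≢false l∈)
    ... | inj₂ (inj₂ e) = e

    center-∉ : ∀ {l} → lookup B l ≡ false → l ≢ center l → center l — l
    center-∉ {l} l∉ ≢ with center-cases l
    ... | inj₁ p        = contradiction (≡.sym p) ≢
    ... | inj₂ (inj₁ e) = e
    ... | inj₂ (inj₂ e) = contradiction l∉ (true≢false (proj₁ (—-ends e)))

-- Sums of lines and hyperplanes in blocks.

module BlockSpaces {K : CommutativeRing 0ℓ 0ℓ} (F : ClassicalField K) where
  open Centers F public

  private variable
    k : ℕ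

  mkReduced-row : ∀ {n ℓ} {W : Pred (Fin n → 𝕂) ℓ} (W-closed : Closed W) S row p q r b → lookup S b ≡ true →
    Reduced.row (mkReduced W-closed S row p q r) b ≡ row b
  mkReduced-row W-closed S row p q r b b∈ with lookup S b | b∈
  ... | .true | ≡.refl = ≡.refl

  does-true : ∀ {P : Set} (d : Dec P) → P → does d ≡ true
  does-true (yes _) _ = ≡.refl
  does-true (no ¬p) p = contradiction p ¬p

  does-false : ∀ {P : Set} (d : Dec P) → ¬ P → does d ≡ false
  does-false (yes p) ¬p = contradiction p ¬p
  does-false (no _)  _  = ≡.refl

  from-does : ∀ {P : Set} (d : Dec P) → does d ≡ true → P
  from-does (yes p) _ = p

  _when_ : ∀ {P : Set} → 𝕂 → Dec P → 𝕂
  x when d = if does d then x else 0#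

  when-yes : ∀ {P : Set} (d : Dec P) {x} → P → x when d ≈ x
  when-yes (yes _) _ = refl
  when-yes (no ¬p) p = contradiction p ¬p

  when-no : ∀ {P : Set} (d : Dec P) {x} → ¬ P → x when d ≈ 0#
  when-no (yes p) ¬p = contradiction p ¬p
  when-no (no _)  _  = refl

  -- The index set is partitioned into the fibres of blk.  A point y determines in each
  -- block a line (spanned by y) or a hyperplane (with equation y).
  module Blocks {n r : ℕ} (blk : Fin n → Fin r) (isLine : Fin r → Bool) where

    -- The line is cut out by 2 by 2 minors, so that no nonzero coordinate of `y` has to be singled
    -- out and the condition is linear in `v`.
    OnLine OnHyperplane : Fin r → (y v : Fin n → 𝕂) → Set
    OnLine a y v = ∀ l l′ → blk l ≡ a → blk l′ ≡ a → y l * v l′ ≈ y l′ * v l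
    OnHyperplane a y v = sum (λ l → (y l * v l) when (blk l Fin.≟ a)) ≈ 0#

    Condition : Bool → Fin r → (y v : Fin n → 𝕂) → Set
    Condition true  = OnLine
    Condition false = OnHyperplane

    Space : (Fin n → 𝕂) → Pred (Fin n → 𝕂) 0ℓ
    Space y v = ∀ a → Condition (isLine a) a y v

    when-cong : ∀ {P : Set} (d : Dec P) {x y} → x ≈ y → x when d ≈ y when d
    when-cong d e = if-cong (does d) e refl

    when-sum : ∀ {P : Set} {m} (d : Dec P) (f : Fin m → 𝕂) → sum f when d ≈ sum (λ j → f j when d)
    when-sum         (yes _) f = refl
    when-sum {m = m} (no _)  f = sym (sum-replicate-zero m)

    condition-closed : ∀ b a y {m} (c : Fin m → 𝕂) (u : Fin m → Fin n → 𝕂) → (∀ j → Condition b a y (u j)) →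
      ∀ v → v ≋ combination c u → Condition b a y v
    condition-closed true a y c u h v e l l′ p p′ = begin
      y l * v l′                             ≈⟨ *-congˡ (e l′) ⟩
      y l * sum (λ j → c j * u j l′)          ≈⟨ scale l l′ ⟩
      sum (λ j → c j * (y l * u j l′))        ≈⟨ sum-cong-≋ (λ j → *-congˡ {c j} (h j l l′ p p′)) ⟩
      sum (λ j → c j * (y l′ * u j l))        ≈⟨ scale l′ l ⟨
      y l′ * sum (λ j → c j * u j l)          ≈⟨ *-congˡ (e l) ⟨
      y l′ * v l                             ∎
      where
      open ≈-Reasoning
      scale : ∀ l l′ → y l * sum (λ j → c j * u j l′) ≈ sum (λ j → c j * (y l * u j l′))
      scale l l′ = trans (*-distribˡ-sum (y l) (λ j → c j * u j l′))
        (sum-cong-≋ (λ j → solve 3 (λ y c u → y :* (c :* u) := c :* (y :* u)) refl (y l) (c j) (u j l′)))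
    condition-closed false a y c u h v e = begin
      sum (λ l → (y l * v l) when (blk l Fin.≟ a))
        ≈⟨ sum-cong-≋ (λ l → trans (when-cong (blk l Fin.≟ a) (trans (*-congˡ (e l)) (*-distribˡ-sum (y l) (λ j → c j * u j l))))
             (when-sum (blk l Fin.≟ a) (λ j → y l * (c j * u j l)))) ⟩
      sum (λ l → sum (λ j → (y l * (c j * u j l)) when (blk l Fin.≟ a)))
        ≈⟨ ∑-comm (λ l j → (y l * (c j * u j l)) when (blk l Fin.≟ a)) ⟩
      sum (λ j → sum (λ l → (y l * (c j * u j l)) when (blk l Fin.≟ a)))
        ≈⟨ sum-zero (λ j → trans (sum-cong-≋ (λ l → pull (blk l Fin.≟ a) (y l) (c j) (u j l)))
             (trans (sym (*-distribˡ-sum (c j) (λ l → (y l * u j l) when (blk l Fin.≟ a)))) (*0≈0 (h j)))) ⟩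
      0# ∎
      where
      open ≈-Reasoning
      pull : ∀ {P : Set} (d : Dec P) y c u → (y * (c * u)) when d ≈ c * ((y * u) when d)
      pull (yes _) y c u = solve 3 (λ y c u → y :* (c :* u) := c :* (y :* u)) refl y c u
      pull (no _)  y c u = sym (zeroʳ c)

    Space-closed : ∀ y → Closed (Space y)
    Space-closed y c u u∈ v e a = condition-closed (isLine a) a y c u (λ j → u∈ j a) v e

    condition-cong : ∀ b a {y y′} → y ≋ y′ → ∀ {v} → Condition b a y v → Condition b a y′ v
    condition-cong true  a e h l l′ p p′ = trans (*-congʳ (sym (e l))) (trans (h l l′ p p′) (*-congʳ (e l′)))
    condition-cong false a e h = trans (sum-cong-≋ (λ l → when-cong (blk l Fin.≟ a) (*-congʳ (sym (e l))))) h

    Space-cong : ∀ {y y′} → y ≋ y′ → ∀ {v} → Space y v → Space y′ v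
    Space-cong e h a = condition-cong (isLine a) a e (h a)

    module Section (σ : Fin r → Fin n) (blk-σ : ∀ a → blk (σ a) ≡ a) where

      chosen-by : Bool → Bool → Bool
      chosen-by true  b = b
      chosen-by false b = not b

      -- If `y` is nonzero at `σ a`, a vector is determined on a line by its coordinate at `σ a`,
      -- and on a hyperplane by all the others.
      chosen : Subset n
      chosen = tabulate (λ l → chosen-by (isLine (blk l)) (does (l Fin.≟ σ (blk l))))

      lookup-chosen : ∀ l → lookup chosen l ≡ chosen-by (isLine (blk l)) (does (l Fin.≟ σ (blk l)))
      lookup-chosen = Vec.lookup∘tabulate _

      chosen-line : ∀ {l} → isLine (blk l) ≡ true → lookup chosen l ≡ does (l Fin.≟ σ (blk l))
      chosen-line {l} p = ≡.trans (lookup-chosen l) (≡.cong (λ b → chosen-by b (does (l Fin.≟ σ (blk l)))) p)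

      chosen-hyperplane : ∀ {l} → isLine (blk l) ≡ false → lookup chosen l ≡ not (does (l Fin.≟ σ (blk l)))
      chosen-hyperplane {l} p = ≡.trans (lookup-chosen l) (≡.cong (λ b → chosen-by b (does (l Fin.≟ σ (blk l)))) p)

      line⇒σ : ∀ {l} → isLine (blk l) ≡ true → lookup chosen l ≡ true → l ≡ σ (blk l)
      line⇒σ {l} p q = from-does (l Fin.≟ σ (blk l)) (≡.trans (≡.sym (chosen-line p)) q)

      σ∈ : ∀ {a} → isLine a ≡ true → lookup chosen (σ a) ≡ true
      σ∈ {a} p = ≡.trans (chosen-line (≡.trans (≡.cong isLine (blk-σ a)) p))
        (does-true (σ a Fin.≟ σ (blk (σ a))) (≡.cong σ (≡.sym (blk-σ a))))

      σ∉ : ∀ {l} → isLine (blk l) ≡ false → lookup chosen l ≡ true → l ≢ σ (blk l)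
      σ∉ {l} p q e = true≢false q (≡.trans (chosen-hyperplane p) (≡.cong not (does-true (l Fin.≟ σ (blk l)) e)))

      hyperplane∈ : ∀ {l} → isLine (blk l) ≡ false → l ≢ σ (blk l) → lookup chosen l ≡ true
      hyperplane∈ {l} p q = ≡.trans (chosen-hyperplane p) (≡.cong not (does-false (l Fin.≟ σ (blk l)) q))

      module _ (y : Fin n → 𝕂) (yσ≉0 : ∀ a → y (σ a) ≉ 0#) where

        condition-determined : ∀ b a v → isLine a ≡ b → Condition b a y v → (∀ l → lookup chosen l ≡ true → v l ≈ 0#) →
          ∀ l → blk l ≡ a → v l ≈ 0#
        condition-determined true a v p h v0 l q = *-cancel-0 (yσ≉0 a) (trans (h (σ a) l (blk-σ a) q)
          (*0≈0 (v0 (σ a) (σ∈ p))))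
        condition-determined false a v p h v0 l ≡.refl with l Fin.≟ σ a
        ... | no l≢σ = v0 l (hyperplane∈ p l≢σ)
        ... | yes l≡ = *-cancel-0 (≉0-cong (reflexive (≡.cong y (≡.sym l≡))) (yσ≉0 (blk l))) (trans (sym (trans
                (sum-single _ l off) (when-yes (blk l Fin.≟ a) ≡.refl))) h)
          where
          off : ∀ j → j ≢ l → (y j * v j) when (blk j Fin.≟ a) ≈ 0#
          off j j≢l with blk j Fin.≟ a
          ... | no _  = refl
          ... | yes e = *0≈0 (v0 j (hyperplane∈ (≡.trans (≡.cong isLine e) p) (λ j≡ → j≢l (≡.trans j≡ (≡.trans (≡.cong σ e) (≡.sym l≡))))))

        Space-determined : ∀ v → Space y v → (∀ l → lookup chosen l ≡ true → v l ≈ 0#) → v ≋ (λ _ → 0#)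
        Space-determined v h v0 l = condition-determined (isLine (blk l)) (blk l) v ≡.refl (h (blk l)) v0 l ≡.refl

      -- On a line, `y` itself; on a hyperplane, the solution of the equation supported on `b` and
      -- `σ (blk b)`. There is no division, so the entries are polynomial in `y`.
      generator-by : Bool → (y : Fin n → 𝕂) → Fin n → Fin n → 𝕂
      generator-by true  y b l = y l when (blk l Fin.≟ blk b)
      generator-by false y b l = δ l b * y (σ (blk b)) - δ l (σ (blk b)) * y b

      generator : (y : Fin n → 𝕂) → Fin n → Fin n → 𝕂
      generator y b = generator-by (isLine (blk b)) y b

      generator-off : ∀ k y b l → blk l ≢ blk b → generator-by k y b l ≈ 0#
      generator-off true  y b l p = when-no (blk l Fin.≟ blk b) p
      generator-off false y b l p = trans (+-cong (0*≈0 (δ-≢ (p ∘ ≡.cong blk)))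
        (-0≈0 (0*≈0 (δ-≢ (λ e → p (≡.trans (≡.cong blk e) (blk-σ _))))))) (+-identityˡ _)

      generator-condition : ∀ y b k k′ a → isLine (blk b) ≡ k → isLine a ≡ k′ → Condition k′ a y (generator-by k y b)
      generator-condition y b true true a p q l l′ e e′ with blk l Fin.≟ blk b | blk l′ Fin.≟ blk b
      ... | yes _ | yes _ = *-comm _ _
      ... | no  _ | no  _ = trans (zeroʳ _) (sym (zeroʳ _))
      ... | yes s | no ¬s = contradiction (≡.trans e′ (≡.trans (≡.sym e) s)) ¬s
      ... | no ¬s | yes s = contradiction (≡.trans e (≡.trans (≡.sym e′) s)) ¬s
      generator-condition y b false true a p q l l′ e e′ = trans (vanish y l l′ e′) (sym (vanish y l′ l e))
        where
        vanish : ∀ y l l′ → blk l′ ≡ a → y l * generator-by false y b l′ ≈ 0#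
        vanish y l l′ e = *0≈0 (generator-off false y b l′ (λ s →
          true≢false q (≡.trans (≡.cong isLine (≡.trans (≡.sym e) s)) p)))
      generator-condition y b k false a p q with a Fin.≟ blk b
      ... | no a≢ = sum-zero {f = λ l → (y l * generator-by k y b l) when (blk l Fin.≟ a)} vanish
        where
        vanish : ∀ l → (y l * generator-by k y b l) when (blk l Fin.≟ a) ≈ 0#
        vanish l with blk l Fin.≟ a
        ... | no _  = refl
        ... | yes e = *0≈0 (generator-off k y b l (λ s → a≢ (≡.trans (≡.sym e) s)))
      generator-condition y b true  false .(blk b) p q | yes ≡.refl = contradiction q (true≢false p)
      generator-condition y b false false .(blk b) p q | yes ≡.refl = begin
        sum (λ l → (y l * generator-by false y b l) when (blk l Fin.≟ blk b))
          ≈⟨ sum-cong-≋ expand ⟩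
        sum (λ l → (y l * yh) * δ l b + - ((y l * y b) * δ l h))
          ≈⟨ ∑-distrib-+ (λ l → (y l * yh) * δ l b) (λ l → - ((y l * y b) * δ l h)) ⟩
        sum (λ l → (y l * yh) * δ l b) + sum (λ l → - ((y l * y b) * δ l h))
          ≈⟨ +-cong (sum-δ (λ l → y l * yh) b) (trans (sum-neg (λ l → (y l * y b) * δ l h)) (-‿cong (sum-δ (λ l → y l * y b) h))) ⟩
        y b * yh - yh * y b
          ≈⟨ trans (+-congˡ (-‿cong (*-comm _ _))) (-‿inverseʳ _) ⟩
        0# ∎
        where
        open ≈-Reasoning
        h = σ (blk b)
        yh = y h
        identity : ∀ l → y l * (δ l b * yh - δ l h * y b) ≈ (y l * yh) * δ l b + - ((y l * y b) * δ l h)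
        identity l = solve 5 (λ p d q e s → p :* (d :* q :- e :* s) := (p :* q) :* d :+ (:- ((p :* s) :* e))) refl
          (y l) (δ l b) yh (δ l h) (y b)
        expand : ∀ l → (y l * generator-by false y b l) when (blk l Fin.≟ blk b) ≈ (y l * yh) * δ l b + - ((y l * y b) * δ l h)
        expand l with blk l Fin.≟ blk b
        ... | yes _ = identity l
        ... | no ¬e = trans (sym (*0≈0 (generator-off false y b l ¬e))) (identity l)

      generator∈ : ∀ y b → Space y (generator y b)
      generator∈ y b a = generator-condition y b _ _ a ≡.refl ≡.refl

      generator-chosen : ∀ y b b′ → lookup chosen b ≡ true → lookup chosen b′ ≡ true →
        generator y b b′ ≈ δ b b′ * y (σ (blk b))
      generator-chosen y b b′ p p′ = by (isLine (blk b)) ≡.refl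
        where
        by : ∀ k → isLine (blk b) ≡ k → generator-by k y b b′ ≈ δ b b′ * y (σ (blk b))
        by true q with blk b′ Fin.≟ blk b
        ... | no ¬e = sym (0*≈0 (δ-≢ (λ b≡b′ → ¬e (≡.cong blk (≡.sym b≡b′)))))
        ... | yes e = trans (reflexive (≡.cong y b′≡)) (sym (1*≈ (δ-≡ (≡.trans (line⇒σ q p) (≡.sym b′≡)))))
          where
          b′≡ : b′ ≡ σ (blk b)
          b′≡ = ≡.trans (line⇒σ (≡.trans (≡.cong isLine e) q) p′) (≡.cong σ e)
        by false q = trans (+-cong (*-congʳ (δ-sym b′ b)) (-0≈0 (0*≈0 (δ-≢ b′≢)))) (+-identityʳ _)
          where
          δ-sym : ∀ {n} (i j : Fin n) → δ i j ≈ δ j i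
          δ-sym i j with i Fin.≟ j
          ... | yes ≡.refl = sym (δ-same i)
          ... | no  i≢j    = sym (δ-≢ (i≢j ∘ ≡.sym))
          b′≢ : b′ ≢ σ (blk b)
          b′≢ e = σ∉ (≡.trans (≡.cong isLine same) q) p′ (≡.trans e (≡.cong σ (≡.sym same)))
            where
            same : blk b′ ≡ blk b
            same = ≡.trans (≡.cong blk e) (blk-σ _)

      module _ (y : Fin n → 𝕂) (yσ≉0 : ∀ a → y (σ a) ≉ 0#) where
        private
          scale : Fin n → 𝕂
          scale b = y (σ (blk b)) ⁻¹[ yσ≉0 (blk b) ]

          unit-row : Fin n → Fin n → 𝕂
          unit-row b l = scale b * generator y b l + 0# * 0#

          unit-row∈ : ∀ b → lookup chosen b ≡ true → Space y (unit-row b)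
          unit-row∈ b _ = closed-+ (Space-closed y) _ _ (generator∈ y b) (closed-zero (Space-closed y))

          unit-row-δ : ∀ b b′ → lookup chosen b ≡ true → lookup chosen b′ ≡ true → unit-row b b′ ≈ δ b b′
          unit-row-δ b b′ p p′ = trans (+-congˡ (zeroˡ 0#)) (trans (+-identityʳ _) (trans (*-congˡ (generator-chosen y b b′ p p′))
            (trans (solve 3 (λ i d y → i :* (d :* y) := (y :* i) :* d) refl (scale b) (δ b b′) (y (σ (blk b))))
              (1*≈ (*-inv (yσ≉0 (blk b)))))))

        Space-reduced : Reduced (Space y) chosen
        Space-reduced = mkReduced (Space-closed y) chosen unit-row unit-row∈ unit-row-δ (Space-determined y yσ≉0)

        -- The reduced rows are the generators divided by `y` at the section; undoing these
        -- divisions multiplies all Plücker coordinates by one nonzero factor.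
        Space-plücker : ∀ {k} (H : HasDimension (Space y) k) (e : ∣ chosen ∣ ≡ k) →
          plü (HasDimension.basis H) ∝ plü (λ i l → generator y (elements chosen (≡.subst Fin (≡.sym e) i)) l)
        Space-plücker H ≡.refl = ∝-sym (y-prod * c , *-≉0 (prod-≉0 (λ i → yσ≉0 (blk (elements chosen i)))) (proj₁ (proj₂ change)) , λ I → begin
            plü G I                                      ≈⟨ *-identityˡ _ ⟨
            1# * plü G I                                 ≈⟨ *-congʳ inverse-scale ⟨
            (s-prod * y-prod) * plü G I                  ≈⟨ solve 3 (λ s t p → (s :* t) :* p := t :* (s :* p)) refl s-prod y-prod (plü G I) ⟩
            y-prod * (s-prod * plü G I)                  ≈⟨ *-congˡ (rows I) ⟨
            y-prod * plü (HasDimension.basis R) I        ≈⟨ *-congˡ (c-≈ I) ⟩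
            y-prod * (c * plü (HasDimension.basis H) I)  ≈⟨ *-assoc _ _ _ ⟨
            y-prod * c * plü (HasDimension.basis H) I    ∎)
          where
          open ≈-Reasoning
          R = reduced⇒dimension (Space-closed y) Space-reduced
          change = plü-change-of-basis H R
          c = proj₁ change
          c-≈ = proj₂ (proj₂ change)
          G : Fin ∣ chosen ∣ → Fin n → 𝕂
          G i = generator y (elements chosen i)
          y-prod = prod (λ i → y (σ (blk (elements chosen i))))
          s-prod = prod (scale ∘ elements chosen)
          inverse-scale : s-prod * y-prod ≈ 1#
          inverse-scale = trans (sym (Π.∑-distrib-+ (scale ∘ elements chosen) (λ i → y (σ (blk (elements chosen i))))))
            (prod-one (λ i → trans (*-comm _ _) (*-inv (yσ≉0 (blk (elements chosen i))))))
          rows : ∀ I → plü (HasDimension.basis R) I ≈ prod (scale ∘ elements chosen) * plü G I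
          rows I = trans (plü-cong (λ i l → trans (reflexive (≡.cong (λ f → f l)
              (mkReduced-row (Space-closed y) chosen unit-row unit-row∈ unit-row-δ (Space-determined y yσ≉0) (elements chosen i) (elements∈ chosen i))))
              (+0≈ (zeroˡ 0#))) I)
            (plü-rows G (scale ∘ elements chosen) I)

-- The decomposition of X along its stars.

module StarDecomposition {K : CommutativeRing 0ℓ 0ℓ} (F : ClassicalField K) where
  open BlockSpaces F public

  record Star {k n : ℕ} (X : Gr k (Fin n)) : Set where
    field
      {r}    : ℕ
      blk    : Fin n → Fin r
      isLine : Fin r → Bool
      σ₀     : Fin r → Fin n
      blk-σ₀ : ∀ a → blk (σ₀ a) ≡ a
      x      : Fin n → 𝕂
      x≉0    : ∀ l → x l ≉ 0#
    open Blocks blk isLine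
    field
      X⊆Space : ∀ {v} → v ∈ subspace X → Space x v
      Space⊆X : ∀ {v} → Space x v → v ∈ subspace X

  module _ {n r : ℕ} (blk : Fin n → Fin r) (isLine : Fin r → Bool) (σ : Fin r → Fin n) (blk-σ : ∀ a → blk (σ a) ≡ a) where
    open Blocks blk isLine
    open Section σ blk-σ

    -- Used twice, for X itself and for each point of its orbit closure: a matrix without nonzero
    -- entries between different blocks describes a line or a hyperplane in every block.
    module BlockDiagonal {W : Pred (Fin n → 𝕂) 0ℓ} (W-closed : Closed W) (R : Reduced W chosen)
      (diagonal : ∀ b l → lookup chosen b ≡ true → lookup chosen l ≡ false → Reduced.row R b l ≉ 0# → blk b ≡ blk l) where
      open Reduced R

      private
        h : Fin n → Fin n
        h l = σ (blk l)

        h-h : ∀ l → h (h l) ≡ h l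
        h-h l = ≡.cong σ (blk-σ (blk l))

        line-h : ∀ {l b} → isLine (blk l) ≡ b → isLine (blk (h l)) ≡ b
        line-h {l} = ≡.trans (≡.cong isLine (blk-σ (blk l)))

        h∉ : ∀ {l} → isLine (blk l) ≡ false → lookup chosen (h l) ≡ false
        h∉ {l} p = not-true (λ q → σ∉ (line-h {l} p) q (≡.sym (h-h l)))

        -- On a line the coefficients are the row of `h l`. The equation of a hyperplane is the
        -- expansion at the omitted index, `v (h l) = Σ v b * row b (h l)`, brought to one side:
        -- hence `- 1#` at that index.
        coefficient-by : Bool → ∀ l → Dec (l ≡ h l) → 𝕂
        coefficient-by true  l _       = row (h l) l
        coefficient-by false l (yes _) = - 1#
        coefficient-by false l (no _)  = row l (h l)

        row≉0⇒∈ : ∀ b l → row b l ≉ 0# → lookup chosen b ≡ true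
        row≉0⇒∈ b l ≉0 = not-false (λ b∉ → ≉0 (row-out b b∉ l))

      coefficient : Fin n → 𝕂
      coefficient l = coefficient-by (isLine (blk l)) l (l Fin.≟ h l)

      coefficient-line : ∀ {l} → isLine (blk l) ≡ true → coefficient l ≡ row (h l) l
      coefficient-line {l} p = ≡.cong (λ b → coefficient-by b l (l Fin.≟ h l)) p

      coefficient-hyperplane : ∀ {l} → isLine (blk l) ≡ false → l ≢ h l → coefficient l ≡ row l (h l)
      coefficient-hyperplane {l} p l≢ = ≡.trans (≡.cong (λ b → coefficient-by b l (l Fin.≟ h l)) p) (by (l Fin.≟ h l))
        where
        by : ∀ d → coefficient-by false l d ≡ row l (h l)
        by (yes e) = contradiction e l≢
        by (no _)  = ≡.refl

      coefficient-center : ∀ {l} → l ≡ h l → coefficient l ≉ 0#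
      coefficient-center {l} l≡ = by (isLine (blk l)) (l Fin.≟ h l) ≡.refl
        where
        by : ∀ b d → isLine (blk l) ≡ b → coefficient-by b l d ≉ 0#
        by true  _       p = ≉0-cong (sym (trans (reflexive (≡.cong (row (h l)) l≡)) (row-diag (h l) (σ∈ p)))) 1≉0
        by false (yes _) p = -‿≉0 1≉0
        by false (no l≢) p = contradiction l≡ l≢

      coefficient-σ≉0 : ∀ a → coefficient (σ a) ≉ 0#
      coefficient-σ≉0 a = coefficient-center (≡.cong σ (≡.sym (blk-σ a)))

      private
        line-block : ∀ v → v ∈ W → ∀ l → isLine (blk l) ≡ true → v l ≈ v (h l) * row (h l) l
        line-block v v∈ l p = trans (expansion W-closed R v v∈ l) (sum-single (λ b → v b * row b l) (h l)
          (λ b b≢ → *0≈0 (by-contradiction (λ ≉0 → off b b≢ ≉0 (lookup chosen l) ≡.refl))))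
          where
          off : ∀ b → b ≢ h l → row b l ≉ 0# → ∀ y → lookup chosen l ≡ y → ⊥
          off b b≢ ≉0 true  q = ≉0 (row-off b l q (λ b≡l → b≢ (≡.trans b≡l (line⇒σ p q))))
          off b b≢ ≉0 false q = b≢ (≡.trans (line⇒σ (≡.trans (≡.cong isLine same) p) b∈) (≡.cong σ same))
            where
            b∈ = row≉0⇒∈ b l ≉0
            same = diagonal b l b∈ q ≉0

        line-condition : ∀ v → v ∈ W → ∀ a → isLine a ≡ true → OnLine a coefficient v
        line-condition v v∈ a p l l′ e e′ = begin
          coefficient l * v l′                   ≈⟨ *-cong (coef l e) (val l′ e′) ⟩
          row c l * (v c * row c l′)             ≈⟨ solve 3 (λ x y z → x :* (y :* z) := z :* (y :* x)) refl (row c l) (v c) (row c l′) ⟩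
          row c l′ * (v c * row c l)             ≈⟨ *-cong (coef l′ e′) (val l e) ⟨
          coefficient l′ * v l                   ∎
          where
          open ≈-Reasoning
          c = σ a
          p′ : ∀ l → blk l ≡ a → isLine (blk l) ≡ true
          p′ l e = ≡.trans (≡.cong isLine e) p
          coef : ∀ l → blk l ≡ a → coefficient l ≈ row c l
          coef l e = reflexive (≡.trans (coefficient-line (p′ l e)) (≡.cong (λ a → row (σ a) l) e))
          val : ∀ l → blk l ≡ a → v l ≈ v c * row c l
          val l e = trans (line-block v v∈ l (p′ l e)) (reflexive (≡.cong (λ a → v (σ a) * row (σ a) l) e))

        hyperplane-condition : ∀ v → v ∈ W → ∀ a → isLine a ≡ false → OnHyperplane a coefficient v
        hyperplane-condition v v∈ a p = begin
          sum (λ l → (coefficient l * v l) when (blk l Fin.≟ a))    ≈⟨ sum-cong-≋ term ⟩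
          sum (λ l → v l * row l c + - (v l * δ l c))               ≈⟨ ∑-distrib-+ (λ l → v l * row l c) (λ l → - (v l * δ l c)) ⟩
          sum (λ l → v l * row l c) + sum (λ l → - (v l * δ l c))
            ≈⟨ +-cong (sym (expansion W-closed R v v∈ c)) (trans (sum-neg (λ l → v l * δ l c)) (-‿cong (sum-δ v c))) ⟩
          v c - v c                                                 ≈⟨ -‿inverseʳ _ ⟩
          0#                                                        ∎
          where
          open ≈-Reasoning
          c = σ a
          c∉ : lookup chosen c ≡ false
          c∉ = ≡.trans (≡.cong (λ a → lookup chosen (σ a)) (≡.sym (blk-σ a))) (h∉ (≡.trans (≡.cong isLine (blk-σ a)) p))
          term-in : ∀ l → blk l ≡ a → coefficient l * v l ≈ v l * row l c + - (v l * δ l c)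
          term-in l ≡.refl = trans (*-congʳ (reflexive (≡.cong (λ b → coefficient-by b l (l Fin.≟ h l)) p))) (by (l Fin.≟ h l))
            where
            by : ∀ d → coefficient-by false l d * v l ≈ v l * row l c + - (v l * δ l c)
            by (yes l≡) = sym (trans (+-cong (*0≈0 (row-out l (≡.trans (≡.cong (lookup chosen) l≡) c∉) c))
                (-‿cong (trans (*-congˡ (δ-≡ l≡)) (trans (*-identityʳ _) (sym (*-identityˡ _))))))
              (trans (+-identityˡ _) (-‿distribˡ-* 1# (v l))))
            by (no l≢) = sym (trans (+-congˡ (-0≈0 (*0≈0 (δ-≢ l≢))))
              (trans (+-identityʳ _) (*-comm _ _)))
          term-out : ∀ l → blk l ≢ a → 0# ≈ v l * row l c + - (v l * δ l c)
          term-out l ¬e = sym (trans (+-cong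
            (*0≈0 (by-contradiction (λ ≉0 → ¬e (≡.trans (diagonal l c (row≉0⇒∈ l c ≉0) c∉ ≉0) (blk-σ a)))))
            (-0≈0 (*0≈0 (δ-≢ (λ l≡c → ¬e (≡.trans (≡.cong blk l≡c) (blk-σ a)))))))
            (+-identityʳ _))
          term : ∀ l → (coefficient l * v l) when (blk l Fin.≟ a) ≈ v l * row l c + - (v l * δ l c)
          term l with blk l Fin.≟ a
          ... | yes e = term-in l e
          ... | no ¬e = term-out l ¬e

      W⊆Space : ∀ {v} → v ∈ W → Space coefficient v
      W⊆Space {v} v∈ a = by (isLine a) ≡.refl
        where
        by : ∀ b → isLine a ≡ b → Condition b a coefficient v
        by true  = line-condition v v∈ a
        by false = hyperplane-condition v v∈ a

      Space⊆W : ∀ {v} → Space coefficient v → v ∈ W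
      Space⊆W {v} v∈ = closed-≋ W-closed (λ l → sym (x-y≈0⇒x≈y (Space-determined coefficient coefficient-σ≉0
          (λ l → v l - w l) (closed-difference (Space-closed coefficient) v∈ (W⊆Space w∈))
          (λ l l∈ → trans (+-congˡ (-‿cong (expansion-at W-closed R v l l∈))) (-‿inverseʳ _)) l))) w∈
        where
        w = combination v row
        w∈ : w ∈ W
        w∈ = W-closed v row row∈ _ (λ _ → refl)

  module _ {k n : ℕ} (X : Gr k (Fin n)) {D : ℕ}
    (smooth : ∀ p → p ∈ Plücker (OrbitClosure X) → HasDimension (ConeTangentSpace (Plücker (OrbitClosure X)) p) D)
    {B : Subset n} (R : Reduced (subspace X) B) where
    open Reduced R
    open Stars {B = B} (Edge X R) (λ e → proj₁ e , proj₁ (proj₂ e)) (no-path X smooth R)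
    private
      C : Subset n
      C = tabulate (λ l → does (center l Fin.≟ l))

      ctr : Fin ∣ C ∣ → Fin n
      ctr = elements C

      center∈C : ∀ l → lookup C (center l) ≡ true
      center∈C l = ≡.trans (Vec.lookup∘tabulate _ (center l)) (does-true (center (center l) Fin.≟ center l) (center-idempotent l))

      center-ctr : ∀ a → center (ctr a) ≡ ctr a
      center-ctr a = from-does (center (ctr a) Fin.≟ ctr a) (≡.trans (≡.sym (Vec.lookup∘tabulate _ (ctr a))) (elements∈ C a))

      block : Fin n → Fin ∣ C ∣
      block l = proj₁ (elements-surjective C (center l) (center∈C l))

      ctr-block : ∀ l → ctr (block l) ≡ center l
      ctr-block l = proj₂ (elements-surjective C (center l) (center∈C l))

      block-ctr : ∀ a → block (ctr a) ≡ a
      block-ctr a = elements-injective C (≡.trans (ctr-block (ctr a)) (center-ctr a))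

      line : Fin ∣ C ∣ → Bool
      line a = lookup B (ctr a)

      line≡ : ∀ l → line (block l) ≡ lookup B (center l)
      line≡ l = ≡.cong (lookup B) (ctr-block l)

      edge-block : ∀ {i j} → Edge X R i j → block i ≡ block j
      edge-block {i} {j} e = elements-injective C (≡.trans (ctr-block i) (≡.trans (center-edge e) (≡.sym (ctr-block j))))

      open Blocks block line
      open Section ctr block-ctr

      -- An edge joins `B` to its complement, so every vertex of a star other than the center lies
      -- on the side opposite to the center.
      chosen≡B : chosen ≡ B
      chosen≡B = subset-ext (λ l → by l (l Fin.≟ center l) (lookup B l) ≡.refl)
        where
        at-center : ∀ l → l ≡ center l → lookup chosen l ≡ lookup B l
        at-center l l≡ = ≡.trans (lookup-chosen l) (≡.trans (≡.cong₂ chosen-by (≡.trans (line≡ l) (≡.cong (lookup B) (≡.sym l≡)))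
          (does-true (l Fin.≟ ctr (block l)) (≡.trans l≡ (≡.sym (ctr-block l))))) (by-true (lookup B l)))
          where
          by-true : ∀ b → chosen-by b true ≡ b
          by-true true  = ≡.refl
          by-true false = ≡.refl
        off-center : ∀ l → l ≢ center l → ∀ b → lookup B (center l) ≡ not b → lookup chosen l ≡ b
        off-center l l≢ b p = ≡.trans (lookup-chosen l) (≡.trans (≡.cong₂ chosen-by (≡.trans (line≡ l) p)
          (does-false (l Fin.≟ ctr (block l)) (λ e → l≢ (≡.trans e (ctr-block l))))) (by-false b))
          where
          by-false : ∀ b → chosen-by (not b) false ≡ b
          by-false true  = ≡.refl
          by-false false = ≡.refl
        by : ∀ l → Dec (l ≡ center l) → ∀ b → lookup B l ≡ b → lookup chosen l ≡ lookup B l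
        by l (yes l≡) _     _ = at-center l l≡
        by l (no l≢)  true  p = ≡.trans (off-center l l≢ true (proj₁ (proj₂ (center-∈ p l≢)))) (≡.sym p)
        by l (no l≢)  false p = ≡.trans (off-center l l≢ false (proj₁ (center-∉ p l≢))) (≡.sym p)

      -- Generalised over `S`, because `chosen` is computed from `B` and an equality `chosen ≡ B`
      -- cannot be matched with `refl` directly.
      star-by : ∀ S → chosen ≡ S → (Q : Reduced (subspace X) S) →
        (∀ b l → lookup S b ≡ true → lookup S l ≡ false → Reduced.row Q b l ≉ 0# → block b ≡ block l) →
        (∀ b → lookup S b ≡ true → b ≢ ctr (block b) → Reduced.row Q b (ctr (block b)) ≉ 0#) →
        (∀ l → lookup S l ≡ false → l ≢ ctr (block l) → Reduced.row Q (ctr (block l)) l ≉ 0#) → Star X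
      star-by _ ≡.refl Q edge edge⁻ edge⁻′ = record
          { blk = block ; isLine = line ; σ₀ = ctr ; blk-σ₀ = block-ctr
          ; x = coefficient ; x≉0 = coefficient≉0 ; X⊆Space = W⊆Space ; Space⊆X = Space⊆W }
          where
          open BlockDiagonal block line ctr block-ctr (X-closed X) Q edge
          coefficient≉0 : ∀ l → coefficient l ≉ 0#
          coefficient≉0 l = by (l Fin.≟ ctr (block l)) (line (block l)) ≡.refl
            where
            by : Dec (l ≡ ctr (block l)) → ∀ b → line (block l) ≡ b → coefficient l ≉ 0#
            by (yes l≡) _     _ = coefficient-center l≡
            by (no l≢)  true  p = ≉0-cong (reflexive (≡.sym (coefficient-line p)))
              (edge⁻′ l (≡.trans (chosen-line p) (does-false (l Fin.≟ ctr (block l)) l≢)) l≢)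
            by (no l≢)  false p = ≉0-cong (reflexive (≡.sym (coefficient-hyperplane p l≢)))
              (edge⁻ l (hyperplane∈ p l≢) l≢)

    star : Star X
    star = star-by B chosen≡B R (λ b l b∈ l∉ ≉0 → edge-block (b∈ , l∉ , ≉0))
      (λ b b∈ b≢ → at (≡.sym (ctr-block b)) (proj₂ (proj₂ (center-∈ b∈ (λ e → b≢ (≡.trans e (≡.sym (ctr-block b))))))))
      (λ l l∉ l≢ → at′ (≡.sym (ctr-block l)) (proj₂ (proj₂ (center-∉ l∉ (λ e → l≢ (≡.trans e (≡.sym (ctr-block l))))))))
      where
      at : ∀ {b c c′} → c ≡ c′ → row b c ≉ 0# → row b c′ ≉ 0#
      at ≡.refl p = p
      at′ : ∀ {l c c′} → c ≡ c′ → row c l ≉ 0# → row c′ l ≉ 0#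
      at′ ≡.refl p = p

-- Plücker coordinates of block spaces as monomials.

module StarOrbits {K : CommutativeRing 0ℓ 0ℓ} (F : ClassicalField K) where
  open StarDecomposition F public

  private variable
    n : ℕ

  dimension-≐ : ∀ {ℓ} {ι : Set} {k} {W W′ : Pred (ι → 𝕂) ℓ} → W ≐ W′ → HasDimension W k → HasDimension W′ k
  dimension-≐ (W⊆W′ , W′⊆W) H = record { basis = HasDimension.basis H ; independent = independent ; spans = λ v → mk⇔
    (λ v∈ → Equivalence.to (spans v) (W′⊆W v∈)) (λ e → W⊆W′ (Equivalence.from (spans v) e)) }
    where open HasDimension H using (independent; spans)

  -- On the line `z + s` only the finitely many values `s = - z l` leave the torus, so density in
  -- one variable suffices.
  torus-dense : (G : (Fin n → 𝕂) → 𝕂) → (∀ {z z′} → z ≋ z′ → G z ≈ G z′) →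
    (∀ z → Polynomial (λ s → G (λ l → z l + s))) → (∀ z → (∀ l → z l ≉ 0#) → G z ≈ 0#) → ∀ z → G z ≈ 0#
  torus-dense G G-cong G-poly h z = trans (G-cong (λ l → sym (+-identityʳ (z l))))
    (density (G-poly z) roots (λ s s∉ → h _ (λ l e → s∉ (Any.tabulate⁺ {f = λ l → - z l} l
      (trans (solve 2 (λ z s → s := (z :+ s) :+ (:- z)) refl (z l) s) (0+≈ e))))) 0#)
    where
    roots = List.tabulate (λ l → - z l)

  weight-cong : {t t′ : Fin n → 𝕂} → t ≋ t′ → ∀ S → weight t S ≈ weight t′ S
  weight-cong e S = prod-cong (λ l → if-cong (lookup S l) (e l) refl)

  weight-complement : ∀ (t : Fin n → 𝕂) S → weight t S * weight t (Subset.∁ S) ≈ prod t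
  weight-complement t S = trans (sym (Π.∑-distrib-+ (λ l → if lookup S l then t l else 1#) (λ l → if lookup (Subset.∁ S) l then t l else 1#)))
    (prod-cong (λ l → trans (*-congˡ (reflexive (≡.cong (λ b → if b then t l else 1#) (Vec.lookup-map l not S)))) (by (lookup S l) (t l))))
    where
    by : ∀ b x → (if b then x else 1#) * (if not b then x else 1#) ≈ x
    by true  x = *-identityʳ x
    by false x = *-identityˡ x

  weight-* : ∀ (t t′ : Fin n → 𝕂) S → weight t S * weight t′ S ≈ weight (λ l → t l * t′ l) S
  weight-* t t′ S = trans (sym (Π.∑-distrib-+ (λ l → if lookup S l then t l else 1#) (λ l → if lookup S l then t′ l else 1#)))
    (prod-cong (λ l → by (lookup S l) (t l) (t′ l)))
    where
    by : ∀ b x y → (if b then x else 1#) * (if b then y else 1#) ≈ (if b then x * y else 1#)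
    by true  x y = refl
    by false x y = *-identityˡ 1#

  module _ {n r : ℕ} (blk : Fin n → Fin r) (isLine : Fin r → Bool) where
    open Blocks blk isLine

    -- The torus element belonging to `z` is `onLines z` divided by `onHyperplanes z`, since
    -- equations transform inversely to vectors.
    onLines onHyperplanes : (Fin n → 𝕂) → Fin n → 𝕂
    onLines z l = if isLine (blk l) then z l else 1#
    onHyperplanes z l = if isLine (blk l) then 1# else z l

    ψ-factor : Bool → Bool → 𝕂 → 𝕂
    ψ-factor true  true  x = x
    ψ-factor true  false x = 1#
    ψ-factor false true  x = 1#
    ψ-factor false false x = x

    -- z(S ∩ lines) z(hyperplanes ∖ S)
    ψ : (Fin n → 𝕂) → Subset n → 𝕂
    ψ z S = prod (λ l → ψ-factor (lookup S l) (isLine (blk l)) (z l))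

    ψ-factor-cong : ∀ a b {x y} → x ≈ y → ψ-factor a b x ≈ ψ-factor a b y
    ψ-factor-cong true  true  e = e
    ψ-factor-cong true  false e = refl
    ψ-factor-cong false true  e = refl
    ψ-factor-cong false false e = e

    ψ-factor-poly : ∀ a b {g} → Polynomial g → Polynomial (λ s → ψ-factor a b (g s))
    ψ-factor-poly true  true  P = P
    ψ-factor-poly true  false P = poly-const 1#
    ψ-factor-poly false true  P = poly-const 1#
    ψ-factor-poly false false P = P

    poly-shift : (z : Fin n → 𝕂) → ∀ l → Polynomial (λ s → z l + s)
    poly-shift z l = poly-+ (poly-const (z l)) poly-var

    ψ-cong : ∀ {z z′} → z ≋ z′ → ∀ S → ψ z S ≈ ψ z′ S
    ψ-cong e S = prod-cong (λ l → ψ-factor-cong (lookup S l) (isLine (blk l)) (e l))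

    ψ-poly : ∀ z S → Polynomial (λ s → ψ (λ l → z l + s) S)
    ψ-poly z S = poly-prod (λ l → ψ-factor-poly (lookup S l) (isLine (blk l)) (poly-shift z l))

    ψ-split : ∀ z S → ψ z S ≈ weight (onLines z) S * weight (onHyperplanes z) (Subset.∁ S)
    ψ-split z S = sym (trans (sym (Π.∑-distrib-+ (λ l → if lookup S l then onLines z l else 1#)
        (λ l → if lookup (Subset.∁ S) l then onHyperplanes z l else 1#)))
      (prod-cong (λ l → trans (*-congˡ (reflexive (≡.cong (λ b → if b then onHyperplanes z l else 1#) (Vec.lookup-map l not S))))
        (by (lookup S l) (isLine (blk l)) (z l)))))
      where
      by : ∀ a b x → (if a then (if b then x else 1#) else 1#) * (if not a then (if b then 1# else x) else 1#) ≈ ψ-factor a b x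
      by true  true  x = *-identityʳ x
      by true  false x = *-identityʳ 1#
      by false true  x = *-identityʳ 1#
      by false false x = *-identityˡ x

    module _ (σ : Fin r → Fin n) (blk-σ : ∀ a → blk (σ a) ≡ a) (x : Fin n → 𝕂) where
      open Section σ blk-σ

      _⊙x : (Fin n → 𝕂) → Fin n → 𝕂
      (z ⊙x) l = z l * x l

      private
        ρ-rest : (Fin n → 𝕂) → Fin n → 𝕂
        ρ-rest z b = if isLine (blk b) then 1# else z (σ (blk b))

        δ-transport : (f : Fin n → 𝕂) → ∀ l b → δ l b * f l ≈ δ l b * f b
        δ-transport f l b with l Fin.≟ b
        ... | yes ≡.refl = refl
        ... | no  _      = trans (zeroˡ _) (sym (zeroˡ _))

        -- Passing from `x` to `z ⊙x` multiplies columns in line blocks by `z` and divides those in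
        -- hyperplane blocks by `z`, up to a factor for each row. The division is moved to the left
        -- side, so that nothing is inverted.
        generator-columns : ∀ z b l →
          generator (z ⊙x) b l * onHyperplanes z l ≈ (onHyperplanes z b * ρ-rest z b) * (generator x b l * onLines z l)
        generator-columns z b l = by (blk l Fin.≟ blk b)
          where
          same : ∀ p → (if p then 1# else z b) * (if p then 1# else z (σ (blk b))) ≈ (if p then 1# else z b * z (σ (blk b)))
          same true  = *-identityˡ 1#
          same false = refl
          in-block : ∀ p → (d : Dec (blk l ≡ blk b)) → blk l ≡ blk b →
            generator-by p (z ⊙x) b l * (if p then 1# else z l) ≈
            (if p then 1# else z b * z (σ (blk b))) * (generator-by p x b l * (if p then z l else 1#))
          in-block true _ e = trans (*-identityʳ _) (trans (trans (when-yes (blk l Fin.≟ blk b) e)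
            (trans (*-comm _ _) (*-congʳ (sym (when-yes (blk l Fin.≟ blk b) e))))) (sym (*-identityˡ _)))
          in-block false _ e = begin
            (δ l b * (z h * x h) - δ l h * (z b * x b)) * z l
              ≈⟨ solve 7 (λ d e zh xh zb xb zl → (d :* (zh :* xh) :- e :* (zb :* xb)) :* zl :=
                   (d :* zl) :* (zh :* xh) :- (e :* zl) :* (zb :* xb)) refl (δ l b) (δ l h) (z h) (x h) (z b) (x b) (z l) ⟩
            (δ l b * z l) * (z h * x h) - (δ l h * z l) * (z b * x b)
              ≈⟨ +-cong (*-congʳ (δ-transport z l b)) (-‿cong (*-congʳ (δ-transport z l h))) ⟩
            (δ l b * z b) * (z h * x h) - (δ l h * z h) * (z b * x b)
              ≈⟨ solve 6 (λ d e zh xh zb xb → (d :* zb) :* (zh :* xh) :- (e :* zh) :* (zb :* xb) :=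
                   (zb :* zh) :* (d :* xh :- e :* xb)) refl (δ l b) (δ l h) (z h) (x h) (z b) (x b) ⟩
            (z b * z h) * (δ l b * x h - δ l h * x b)
              ≈⟨ *-congˡ (*-identityʳ _) ⟨
            (z b * z h) * ((δ l b * x h - δ l h * x b) * 1#) ∎
            where
            open ≈-Reasoning
            h = σ (blk b)
          by : Dec (blk l ≡ blk b) → generator (z ⊙x) b l * onHyperplanes z l ≈
            (onHyperplanes z b * ρ-rest z b) * (generator x b l * onLines z l)
          by (no ¬e) = trans (0*≈0 (generator-off (isLine (blk b)) (z ⊙x) b l ¬e))
            (sym (*0≈0 (0*≈0 (generator-off (isLine (blk b)) x b l ¬e))))
          by (yes e) = trans (*-congˡ (reflexive (≡.cong (λ a → if isLine a then 1# else z l) e)))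
            (trans (in-block (isLine (blk b)) (yes e) e)
              (*-cong (sym (same (isLine (blk b)))) (*-congˡ (reflexive (≡.cong (λ a → if isLine a then z l else 1#) (≡.sym e))))))

        generator-cong : ∀ p {y y′} → y ≋ y′ → ∀ b l → generator-by p y b l ≈ generator-by p y′ b l
        generator-cong true  e b l = when-cong (blk l Fin.≟ blk b) (e l)
        generator-cong false e b l = +-cong (*-congˡ (e _)) (-‿cong (*-congˡ (e b)))

        generator-poly : ∀ p (z : Fin n → 𝕂) b l → Polynomial (λ s → generator-by p ((λ l → z l + s) ⊙x) b l)
        generator-poly true  z b l = poly-if (does (blk l Fin.≟ blk b)) (poly-* (poly-shift z l) (poly-const (x l))) (poly-const 0#)
        generator-poly false z b l = poly-+ (poly-* (poly-const (δ l b)) (poly-* (poly-shift z (σ (blk b))) (poly-const (x (σ (blk b))))))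
          (poly-neg (poly-* (poly-const (δ l (σ (blk b)))) (poly-* (poly-shift z b) (poly-const (x b)))))

        rows : (Fin n → 𝕂) → Fin ∣ chosen ∣ → Fin n → 𝕂
        rows y i = generator y (elements chosen i)

        Q P R : (Fin n → 𝕂) → 𝕂
        Q z = weight (onHyperplanes z) (Subset.∁ chosen)
        P z = weight (onHyperplanes z) chosen
        R z = prod (λ i → ρ-rest z (elements chosen i))

        onHyperplanes-≉0 : ∀ {z} → (∀ l → z l ≉ 0#) → ∀ l → onHyperplanes z l ≉ 0#
        onHyperplanes-≉0 h l = if-≉0 (isLine (blk l)) 1≉0 (h l)

        -- The product of `z` over all hyperplane blocks splits along `chosen` as well as along `I`;
        -- comparing the two splittings turns the inverse weight of `I` into the weight of its
        -- complement.
        torus-formula : ∀ z → (∀ l → z l ≉ 0#) → ∀ I → Q z * plü (rows (z ⊙x)) I ≈ R z * (ψ z (proj₁ I) * plü (rows x) I)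
        torus-formula z z≉0 I = *-cancel (weight-≉0 (onHyperplanes-≉0 z≉0) chosen) (begin
          P z * (Q z * p)                  ≈⟨ *-assoc _ _ _ ⟨
          P z * Q z * p                    ≈⟨ *-congʳ (trans (weight-complement (onHyperplanes z) chosen) (sym (weight-complement (onHyperplanes z) S))) ⟩
          (wH * wH∁) * p                   ≈⟨ solve 3 (λ a b p → (a :* b) :* p := b :* (a :* p)) refl wH wH∁ p ⟩
          wH∁ * (wH * p)                   ≈⟨ *-congˡ (plü-columns (rows (z ⊙x)) (onHyperplanes z) I) ⟨
          wH∁ * plü (λ i l → rows (z ⊙x) i l * onHyperplanes z l) I
            ≈⟨ *-congˡ (plü-cong (λ i l → generator-columns z (elements chosen i) l) I) ⟩
          wH∁ * plü (λ i l → ρ i * (rows x i l * onLines z l)) I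
            ≈⟨ *-congˡ (trans (plü-rows (λ i l → rows x i l * onLines z l) ρ I) (*-congˡ (plü-columns (rows x) (onLines z) I))) ⟩
          wH∁ * (prod ρ * (wL * p₁))
            ≈⟨ *-congˡ (*-congʳ (trans (Π.∑-distrib-+ (onHyperplanes z ∘ elements chosen) (ρ-rest z ∘ elements chosen))
                 (*-congʳ (prod-elements chosen (onHyperplanes z))))) ⟩
          wH∁ * (P z * R z * (wL * p₁))
            ≈⟨ solve 5 (λ w p r l q → w :* (p :* r :* (l :* q)) := p :* (r :* ((l :* w) :* q))) refl wH∁ (P z) (R z) wL p₁ ⟩
          P z * (R z * (wL * wH∁ * p₁))    ≈⟨ *-congˡ (*-congˡ (*-congʳ (ψ-split z S))) ⟨
          P z * (R z * (ψ z S * p₁))       ∎)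
          where
          open ≈-Reasoning
          S = proj₁ I
          p = plü (rows (z ⊙x)) I
          p₁ = plü (rows x) I
          wH = weight (onHyperplanes z) S
          wH∁ = weight (onHyperplanes z) (Subset.∁ S)
          wL = weight (onLines z) S
          ρ : Fin ∣ chosen ∣ → 𝕂
          ρ i = onHyperplanes z (elements chosen i) * ρ-rest z (elements chosen i)

        -- Both sides are polynomial in `z`, so the identity extends beyond the torus.
        formula : ∀ z I → Q z * plü (rows (z ⊙x)) I ≈ R z * (ψ z (proj₁ I) * plü (rows x) I)
        formula z I = x-y≈0⇒x≈y (torus-dense G G-cong G-poly (λ z z≉0 → x≈y⇒x-y≈0 (torus-formula z z≉0 I)) z)
          where
          G : (Fin n → 𝕂) → 𝕂
          G z = Q z * plü (rows (z ⊙x)) I - R z * (ψ z (proj₁ I) * plü (rows x) I)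
          G-cong : ∀ {z z′} → z ≋ z′ → G z ≈ G z′
          G-cong e = +-cong (*-cong (weight-cong (λ l → if-cong (isLine (blk l)) refl (e l)) (Subset.∁ chosen))
              (plü-cong (λ i l → generator-cong (isLine (blk (elements chosen i))) (λ l → *-congʳ (e l)) (elements chosen i) l) I))
            (-‿cong (*-cong (prod-cong (λ i → if-cong (isLine (blk (elements chosen i))) refl (e (σ (blk (elements chosen i)))))) (*-congʳ (ψ-cong e (proj₁ I)))))
          G-poly : ∀ z → Polynomial (λ s → G (λ l → z l + s))
          G-poly z = poly-+ (poly-* (poly-weight (λ l → poly-if (isLine (blk l)) (poly-const 1#) (poly-shift z l)) (Subset.∁ chosen))
              (poly-plü (λ i l → generator-poly (isLine (blk (elements chosen i))) z (elements chosen i) l) I))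
            (poly-neg (poly-* (poly-prod (λ i → poly-if (isLine (blk (elements chosen i))) (poly-const 1#) (poly-shift z (σ (blk (elements chosen i))))))
              (poly-* (ψ-poly z (proj₁ I)) (poly-const (plü (rows x) I)))))

      ∝-cancel : ∀ {ι : Set} {a b} {u v : ι → 𝕂} → a ≉ 0# → b ≉ 0# → (∀ i → a * u i ≈ b * v i) → u ∝ v
      ∝-cancel {a = a} {b} {u} {v} a≉0 b≉0 e = a ⁻¹[ a≉0 ] * b , *-≉0 (inv≉0 a≉0) b≉0 , λ i → begin
        u i                        ≈⟨ *-identityˡ _ ⟨
        1# * u i                   ≈⟨ *-congʳ (*-inv a≉0) ⟨
        a * a ⁻¹[ a≉0 ] * u i      ≈⟨ solve 3 (λ a r u → a :* r :* u := r :* (a :* u)) refl a (a ⁻¹[ a≉0 ]) (u i) ⟩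
        a ⁻¹[ a≉0 ] * (a * u i)    ≈⟨ *-congˡ (e i) ⟩
        a ⁻¹[ a≉0 ] * (b * v i)    ≈⟨ *-assoc _ _ _ ⟨
        a ⁻¹[ a≉0 ] * b * v i      ∎
        where open ≈-Reasoning

      -- `Q z` and `R z` are products of values of `z` at the section, so they stay nonzero when
      -- other coordinates of `z` vanish; this covers the boundary of the orbit.
      Space-plücker-ψ : ∀ {k z} → (∀ a → z (σ a) ≉ 0#) → (∀ a → x (σ a) ≉ 0#) →
        (H : HasDimension (Space x) k) (H′ : HasDimension (Space (z ⊙x)) k) →
        plü (HasDimension.basis H′) ∝ (λ I → ψ z (proj₁ I) * plü (HasDimension.basis H) I)
      Space-plücker-ψ {z = z} zσ≉0 xσ≉0 H H′ = by (reduced-size H (Space-reduced x xσ≉0)) H H′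
        where
        Q≉0 : Q z ≉ 0#
        Q≉0 = prod-≉0 (λ l → by (lookup (Subset.∁ chosen) l) (isLine (blk l)) l ≡.refl ≡.refl)
          where
          by : ∀ p q l → lookup (Subset.∁ chosen) l ≡ p → isLine (blk l) ≡ q → (if p then (if q then 1# else z l) else 1#) ≉ 0#
          by false _     l _ _ = 1≉0
          by true  true  l _ _ = 1≉0
          by true  false l s q = at (l Fin.≟ σ (blk l))
            where
            at : Dec (l ≡ σ (blk l)) → z l ≉ 0#
            at (yes l≡) = ≉0-cong (reflexive (≡.cong z (≡.sym l≡))) (zσ≉0 (blk l))
            at (no l≢)  = contradiction (≡.trans (Vec.lookup-map l not chosen) (≡.cong not (hyperplane∈ q l≢))) (true≢false s)
        R≉0 : R z ≉ 0#
        R≉0 = prod-≉0 (λ i → if-≉0 (isLine (blk (elements chosen i))) 1≉0 (zσ≉0 _))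
        by : ∀ {k} → ∣ chosen ∣ ≡ k → (H : HasDimension (Space x) k) (H′ : HasDimension (Space (z ⊙x)) k) →
          plü (HasDimension.basis H′) ∝ (λ I → ψ z (proj₁ I) * plü (HasDimension.basis H) I)
        by ≡.refl H H′ = ∝-trans (Space-plücker (z ⊙x) (λ a → *-≉0 (zσ≉0 a) (xσ≉0 a)) H′ ≡.refl)
          (∝-trans (∝-cancel Q≉0 R≉0 (formula z)) (c , c≉0 , λ I → trans (*-congˡ (c-≈ I))
            (solve 3 (λ p c q → p :* (c :* q) := c :* (p :* q)) refl (ψ z (proj₁ I)) c (plü (HasDimension.basis H) I))))
          where
          proportional = ∝-sym (Space-plücker x xσ≉0 H ≡.refl)
          c = proj₁ proportional
          c≉0 = proj₁ (proj₂ proportional)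
          c-≈ = proj₂ (proj₂ proportional)

-- The orbit closure as the family of block spaces.

module StarClosures {K : CommutativeRing 0ℓ 0ℓ} (F : ClassicalField K) where
  open StarOrbits F public

  reduced-≐ : ∀ {n} {W W′ : Pred (Fin n → 𝕂) 0ℓ} {S} → W ≐ W′ → Reduced W S → Reduced W′ S
  reduced-≐ (W⊆W′ , W′⊆W) R = record
    { row = row ; row∈ = λ b → W⊆W′ (row∈ b) ; row-out = row-out ; row-δ = row-δ
    ; determined = λ v v∈ → determined v (W′⊆W v∈) }
    where open Reduced R

  module OnStar {k n : ℕ} (X : Gr k (Fin n)) (star : Star X) where
    open Star star public
    open Blocks blk isLine public
    open Closure X public hiding (x)

    X≐Space : subspace X ≐ Space x
    X≐Space = X⊆Space , Space⊆X

    _⊙_ : (Fin n → 𝕂) → (Fin n → 𝕂) → Fin n → 𝕂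
    (z ⊙ y) l = z l * y l

    Ψ : (Fin n → 𝕂) → KSubset k n → 𝕂
    Ψ z I = ψ blk isLine z (proj₁ I) * plücker X I

    HX : HasDimension (Space x) k
    HX = dimension-≐ X≐Space (dimension X)

    -- Such a `z` represents a point in the product of the projective spaces of the blocks.
    record Good (z : Fin n → 𝕂) : Set where
      constructor good
      field
        σ     : Fin r → Fin n
        blk-σ : ∀ a → blk (σ a) ≡ a
        zσ≉0  : ∀ a → z (σ a) ≉ 0#

    space⇒plücker : ∀ {z} → Good z → (Y : Gr k (Fin n)) → subspace Y ≐ Space (z ⊙ x) → plücker Y ∝ Ψ z
    space⇒plücker {z} (good σ blk-σ zσ≉0) Y Y≐ = ∝-trans (≋⇒∝ (λ I → reflexive (plücker≡plü Y I)))
      (∝-trans (Space-plücker-ψ blk isLine σ blk-σ x zσ≉0 (λ a → x≉0 (σ a)) HX (dimension-≐ Y≐ (dimension Y)))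
        (≋⇒∝ (λ I → *-congˡ (sym (reflexive (plücker≡plü X I))))))

    spaceGr : ∀ z → Good z → Gr k (Fin n)
    spaceGr z (good σ blk-σ zσ≉0) = record
      { subspace = Space (z ⊙ x)
      ; dimension = ≡.subst (HasDimension (Space (z ⊙ x))) (reduced-size HX (Section.Space-reduced σ blk-σ x (λ a → x≉0 (σ a))))
          (reduced⇒dimension (Space-closed (z ⊙ x)) (Section.Space-reduced σ blk-σ (z ⊙ x) (λ a → *-≉0 (zσ≉0 a) (x≉0 (σ a))))) }

    -- For `z` in the torus, `Ψ z` is the orbit point of the torus element equal to `z` on lines and
    -- to its inverse on hyperplanes, times `H`, the product of `z` over the hyperplane blocks.
    -- Density gives the other `z`.
    Ψ-vanishes : ∀ f → VanishesOnOrbit f → ∀ z → eval (poly f) (λ _ → Ψ z) ≈ 0#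
    Ψ-vanishes f vanishes = torus-dense (λ z → eval (poly f) (λ _ → Ψ z))
      (λ e → eval-cong (poly f) (λ _ I → *-congʳ (ψ-cong blk isLine e (proj₁ I))))
      (λ z → poly-eval (poly f) (λ _ I → poly-* (ψ-poly blk isLine z (proj₁ I)) (poly-const (plücker X I))))
      (λ z z≉0 → vanishes-∝ f (translated z z≉0) (vanishes (T z z≉0)))
      where
      wL : (Fin n → 𝕂) → Subset n → 𝕂
      wL z = weight (onLines blk isLine z)
      wH : (Fin n → 𝕂) → Subset n → 𝕂
      wH z = weight (onHyperplanes blk isLine z)
      module _ (z : Fin n → 𝕂) (z≉0 : ∀ l → z l ≉ 0#) where
        inv : Fin n → 𝕂
        inv l = if isLine (blk l) then 1# else z l ⁻¹[ z≉0 l ]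
        t : Fin n → 𝕂
        t l = onLines blk isLine z l * inv l
        T : Torus n
        T = t , λ l → *-≉0 (if-≉0 (isLine (blk l)) (z≉0 l) 1≉0) (if-≉0 (isLine (blk l)) 1≉0 (inv≉0 (z≉0 l)))
        H = prod (onHyperplanes blk isLine z)
        cancels : ∀ S → wH z S * weight inv S ≈ 1#
        cancels S = trans (weight-* (onHyperplanes blk isLine z) inv S) (prod-one (λ l → one (lookup S l) (isLine (blk l)) l))
          where
          one : ∀ p q l → (if p then (if q then 1# else z l) * (if q then 1# else z l ⁻¹[ z≉0 l ]) else 1#) ≈ 1#
          one false q     l = refl
          one true  true  l = *-identityˡ 1#
          one true  false l = *-inv (z≉0 l)
        translated : Ψ z ∝ orbit-point T
        translated = H , prod-≉0 (λ l → if-≉0 (isLine (blk l)) 1≉0 (z≉0 l)) , λ I → let S = proj₁ I in begin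
          ψ blk isLine z S * plücker X I
            ≈⟨ *-congʳ (trans (ψ-split blk isLine z S) (trans (sym (*-identityˡ _)) (*-congʳ (sym (cancels S))))) ⟩
          wH z S * weight inv S * (wL z S * wH z (Subset.∁ S)) * plücker X I
            ≈⟨ solve 5 (λ h i l c p → h :* i :* (l :* c) :* p := (h :* c) :* ((l :* i) :* p)) refl
                 (wH z S) (weight inv S) (wL z S) (wH z (Subset.∁ S)) (plücker X I) ⟩
          (wH z S * wH z (Subset.∁ S)) * ((wL z S * weight inv S) * plücker X I)
            ≈⟨ *-cong (weight-complement (onHyperplanes blk isLine z) S) (*-congʳ (weight-* (onLines blk isLine z) inv S)) ⟩
          H * (weight t S * plücker X I) ∎
          where open ≈-Reasoning

    plücker⇒closure : ∀ z Y → plücker Y ∝ Ψ z → OrbitClosure X Y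
    plücker⇒closure z Y e = closure-intro {Y} (λ f vanishes → vanishes-∝ f e (Ψ-vanishes f vanishes z))

    module _ (σ : Fin r → Fin n) (blk-σ : ∀ a → blk (σ a) ≡ a) (l : Fin n) where

      redirect : Fin r → Fin n
      redirect a = if does (a Fin.≟ blk l) then l else σ a

      blk-redirect : ∀ a → blk (redirect a) ≡ a
      blk-redirect a with a Fin.≟ blk l
      ... | yes e = ≡.sym e
      ... | no  _ = blk-σ a

      redirect-new : redirect (blk l) ≡ l
      redirect-new with blk l Fin.≟ blk l
      ... | yes _ = ≡.refl
      ... | no ¬e = contradiction ≡.refl ¬e

      redirect-old : ∀ {a} → a ≢ blk l → redirect a ≡ σ a
      redirect-old {a} a≢ with a Fin.≟ blk l
      ... | yes e = contradiction e a≢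
      ... | no  _ = ≡.refl

    Chosen : Subset n → Set
    Chosen T = Σ[ σ ∈ (Fin r → Fin n) ] Σ[ blk-σ ∈ (∀ a → blk (σ a) ≡ a) ] Section.chosen σ blk-σ ≡ T

    module _ {T : Subset n} (R : Reduced (Space x) T) where
      open Reduced R
      private
        -- The index that a section with `chosen = T` has to pick in the block.
        Exceptional : Fin r → Fin n → Set
        Exceptional a l = blk l ≡ a × lookup T l ≡ isLine a

        -- Otherwise the generator of the line vanishes on `T` without being zero.
        exists-line : ∀ a → isLine a ≡ true → (∀ l → blk l ≡ a → lookup T l ≡ false) → ⊥
        exists-line a p none = x≉0 l (trans (sym (trans (reflexive (≡.cong (λ q → generator-by q x l l) (≡.trans (≡.cong isLine (blk-σ₀ a)) p)))
            (when-yes (blk l Fin.≟ blk l) ≡.refl)))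
          (determined (generator x l) (generator∈ x l)
            (λ b b∈ → generator-off (isLine (blk l)) x l b (λ e → true≢false b∈ (none b (≡.trans e (blk-σ₀ a))))) l))
          where
          open Section σ₀ blk-σ₀
          l = σ₀ a

        -- Otherwise a reduced row has a single nonzero coordinate in the block, against the
        -- equation.
        exists-hyperplane : ∀ a → isLine a ≡ false → (∀ l → blk l ≡ a → lookup T l ≡ true) → ⊥
        exists-hyperplane a p all = x≉0 b (trans (sym (*-identityʳ _)) (trans (sym (trans
            (sum-single (λ l → (x l * row b l) when (blk l Fin.≟ a)) b off)
            (trans (when-yes (blk b Fin.≟ a) (blk-σ₀ a)) (*-congˡ (row-diag b (all b (blk-σ₀ a)))))))
            (condition p (row∈ b a))))
          where
          b = σ₀ a
          condition : isLine a ≡ false → Condition (isLine a) a x (row b) → OnHyperplane a x (row b)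
          condition p c = ≡.subst (λ q → Condition q a x (row b)) p c
          off : ∀ l → l ≢ b → (x l * row b l) when (blk l Fin.≟ a) ≈ 0#
          off l l≢b = by (blk l Fin.≟ a)
            where
            by : (d : Dec (blk l ≡ a)) → (x l * row b l) when d ≈ 0#
            by (no _)  = refl
            by (yes e) = *0≈0 (row-off b l (all l e) (l≢b ∘ ≡.sym))

        -- On a line the coordinates at `l` and `l′` are in a fixed nonzero ratio, so they cannot be
        -- 1 and 0.
        unique-line : ∀ a → isLine a ≡ true → ∀ l l′ → blk l ≡ a → blk l′ ≡ a → lookup T l ≡ true → lookup T l′ ≡ true → l ≢ l′ → ⊥
        unique-line a p l l′ e e′ t t′ l≢ = x≉0 l′ (trans (sym (*1≈ (row-diag l t)))
          (trans (sym (≡.subst (λ q → Condition q a x (row l)) p (row∈ l a) l l′ e e′)) (*0≈0 (row-off l l′ t′ l≢))))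

        -- With the section redirected through `l′`, the generator of `l` is supported on two
        -- indices missing from `T` and would have to vanish.
        unique-hyperplane : ∀ l l′ → isLine (blk l) ≡ false → blk l ≡ blk l′ → lookup T l ≡ false → lookup T l′ ≡ false → l ≢ l′ → ⊥
        unique-hyperplane l l′ p e t t′ l≢ = x≉0 l′ (begin
            x l′                                        ≈⟨ +-identityʳ _ ⟨
            x l′ + 0#                                   ≈⟨ +-cong (trans (sym (*-identityˡ _)) (*-congʳ (sym (δ-same l))))
                                                             (sym (-0≈0 (0*≈0 (δ-≢ l≢)))) ⟩
            δ l l * x l′ - δ l l′ * x l                 ≡⟨ ≡.cong (λ h → δ l l * x h - δ l h * x l) h≡ ⟨
            generator-by false x l l                    ≡⟨ ≡.cong (λ q → generator-by q x l l) p ⟨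
            generator x l l                             ≈⟨ determined (generator x l) (generator∈ x l) vanishes l ⟩
            0#                                          ∎)
          where
          open ≈-Reasoning
          open Section (redirect σ₀ blk-σ₀ l′) (blk-redirect σ₀ blk-σ₀ l′)
          h≡ : redirect σ₀ blk-σ₀ l′ (blk l) ≡ l′
          h≡ = ≡.trans (≡.cong (redirect σ₀ blk-σ₀ l′) e) (redirect-new σ₀ blk-σ₀ l′)
          vanishes : ∀ b → lookup T b ≡ true → generator x l b ≈ 0#
          vanishes b b∈ = trans (reflexive (≡.trans (≡.cong (λ q → generator-by q x l b) p) (≡.cong (λ h → δ b l * x h - δ b h * x l) h≡)))
            (trans (+-cong (0*≈0 (δ-≢ {i = b} {l} (λ { ≡.refl → true≢false b∈ t })))
              (-0≈0 (0*≈0 (δ-≢ {i = b} {l′} (λ { ≡.refl → true≢false b∈ t′ }))))) (+-identityˡ _))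

        exceptional : ∀ a → ∃[ l ] Exceptional a l
        exceptional a = by (em _)
          where
          absurd : ∀ q → isLine a ≡ q → ¬ (∃[ l ] Exceptional a l) → ⊥
          absurd true  p ¬p = exists-line a p (λ l e → not-true (λ t → ¬p (l , e , ≡.trans t (≡.sym p))))
          absurd false p ¬p = exists-hyperplane a p (λ l e → not-false (λ t → ¬p (l , e , ≡.trans t (≡.sym p))))
          by : Dec (∃[ l ] Exceptional a l) → ∃[ l ] Exceptional a l
          by (yes p) = p
          by (no ¬p) = ⊥-elim (absurd (isLine a) ≡.refl ¬p)

        exceptional-unique : ∀ {a l l′} → Exceptional a l → Exceptional a l′ → l ≡ l′
        exceptional-unique {a} {l} {l′} (e , t) (e′ , t′) = by (l Fin.≟ l′)
          where
          absurd : ∀ q → isLine a ≡ q → l ≢ l′ → ⊥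
          absurd true  p = unique-line a p l l′ e e′ (≡.trans t p) (≡.trans t′ p)
          absurd false p = unique-hyperplane l l′ (≡.trans (≡.cong isLine e) p) (≡.trans e (≡.sym e′)) (≡.trans t p) (≡.trans t′ p)
          by : Dec (l ≡ l′) → l ≡ l′
          by (yes p) = p
          by (no ¬p) = ⊥-elim (absurd (isLine a) ≡.refl ¬p)

      reduced⇒chosen : Chosen T
      reduced⇒chosen = σ , blk-σ , subset-ext (λ l → ≡.trans (lookup-chosen l) (by l (l Fin.≟ σ (blk l))))
        where
        σ : Fin r → Fin n
        σ a = proj₁ (exceptional a)
        blk-σ : ∀ a → blk (σ a) ≡ a
        blk-σ a = proj₁ (proj₂ (exceptional a))
        open Section σ blk-σ
        chosen-true : ∀ q → chosen-by q true ≡ q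
        chosen-true true  = ≡.refl
        chosen-true false = ≡.refl
        chosen-false : ∀ q t → t ≢ q → chosen-by q false ≡ t
        chosen-false true  true  ne = contradiction ≡.refl ne
        chosen-false true  false ne = ≡.refl
        chosen-false false true  ne = ≡.refl
        chosen-false false false ne = contradiction ≡.refl ne
        by : ∀ l (d : Dec (l ≡ σ (blk l))) → chosen-by (isLine (blk l)) (does d) ≡ lookup T l
        by l (yes e) = ≡.trans (chosen-true (isLine (blk l))) (≡.sym (≡.trans (≡.cong (lookup T) e) (proj₂ (proj₂ (exceptional (blk l))))))
        by l (no ¬e) = chosen-false (isLine (blk l)) (lookup T l) (λ t → ¬e (exceptional-unique (≡.refl , t) (proj₂ (exceptional (blk l)))))

    plücker≉0⇒chosen : ∀ I → plücker X I ≉ 0# → Chosen (proj₁ I)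
    plücker≉0⇒chosen I p = reduced⇒chosen (reduced-≐ X≐Space (x≉0⇒reduced I p))

    chosen⇒plücker≉0 : ∀ σ blk-σ e → plücker X (Section.chosen σ blk-σ , e) ≉ 0#
    chosen⇒plücker≉0 σ blk-σ e = x-basis≉0 (reduced-≐ (Space⊆X , X⊆Space) (Section.Space-reduced σ blk-σ x (λ a → x≉0 (σ a)))) e

    chosen-size : ∀ σ blk-σ → ∣ Section.chosen σ blk-σ ∣ ≡ k
    chosen-size σ blk-σ = reduced-size HX (Section.Space-reduced σ blk-σ x (λ a → x≉0 (σ a)))

    module _ (Y : Gr k (Fin n)) where

      closure-support : OrbitClosure X Y → ∀ I → plücker X I ≈ 0# → plücker Y I ≈ 0#
      closure-support Y∈ I xI≈0 = trans (sym (trans (+-identityʳ _) (trans (*-identityˡ _) (*-identityʳ _)))) (closure-elim {Y} Y∈ f vanishes)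
        where
        f : Form {1} (λ _ → KSubset k n)
        f = record { degree = λ _ → 1 ; poly = (1# , (zero , I) ∷ []) ∷ [] ; homogeneous = (λ { zero → ≡.refl }) ∷ [] }
        vanishes : VanishesOnOrbit f
        vanishes T = trans (+-identityʳ _) (trans (*-identityˡ _) (trans (*-identityʳ _) (*0≈0 xI≈0)))

      -- A Plücker coordinate that vanishes at X vanishes on the closure, so every basis of Y is one
      -- of X.
      closure-chosen : OrbitClosure X Y → ∀ {T} → Reduced (subspace Y) T → Chosen T
      closure-chosen Y∈ {T} Q = plücker≉0⇒chosen I (λ e →
          reduced⇒plü≉0 (dimension Y) Q (proj₂ I) (trans (sym (reflexive (plücker≡plü Y I))) (closure-support Y∈ I e)))
        where
        I : KSubset k n
        I = T , reduced-size (dimension Y) Q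

      module _ (σ : Fin r → Fin n) (blk-σ : ∀ a → blk (σ a) ≡ a) where
        open Section σ blk-σ

        -- Adding `l` without removing anything from its block leaves two elements on a line, or a
        -- hyperplane block with no omitted index; no section does either.
        chosen-swap : ∀ {b l} → lookup chosen b ≡ true → lookup chosen l ≡ false → Chosen (swap chosen b l) → blk b ≡ blk l
        chosen-swap {b} {l} b∈ l∉ (σ′ , blk-σ′ , e) = by (blk b Fin.≟ blk l)
          where
          module S′ = Section σ′ blk-σ′
          ∈′ : ∀ {m} → lookup (swap chosen b l) m ≡ true → lookup S′.chosen m ≡ true
          ∈′ {m} = ≡.trans (≡.cong (λ S → lookup S m) e)
          absurd : ∀ q → isLine (blk l) ≡ q → blk b ≢ blk l → ⊥
          absurd true p b≢ = true≢false (σ∈ p) (≡.trans (≡.cong (lookup chosen) same) l∉)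
            where
            m = σ (blk l)
            m≢l : m ≢ l
            m≢l e = true≢false (σ∈ p) (≡.trans (≡.cong (lookup chosen) e) l∉)
            m∈′ = ∈′ (≡.trans (swap-other chosen m≢l (λ e → b≢ (≡.trans (≡.cong blk (≡.sym e)) (blk-σ (blk l))))) (σ∈ p))
            same : m ≡ l
            same = ≡.trans (S′.line⇒σ (≡.trans (≡.cong isLine (blk-σ (blk l))) p) m∈′)
              (≡.trans (≡.cong σ′ (blk-σ (blk l))) (≡.sym (S′.line⇒σ p (∈′ (swap-new chosen)))))
          absurd false p b≢ = S′.σ∉ pm (∈′ (≡.trans (swap-other chosen m≢l (λ e → b≢ (≡.trans (≡.cong blk (≡.sym e)) (blk-σ′ (blk l))))) m∈))
              (≡.cong σ′ (≡.sym (blk-σ′ (blk l))))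
            where
            m = σ′ (blk l)
            pm : isLine (blk m) ≡ false
            pm = ≡.trans (≡.cong isLine (blk-σ′ (blk l))) p
            m≢l : m ≢ l
            m≢l e = S′.σ∉ p (∈′ (swap-new chosen)) (≡.sym e)
            l≡ : Dec (l ≡ σ (blk l)) → l ≡ σ (blk l)
            l≡ (yes e) = e
            l≡ (no ¬e) = contradiction l∉ (true≢false (hyperplane∈ p ¬e))
            m∈ : lookup chosen m ≡ true
            m∈ = hyperplane∈ pm (λ e → m≢l (≡.trans e (≡.trans (≡.cong σ (blk-σ′ (blk l))) (≡.sym (l≡ (l Fin.≟ σ (blk l)))))))
          by : Dec (blk b ≡ blk l) → blk b ≡ blk l
          by (yes p) = p
          by (no ¬p) = ⊥-elim (absurd (isLine (blk l)) ≡.refl ¬p)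

      IsSpace : Set
      IsSpace = Σ[ z ∈ (Fin n → 𝕂) ] Good z × subspace Y ≐ Space (z ⊙ x)

      isSpace : ∀ σ → (∀ a → blk (σ a) ≡ a) → ∀ y → (∀ a → y (σ a) ≉ 0#) → subspace Y ≐ Space y → IsSpace
      isSpace σ blk-σ y yσ≉0 (Y⊆ , ⊆Y) = z , good σ blk-σ (λ a → *-≉0 (yσ≉0 a) (inv≉0 (x≉0 (σ a)))) ,
          (λ v∈ → Space-cong y≋ (Y⊆ v∈)) , (λ v∈ → ⊆Y (Space-cong (λ l → sym (y≋ l)) v∈))
        where
        z : Fin n → 𝕂
        z l = y l * x l ⁻¹[ x≉0 l ]
        y≋ : y ≋ (z ⊙ x)
        y≋ l = sym (trans (*-assoc _ _ _) (*1≈ (trans (*-comm _ _) (*-inv (x≉0 l)))))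

      -- A nonzero entry of a reduced matrix of Y permits an exchange, and the exchanged set is
      -- again a basis of X; so the entry lies within a block and `BlockDiagonal` applies.
      closure⇒space : OrbitClosure X Y → IsSpace
      closure⇒space Y∈ = by T Q (closure-chosen Y∈ Q)
        where
        T = proj₁ (reduced-exists (X-closed Y))
        Q = proj₂ (reduced-exists (X-closed Y))
        by : ∀ T → Reduced (subspace Y) T → Chosen T → IsSpace
        by _ Q (σ , blk-σ , ≡.refl) = isSpace σ blk-σ coefficient coefficient-σ≉0 (W⊆Space , Space⊆W)
          where
          open BlockDiagonal blk isLine σ blk-σ (X-closed Y) Q
            (λ b l b∈ l∉ ≉0 → chosen-swap σ blk-σ b∈ l∉ (closure-chosen Y∈ (pivot (X-closed Y) Q b∈ l∉ ≉0)))

      space⇒closure : IsSpace → OrbitClosure X Y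
      space⇒closure (z , g , e) = plücker⇒closure z Y (space⇒plücker g Y e)

-- Counting indices block by block.

module Counting where
  open Sum ℕ.+-*-semiring using (sum; sum-cong-≗; ∑-comm; ∑-distrib-+; sum-remove; sum-replicate-zero)

  private variable
    n r : ℕ

  one-if : Bool → ℕ
  one-if b = if b then 1 else 0

  size-sum : (S : Subset n) → ∣ S ∣ ≡ sum (one-if ∘ lookup S)
  size-sum []          = ≡.refl
  size-sum (true  ∷ S) = ≡.cong suc (size-sum S)
  size-sum (false ∷ S) = size-sum S

  vec-sum : (f : Fin n → ℕ) → Vec.sum (tabulate f) ≡ sum f
  vec-sum {zero}  f = ≡.refl
  vec-sum {suc n} f = ≡.cong (f zero ℕ.+_) (vec-sum (f ∘ suc))

  sum-single : (f : Fin n → ℕ) → ∀ i → (∀ j → j ≢ i → f j ≡ 0) → sum f ≡ f i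
  sum-single {suc n} f i e = ≡.trans (sum-remove {i = i} f)
    (≡.trans (≡.cong (f i ℕ.+_) (≡.trans (sum-cong-≗ (λ j → e (punchIn i j) (Fin.punchInᵢ≢i i j))) (sum-replicate-zero n))) (ℕ.+-identityʳ _))

  within : ∀ {P : Set} → ℕ → Dec P → ℕ
  within x d = if does d then x else 0

  within-yes : ∀ {P : Set} {x} (d : Dec P) → P → within x d ≡ x
  within-yes (yes _) _ = ≡.refl
  within-yes (no ¬p) p = contradiction p ¬p

  within-no : ∀ {P : Set} {x} (d : Dec P) → ¬ P → within x d ≡ 0
  within-no (yes p) ¬p = contradiction p ¬p
  within-no (no _)  _  = ≡.refl

  sum-fibres : (blk : Fin n → Fin r) (f : Fin n → ℕ) → sum (λ a → sum (λ l → within (f l) (blk l Fin.≟ a))) ≡ sum f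
  sum-fibres blk f = ≡.trans (∑-comm (λ a l → within (f l) (blk l Fin.≟ a)))
    (sum-cong-≗ (λ l → ≡.trans (sum-single (λ a → within (f l) (blk l Fin.≟ a)) (blk l) (λ a a≢ → within-no (blk l Fin.≟ a) (a≢ ∘ ≡.sym)))
      (within-yes (blk l Fin.≟ blk l) ≡.refl)))

  sum-one : (i : Fin n) → sum (λ l → within 1 (l Fin.≟ i)) ≡ 1
  sum-one i = ≡.trans (sum-single (λ l → within 1 (l Fin.≟ i)) i (λ j j≢i → within-no (j Fin.≟ i) j≢i)) (within-yes (i Fin.≟ i) ≡.refl)

  sum-cong : (f g : Fin n → ℕ) → (∀ l → f l ≡ g l) → sum f ≡ sum g
  sum-cong f g e = sum-cong-≗ e

  sum-pair : (f g h : Fin n → ℕ) → (∀ l → f l ≡ g l ℕ.+ h l) → sum f ≡ sum g ℕ.+ sum h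
  sum-pair f g h e = ≡.trans (sum-cong-≗ e) (∑-distrib-+ g h)

-- The orbit closure as a product of Grassmannians.

module StarProducts {K : CommutativeRing 0ℓ 0ℓ} (F : ClassicalField K) where
  open StarClosures F public

  equal-dimension-⊆ : ∀ {ι : Set} {d} {W W′ : Pred (ι → 𝕂) 0ℓ} → HasDimension W d → HasDimension W′ d →
    (∀ {v} → v ∈ W → v ∈ W′) → ∀ {v} → v ∈ W′ → v ∈ W
  equal-dimension-⊆ {ι} {d} {W} {W′} H H′ W⊆W′ {v} v∈ = by (em (v ∈ W))
    where
    b = HasDimension.basis H
    family : Fin (suc d) → ι → 𝕂
    family zero    = v
    family (suc j) = b j
    family∈ : ∀ j → family j ∈ W′
    family∈ zero    = v∈
    family∈ (suc j) = W⊆W′ (basis∈ H j)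
    independent : ¬ v ∈ W → ∀ c → combination c family ≋ (λ _ → 0#) → ∀ j → c j ≈ 0#
    independent v∉ c e = λ { zero → c₀≈0 ; (suc j) → HasDimension.independent H (c ∘ suc)
        (λ i → trans (sym (0+≈ (0*≈0 c₀≈0))) (e i)) j }
      where
      c₀≈0 : c zero ≈ 0#
      c₀≈0 = by-contradiction (λ c₀≉0 → v∉ (closed H (λ j → - c zero ⁻¹[ c₀≉0 ] * c (suc j)) b (basis∈ H) v
        (λ i → let q = c zero ⁻¹[ c₀≉0 ] ; s = sum (λ j → c (suc j) * b j i) in sym (begin
          sum (λ j → - q * c (suc j) * b j i)
            ≈⟨ trans (sum-cong-≋ (λ j → *-assoc (- q) (c (suc j)) (b j i))) (sym (*-distribˡ-sum (- q) (λ j → c (suc j) * b j i))) ⟩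
          - q * s
            ≈⟨ solve 4 (λ q c v s → (:- q) :* s := (:- q) :* (c :* v :+ s) :+ (c :* q) :* v) refl q (c zero) (v i) s ⟩
          - q * (c zero * v i + s) + (c zero * q) * v i
            ≈⟨ +-cong (*0≈0 (e i)) (1*≈ (*-inv c₀≉0)) ⟩
          0# + v i
            ≈⟨ +-identityˡ _ ⟩
          v i ∎))))
        where open ≈-Reasoning
    by : Dec (v ∈ W) → v ∈ W
    by (yes p) = p
    by (no ¬p) = contradiction (independent-bound H′ family family∈ (independent ¬p)) ℕ.1+n≰n

  module OnStarProduct {k n : ℕ} (X : Gr k (Fin n)) (star : Star X) where
    open OnStar X star public

    J : Fin r → Subset n
    J a = tabulate (λ l → does (blk l Fin.≟ a))

    -- Blocks are nonempty, so the subtraction is exact. A one-element block has the value 1 as a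
    -- line and 0 as a hyperplane, which accounts for isolated indices.
    κ-by : Bool → ℕ → ℕ
    κ-by true  _ = 1
    κ-by false m = m ∸ 1

    κ : Fin r → ℕ
    κ a = κ-by (isLine a) ∣ J a ∣

    J⇒blk : ∀ {a l} → lookup (J a) l ≡ true → blk l ≡ a
    J⇒blk {a} {l} e = from-does (blk l Fin.≟ a) (≡.trans (≡.sym (Vec.lookup∘tabulate _ l)) e)

    blk⇒J : ∀ {a l} → blk l ≡ a → lookup (J a) l ≡ true
    blk⇒J {a} {l} e = ≡.trans (Vec.lookup∘tabulate _ l) (does-true (blk l Fin.≟ a) e)

    J-partition : IsPartition J
    J-partition = record
      { nonempty = λ a → σ₀ a , lookup⇒∈ (blk⇒J (blk-σ₀ a))
      ; disjoint = λ a b a≢b (l , l∈) → let (p , q) = Subset.x∈p∩q⁻ (J a) (J b) l∈ in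
          a≢b (≡.trans (≡.sym (J⇒blk (∈⇒lookup p))) (J⇒blk (∈⇒lookup q)))
      ; covers = λ l → blk l , lookup⇒∈ (blk⇒J ≡.refl) }

    κ-options : ∀ a → κ a ≡ 0 ⊎ κ a ≡ 1 ⊎ κ a ≡ ∣ J a ∣ ∸ 1 ⊎ κ a ≡ ∣ J a ∣
    κ-options a = by (isLine a)
      where
      by : ∀ b → κ-by b ∣ J a ∣ ≡ 0 ⊎ κ-by b ∣ J a ∣ ≡ 1 ⊎ κ-by b ∣ J a ∣ ≡ ∣ J a ∣ ∸ 1 ⊎ κ-by b ∣ J a ∣ ≡ ∣ J a ∣
      by true  = inj₂ (inj₁ ≡.refl)
      by false = inj₂ (inj₂ (inj₁ ≡.refl))

    module _ (σ : Fin r → Fin n) (blk-σ : ∀ a → blk (σ a) ≡ a) where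
      open Section σ blk-σ
      open Counting using (one-if; within; within-yes; within-no; size-sum; vec-sum; sum-fibres; sum-one; sum-pair; sum-cong)
      private module ℕΣ = Sum ℕ.+-*-semiring

      chosen-in : Fin r → Subset n
      chosen-in a = tabulate (λ l → if does (blk l Fin.≟ a) then lookup chosen l else false)

      chosen-in⇒ : ∀ {a l} → lookup (chosen-in a) l ≡ true → blk l ≡ a × lookup chosen l ≡ true
      chosen-in⇒ {a} {l} e = by (blk l Fin.≟ a) (≡.trans (≡.sym (Vec.lookup∘tabulate _ l)) e)
        where
        by : (d : Dec (blk l ≡ a)) → (if does d then lookup chosen l else false) ≡ true → blk l ≡ a × lookup chosen l ≡ true
        by (yes p) q = p , q

      ⇒chosen-in : ∀ {a l} → blk l ≡ a → lookup chosen l ≡ true → lookup (chosen-in a) l ≡ true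
      ⇒chosen-in {a} {l} p q = ≡.trans (Vec.lookup∘tabulate _ l) (≡.trans
        (≡.cong (λ b → if b then lookup chosen l else false) (does-true (blk l Fin.≟ a) p)) q)

      private
        count : Fin r → ℕ
        count a = ℕΣ.sum (λ l → within (one-if (lookup chosen l)) (blk l Fin.≟ a))

        chosen-in-size : ∀ a → ∣ chosen-in a ∣ ≡ count a
        chosen-in-size a = ≡.trans (size-sum (chosen-in a)) (sum-cong (one-if ∘ lookup (chosen-in a)) (λ l → within (one-if (lookup chosen l)) (blk l Fin.≟ a)) (λ l →
          ≡.trans (≡.cong one-if (Vec.lookup∘tabulate _ l)) (by (does (blk l Fin.≟ a)) (lookup chosen l))))
          where
          by : ∀ p q → one-if (if p then q else false) ≡ (if p then one-if q else 0)
          by true  q = ≡.refl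
          by false q = ≡.refl

        J-size : ∀ a → ∣ J a ∣ ≡ ℕΣ.sum (λ l → within 1 (blk l Fin.≟ a))
        J-size a = ≡.trans (size-sum (J a)) (sum-cong (one-if ∘ lookup (J a)) (λ l → within 1 (blk l Fin.≟ a)) (λ l → ≡.cong one-if (Vec.lookup∘tabulate _ l)))

        count-κ : ∀ a b → isLine a ≡ b → count a ≡ κ-by b ∣ J a ∣
        count-κ a true p = ≡.trans (sum-cong (λ l → within (one-if (lookup chosen l)) (blk l Fin.≟ a)) (λ l → within 1 (l Fin.≟ σ a)) (λ l → by l (blk l Fin.≟ a) (l Fin.≟ σ a))) (sum-one (σ a))
          where
          by : ∀ l (d : Dec (blk l ≡ a)) (e : Dec (l ≡ σ a)) → within (one-if (lookup chosen l)) d ≡ within 1 e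
          by l (no ¬p)      (yes ≡.refl) = contradiction (blk-σ a) ¬p
          by l (no _)       (no _)       = ≡.refl
          by l (yes ≡.refl) (yes e)      = ≡.cong one-if (≡.trans (chosen-line p) (does-true (l Fin.≟ σ (blk l)) e))
          by l (yes ≡.refl) (no ¬e)      = ≡.cong one-if (≡.trans (chosen-line p) (does-false (l Fin.≟ σ (blk l)) ¬e))
        -- Shown as `∣ J a ∣ = 1 + count a` and then decremented, to stay clear of truncated
        -- subtraction.
        count-κ a false p = ≡.sym (≡.cong (_∸ 1) (≡.trans (J-size a) (≡.trans (sum-pair (λ l → within 1 (blk l Fin.≟ a)) (λ l → within 1 (l Fin.≟ σ a))
              (λ l → within (one-if (lookup chosen l)) (blk l Fin.≟ a)) (λ l → by l (blk l Fin.≟ a) (l Fin.≟ σ a))) (≡.cong (ℕ._+ count a) (sum-one (σ a))))))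
          where
          by : ∀ l (d : Dec (blk l ≡ a)) (e : Dec (l ≡ σ a)) → within 1 d ≡ within 1 e ℕ.+ within (one-if (lookup chosen l)) d
          by l (no ¬p)      (yes ≡.refl) = contradiction (blk-σ a) ¬p
          by l (no _)       (no _)       = ≡.refl
          by l (yes ≡.refl) (yes e)      = ≡.cong (λ b → suc (one-if b)) (≡.sym (≡.trans (chosen-hyperplane p) (≡.cong not (does-true (l Fin.≟ σ (blk l)) e))))
          by l (yes ≡.refl) (no ¬e)      = ≡.cong one-if (≡.sym (≡.trans (chosen-hyperplane p) (≡.cong not (does-false (l Fin.≟ σ (blk l)) ¬e))))

      chosen-in-κ : ∀ a → ∣ chosen-in a ∣ ≡ κ a
      chosen-in-κ a = ≡.trans (chosen-in-size a) (count-κ a (isLine a) ≡.refl)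

      chosen-κ : Vec.sum (tabulate κ) ≡ ∣ chosen ∣
      chosen-κ = ≡.trans (vec-sum κ) (≡.trans (sum-cong κ count (λ a → ≡.sym (count-κ a (isLine a) ≡.refl)))
        (≡.trans (sum-fibres blk (one-if ∘ lookup chosen)) (≡.sym (size-sum chosen))))

    κ-sum : Vec.sum (tabulate κ) ≡ k
    κ-sum = ≡.trans (chosen-κ σ₀ blk-σ₀) (chosen-size σ₀ blk-σ₀)

    extend-by : ∀ {a l} → Dec (l ∈ₛ J a) → (Elements (J a) → 𝕂) → 𝕂
    extend-by {l = l} (yes p) u = u (l , p)
    extend-by         (no _)  u = 0#

    -- Extension by zero lets `Condition`, which concerns vectors over all of `Fin n`, describe
    -- subspaces of a single block.
    extend : ∀ {a} → (Elements (J a) → 𝕂) → Fin n → 𝕂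
    extend {a} u l = extend-by (l Subset.∈? J a) u

    extend-in : ∀ {a} (u : Elements (J a) → 𝕂) l p → extend u l ≈ u (l , p)
    extend-in {a} u l p = by (l Subset.∈? J a)
      where
      by : ∀ d → extend-by d u ≈ u (l , p)
      by (yes q) = reflexive (≡.cong (λ q → u (l , q)) ([]=-irrelevant q p))
      by (no ¬p) = contradiction p ¬p

    extend-out : ∀ {a} (u : Elements (J a) → 𝕂) l → blk l ≢ a → extend u l ≈ 0#
    extend-out {a} u l ≢a = by (l Subset.∈? J a)
      where
      by : ∀ d → extend-by d u ≈ 0#
      by (yes q) = contradiction (J⇒blk (∈⇒lookup q)) ≢a
      by (no _)  = refl

    condition-local : ∀ b a {y y′ v v′} → (∀ l → blk l ≡ a → y l ≈ y′ l) → (∀ l → blk l ≡ a → v l ≈ v′ l) →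
      Condition b a y v → Condition b a y′ v′
    condition-local true a e e′ h l l′ p p′ = trans (*-cong (sym (e l p)) (sym (e′ l′ p′)))
      (trans (h l l′ p p′) (*-cong (e l′ p′) (e′ l p)))
    condition-local false a {y} {y′} {v} {v′} e e′ h = trans (sum-cong-≋ (λ l → by l (blk l Fin.≟ a))) h
      where
      by : ∀ l (d : Dec (blk l ≡ a)) → (y′ l * v′ l) when d ≈ (y l * v l) when d
      by l (yes p) = *-cong (sym (e l p)) (sym (e′ l p))
      by l (no _)  = refl

    BlockSpace : (Fin n → 𝕂) → ∀ a → Pred (Elements (J a) → 𝕂) 0ℓ
    BlockSpace y a u = Condition (isLine a) a y (extend u)

    extend-restrict : ∀ a (v : Fin n → 𝕂) l → blk l ≡ a → v l ≈ extend (restrict (J a) v) l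
    extend-restrict a v l p = sym (extend-in (restrict (J a) v) l (lookup⇒∈ (blk⇒J p)))

    restrict-blocks : ∀ y v → v ∈ Space y ⇔ (∀ a → BlockSpace y a (restrict (J a) v))
    restrict-blocks y v = mk⇔
      (λ v∈ a → condition-local (isLine a) a (λ _ _ → refl) (extend-restrict a v) (v∈ a))
      (λ h a → condition-local (isLine a) a (λ _ _ → refl) (λ l p → sym (extend-restrict a v l p)) (h a))

    module _ (y : Fin n → 𝕂) (σ : Fin r → Fin n) (blk-σ : ∀ a → blk (σ a) ≡ a) (yσ≉0 : ∀ a → y (σ a) ≉ 0#) where
      open Section σ blk-σ
      open Reduced (Space-reduced y yσ≉0)

      -- A vector of the block that satisfies the condition is determined by its coordinates at the
      -- chosen indices of the block, where the restricted rows form the identity matrix.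
      BlockSpace-dimension : ∀ a → HasDimension (BlockSpace y a) (κ a)
      BlockSpace-dimension a = ≡.subst (HasDimension (BlockSpace y a)) (chosen-in-κ σ blk-σ a) (record
        { basis = λ i → restrict (J a) (row (e i))
        ; independent = λ c z j → trans (sym (at c j)) (z (e j , e∈J j))
        ; spans = λ u → mk⇔
            (λ u∈ → (λ i → u (e i , e∈J i)) , λ { (l , p) → spanned u u∈ l p })
            (λ (c , z) → condition-local (isLine a) a (λ _ _ → refl)
              (λ l p → sym (trans (extend-in u l (lookup⇒∈ (blk⇒J p))) (z _)))
              (Space-closed y c (row ∘ e) (λ i → row∈ (e i)) _ (λ _ → refl) a)) })
        where
        T = chosen-in σ blk-σ a
        e : Fin ∣ T ∣ → Fin n
        e = elements T
        e-blk : ∀ i → blk (e i) ≡ a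
        e-blk i = proj₁ (chosen-in⇒ σ blk-σ {a} {e i} (elements∈ T i))
        e-chosen : ∀ i → lookup chosen (e i) ≡ true
        e-chosen i = proj₂ (chosen-in⇒ σ blk-σ {a} {e i} (elements∈ T i))
        e∈J : ∀ i → e i ∈ₛ J a
        e∈J i = lookup⇒∈ (blk⇒J (e-blk i))
        at : ∀ c j → combination c (row ∘ e) (e j) ≈ c j
        at c j = trans (sum-cong-≋ (λ i → *-congˡ {c i} (trans (row-δ _ _ (e-chosen i) (e-chosen j)) (δ-elements T i j)))) (sum-δ c j)
        spanned : ∀ u → BlockSpace y a u → ∀ l p → u (l , p) ≈ combination (λ i → u (e i , e∈J i)) (row ∘ e) l
        spanned u u∈ l p = trans (sym (extend-in u l p)) (x-y≈0⇒x≈y (condition-determined y yσ≉0 (isLine a) a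
            (λ l → extend u l - w l) ≡.refl d∈ (λ l l∈ → by l l∈ (blk l Fin.≟ a)) l (J⇒blk (∈⇒lookup p))))
          where
          c : Fin ∣ T ∣ → 𝕂
          c i = u (e i , e∈J i)
          w = combination c (row ∘ e)
          d∈ : Condition (isLine a) a y (λ l → extend u l - w l)
          d∈ = closed-difference {W = Condition (isLine a) a y} (λ c u u∈ v e → condition-closed (isLine a) a y c u u∈ v e) u∈
            (Space-closed y c (row ∘ e) (λ i → row∈ (e i)) w (λ _ → refl) a)
          by : ∀ l → lookup chosen l ≡ true → Dec (blk l ≡ a) → extend u l - w l ≈ 0#
          by l l∈ (yes p) = let (j , ej≡l) = elements-surjective T l (⇒chosen-in σ blk-σ p l∈) in
            ≡.subst (λ l → extend u l - w l ≈ 0#) ej≡l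
              (trans (+-cong (extend-in u (e j) (e∈J j)) (-‿cong (at c j))) (-‿inverseʳ _))
          by l l∈ (no ¬p) = trans (+-cong (extend-out u l ¬p) (-‿cong (sum-zero {f = λ i → c i * row (e i) l}
              (λ i → *0≈0 (row-off (e i) l l∈ (λ ei≡l → ¬p (≡.trans (≡.cong blk (≡.sym ei≡l)) (e-blk i))))))))
            (-‿inverseʳ 0#)

    space⇒product : ∀ Y → IsSpace Y → ProductOfGrassmannians J κ Y
    space⇒product Y (z , good σ blk-σ zσ≉0 , Y⊆ , ⊆Y) =
      (λ a → record { subspace = BlockSpace (z ⊙ x) a
                    ; dimension = BlockSpace-dimension (z ⊙ x) σ blk-σ (λ a → *-≉0 (zσ≉0 a) (x≉0 (σ a))) a }) ,
      (λ v → let open Equivalence (restrict-blocks (z ⊙ x) v) in mk⇔ (λ v∈ → to (Y⊆ v∈)) (λ h → ⊆Y (from h)))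

    Equation : ∀ a → Pred (Elements (J a) → 𝕂) 0ℓ → Set
    Equation a W = Σ[ y ∈ (Fin n → 𝕂) ] (∃[ l ] blk l ≡ a × y l ≉ 0#) × (∀ {u} → u ∈ W → BlockSpace y a u)

    private
      line-equation : ∀ a → {W : Pred (Elements (J a) → 𝕂) 0ℓ} → HasDimension W 1 →
        Σ[ y ∈ (Fin n → 𝕂) ] (∃[ l ] blk l ≡ a × y l ≉ 0#) × (∀ {u} → u ∈ W → OnLine a y (extend u))
      line-equation a {W} H = extend u₀ , nonzero-at , λ {u} u∈ → on-line u (Equivalence.to (spans u) u∈)
        where
        open HasDimension H using (independent; spans) renaming (basis to b)
        u₀ = b zero
        nonzero-at : ∃[ l ] blk l ≡ a × extend u₀ l ≉ 0#
        nonzero-at = by (em _)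
          where
          by : Dec (∃[ l ] blk l ≡ a × extend u₀ l ≉ 0#) → ∃[ l ] blk l ≡ a × extend u₀ l ≉ 0#
          by (yes p) = p
          by (no ¬p) = contradiction (independent (λ _ → 1#) (λ { (l , p) → trans (+-identityʳ _) (trans (*-identityˡ _)
            (trans (sym (extend-in u₀ l p)) (by-contradiction (λ ≉0 → ¬p (l , J⇒blk (∈⇒lookup p) , ≉0))))) }) zero) 1≉0
        on-line : ∀ u → ∃[ c ] u ≋ combination c b → OnLine a (extend u₀) (extend u)
        on-line u (c , e) l l′ p p′ = trans (*-congˡ (val l′ p′)) (trans
          (solve 3 (λ x c y → x :* (c :* y) := y :* (c :* x)) refl (extend u₀ l) (c zero) (extend u₀ l′)) (*-congˡ (sym (val l p))))
          where
          val : ∀ l → blk l ≡ a → extend u l ≈ c zero * extend u₀ l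
          val l p = let l∈ = lookup⇒∈ (blk⇒J p) in trans (extend-in u l l∈)
            (trans (e (l , l∈)) (trans (+-identityʳ _) (*-congˡ (sym (extend-in u₀ l l∈)))))

      -- Evaluated on a basis of `W`, the coordinate functions of the block become vectors with one
      -- entry fewer than their number; a relation between them is a nonzero equation satisfied by
      -- `W`.
      hyperplane-equation : ∀ a → {W : Pred (Elements (J a) → 𝕂) 0ℓ} → HasDimension W (∣ J a ∣ ∸ 1) →
        Σ[ y ∈ (Fin n → 𝕂) ] (∃[ l ] blk l ≡ a × y l ≉ 0#) × (∀ {u} → u ∈ W → OnHyperplane a y (extend u))
      hyperplane-equation a {W} H = extend y , (e q , e-blk q , ≉0-cong (sym (y-e q)) (proj₂ (proj₁ (proj₂ relation)))) , λ {u} → on-hyperplane u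
        where
        open HasDimension H using (spans) renaming (basis to b)
        e = elements (J a)
        e-blk : ∀ q → blk (e q) ≡ a
        e-blk q = J⇒blk (elements∈ (J a) q)
        pt : Fin ∣ J a ∣ → Elements (J a)
        pt q = e q , lookup⇒∈ (elements∈ (J a) q)
        smaller : ∣ J a ∣ ∸ 1 ℕ.< ∣ J a ∣
        smaller = by (proj₁ (elements-surjective (J a) (σ₀ a) (blk⇒J (blk-σ₀ a))))
          where
          by : ∀ {m} → Fin m → m ∸ 1 ℕ.< m
          by {suc m} _ = ℕ.≤-refl
        relation = dependent smaller (λ q j → b j (pt q))
        c = proj₁ relation
        q = proj₁ (proj₁ (proj₂ relation))
        y : Elements (J a) → 𝕂
        y (l , p) = c (proj₁ (elements-surjective (J a) l (∈⇒lookup p)))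
        y-e : ∀ q → extend y (e q) ≈ c q
        y-e q = trans (extend-in y (e q) (lookup⇒∈ (elements∈ (J a) q)))
          (reflexive (≡.cong c (elements-injective (J a) (proj₂ (elements-surjective (J a) (e q) _)))))
        on-hyperplane : ∀ u → u ∈ W → OnHyperplane a (extend y) (extend u)
        on-hyperplane u u∈ = begin
          sum (λ l → (extend y l * extend u l) when (blk l Fin.≟ a))
            ≈⟨ sum-elements (J a) (λ l → (extend y l * extend u l) when (blk l Fin.≟ a))
                 (λ l l∉ → when-no (blk l Fin.≟ a) (λ p → true≢false (blk⇒J p) l∉)) ⟨
          sum (λ q → (extend y (e q) * extend u (e q)) when (blk (e q) Fin.≟ a))
            ≈⟨ sum-cong-≋ (λ q → trans (when-yes (blk (e q) Fin.≟ a) (e-blk q)) (*-cong (y-e q)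
                 (trans (extend-in u (e q) (proj₂ (pt q))) (proj₂ c′ (pt q))))) ⟩
          combination c (λ q _ → combination (proj₁ c′) b (pt q)) tt
            ≈⟨ sum-cong-≋ (λ q → trans (*-distribˡ-sum (c q) (λ j → proj₁ c′ j * b j (pt q)))
                 (sum-cong-≋ (λ j → solve 3 (λ c d b → c :* (d :* b) := d :* (c :* b)) refl (c q) (proj₁ c′ j) (b j (pt q))))) ⟩
          sum (λ q → sum (λ j → proj₁ c′ j * (c q * b j (pt q))))
            ≈⟨ ∑-comm (λ q j → proj₁ c′ j * (c q * b j (pt q))) ⟩
          sum (λ j → sum (λ q → proj₁ c′ j * (c q * b j (pt q))))
            ≈⟨ sum-zero (λ j → trans (sym (*-distribˡ-sum (proj₁ c′ j) (λ q → c q * b j (pt q))))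
                 (*0≈0 (proj₂ (proj₂ relation) j))) ⟩
          0# ∎
          where
          open ≈-Reasoning
          c′ = Equivalence.to (spans u) u∈

    equation : ∀ a {W} → HasDimension W (κ a) → Equation a W
    equation a {W} = by (isLine a)
      where
      by : ∀ b → HasDimension W (κ-by b ∣ J a ∣) →
        Σ[ y ∈ (Fin n → 𝕂) ] (∃[ l ] blk l ≡ a × y l ≉ 0#) × (∀ {u} → u ∈ W → Condition b a y (extend u))
      by true  = line-equation a
      by false = hyperplane-equation a

    -- The equations of the factors are glued to one `y`. Each factor is first seen to lie in the
    -- space of its equation, and equal dimensions give equality.
    product⇒space : ∀ Y → ProductOfGrassmannians J κ Y → IsSpace Y
    product⇒space Y (Xs , sums) = isSpace Y σ blk-σ y yσ≉0
        ( (λ {v} v∈ → Equivalence.from (restrict-blocks y v) (λ a → ⊆Block a (Equivalence.to (sums v) v∈ a)))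
        , (λ {v} v∈ → Equivalence.from (sums v) (λ a → equal-dimension-⊆ (dimension (Xs a)) (BlockSpace-dimension y σ blk-σ yσ≉0 a)
            (⊆Block a) (Equivalence.to (restrict-blocks y v) v∈ a))) )
      where
      E : ∀ a → Equation a (subspace (Xs a))
      E a = equation a (dimension (Xs a))
      y : Fin n → 𝕂
      y l = proj₁ (E (blk l)) l
      σ : Fin r → Fin n
      σ a = proj₁ (proj₁ (proj₂ (E a)))
      blk-σ : ∀ a → blk (σ a) ≡ a
      blk-σ a = proj₁ (proj₂ (proj₁ (proj₂ (E a))))
      y-block : ∀ a l → blk l ≡ a → proj₁ (E a) l ≈ y l
      y-block _ l ≡.refl = refl
      yσ≉0 : ∀ a → y (σ a) ≉ 0#
      yσ≉0 a = ≉0-cong (y-block a (σ a) (blk-σ a)) (proj₂ (proj₂ (proj₁ (proj₂ (E a)))))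
      ⊆Block : ∀ a {u} → u ∈ subspace (Xs a) → BlockSpace y a u
      ⊆Block a u∈ = condition-local (isLine a) a (y-block a) (λ _ _ → refl) (proj₂ (proj₂ (E a)) u∈)

    closure≐product : OrbitClosure X ≐ ProductOfGrassmannians J κ
    closure≐product = (λ {Y} Y∈ → space⇒product Y (closure⇒space Y Y∈)) , (λ {Y} Y∈ → space⇒closure Y (product⇒space Y Y∈))

-- The isomorphism with projective spaces: Segre map and its charts.

module StarIsomorphism {K : CommutativeRing 0ℓ 0ℓ} (F : ClassicalField K) where
  open StarProducts F public

  enumerate : ∀ {n N} (S : Subset n) → ∣ S ∣ ≡ N → Fin N → Fin n
  enumerate S ≡.refl = elements S

  enumerate∈ : ∀ {n N} (S : Subset n) (e : ∣ S ∣ ≡ N) i → lookup S (enumerate S e i) ≡ true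
  enumerate∈ S ≡.refl = elements∈ S

  enumerate-surjective : ∀ {n N} (S : Subset n) (e : ∣ S ∣ ≡ N) l → lookup S l ≡ true → ∃[ i ] enumerate S e i ≡ l
  enumerate-surjective S ≡.refl = elements-surjective S

  enumerate-injective : ∀ {n N} (S : Subset n) (e : ∣ S ∣ ≡ N) {i j} → enumerate S e i ≡ enumerate S e j → i ≡ j
  enumerate-injective S ≡.refl = elements-injective S

  evalMonomial-tabulate : ∀ {r m} {I : Fin r → Set} (h : Fin m → Var I) (x : ∀ a → I a → 𝕂) →
    evalMonomial (List.tabulate h) x ≈ prod (λ b → x (proj₁ (h b)) (proj₂ (h b)))
  evalMonomial-tabulate {m = zero}  h x = refl
  evalMonomial-tabulate {m = suc m} h x = *-congˡ (evalMonomial-tabulate (h ∘ suc) x)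

  multidegree-tabulate : ∀ {r m} {I : Fin r → Set} (h : Fin m → Var I) a →
    multidegree (List.tabulate h) a ≡ Sum.sum ℕ.+-*-semiring (λ b → Counting.within 1 (proj₁ (h b) Fin.≟ a))
  multidegree-tabulate {m = zero}  h a = ≡.refl
  multidegree-tabulate {m = suc m} h a with proj₁ (h zero) Fin.≟ a
  ... | yes _ = ≡.cong suc (multidegree-tabulate (h ∘ suc) a)
  ... | no  _ = multidegree-tabulate (h ∘ suc) a

  module _ {k n : ℕ} (X : Gr k (Fin n)) (star : Star X) where
    open OnStarProduct X star

    m : Fin r → ℕ
    m a = ∣ J a ∣ ∸ 1

    J-size : ∀ a → ∣ J a ∣ ≡ suc (m a)
    J-size a = by (proj₁ (elements-surjective (J a) (σ₀ a) (blk⇒J (blk-σ₀ a))))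
      where
      by : ∀ {N} → Fin N → N ≡ suc (N ∸ 1)
      by {suc N} _ = ≡.refl

    pt : ∀ a → Fin (suc (m a)) → Fin n
    pt a = enumerate (J a) (J-size a)

    blk-pt : ∀ a i → blk (pt a i) ≡ a
    blk-pt a i = J⇒blk (enumerate∈ (J a) (J-size a) i)

    index : ∀ a l → blk l ≡ a → ∃[ i ] pt a i ≡ l
    index a l p = enumerate-surjective (J a) (J-size a) l (blk⇒J p)

    P : Fin r → Set
    P a = Fin (suc (m a))

    locate : Fin n → Var P
    locate l = blk l , proj₁ (index (blk l) l ≡.refl)

    pt-locate : ∀ l → pt (proj₁ (locate l)) (proj₂ (locate l)) ≡ l
    pt-locate l = proj₂ (index (blk l) l ≡.refl)

    locate-pt : ∀ a i → locate (pt a i) ≡ (a , i)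
    locate-pt a i = by (blk-pt a i) (pt-locate (pt a i))
      where
      by : ∀ {a′ i′} → a′ ≡ a → pt a′ i′ ≡ pt a i → (a′ , i′) ≡ (a , i)
      by ≡.refl e = ≡.cong (a ,_) (enumerate-injective (J a) (J-size a) e)

    values : (∀ a → P a → 𝕂) → Fin n → 𝕂
    values c l = c (proj₁ (locate l)) (proj₂ (locate l))

    values-pt : ∀ c a i → values c (pt a i) ≡ c a i
    values-pt c a i = ≡.cong (λ v → c (proj₁ v) (proj₂ v)) (locate-pt a i)

    -- On a line the surviving factor belongs to the chosen index, on a hyperplane to the omitted
    -- one; in both cases this is the value of the section. Up to the nonzero coordinates of X, `Ψ`
    -- is thus the Segre embedding.
    ψ-chosen : ∀ z σ blk-σ → ψ blk isLine z (Section.chosen σ blk-σ) ≈ prod (z ∘ σ)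
    ψ-chosen z σ blk-σ = trans (prod-cong (λ l → trans (reflexive (≡.cong (λ b → ψ-factor blk isLine b (isLine (blk l)) (z l)) (lookup-chosen l)))
        (trans (by (isLine (blk l)) (does (l Fin.≟ σ (blk l))) (z l))
          (sym (prod-single (f l) (blk l) (λ a a≢ → off l a (λ e → a≢ (≡.trans (≡.sym (blk-σ a)) (≡.cong blk (≡.sym e))))))))))
      (trans (Π.∑-comm f) (prod-cong (λ a → trans (prod-single (λ l → f l a) (σ a) (λ l l≢ → off l a l≢))
        (reflexive (≡.cong (λ b → if b then z (σ a) else 1#) (does-true (σ a Fin.≟ σ a) ≡.refl))))))
      where
      open Section σ blk-σ
      f : Fin n → Fin r → 𝕂
      f l a = if does (l Fin.≟ σ a) then z l else 1#
      off : ∀ l a → l ≢ σ a → f l a ≈ 1#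
      off l a l≢ = reflexive (≡.cong (λ b → if b then z l else 1#) (does-false (l Fin.≟ σ a) l≢))
      by : ∀ p q x → ψ-factor blk isLine (chosen-by p q) p x ≈ (if q then x else 1#)
      by true  true  x = refl
      by true  false x = refl
      by false true  x = refl
      by false false x = refl

    Ψ-cong : ∀ {z z′} → z ≋ z′ → Ψ z ≋ Ψ z′
    Ψ-cong e I = *-congʳ (ψ-cong blk isLine e (proj₁ I))

    -- Changing the section in a single block isolates one coordinate of `z` up to the common factor
    -- `rest`; this inverts the Segre map where `z` is nonzero along `σ`.
    module Chart (σ : Fin r → Fin n) (blk-σ : ∀ a → blk (σ a) ≡ a) where

      neighbour : Fin n → KSubset k n
      neighbour l = Section.chosen (redirect σ blk-σ l) (blk-redirect σ blk-σ l) , chosen-size (redirect σ blk-σ l) (blk-redirect σ blk-σ l)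

      neighbour≉0 : ∀ l → plücker X (neighbour l) ≉ 0#
      neighbour≉0 l = chosen⇒plücker≉0 (redirect σ blk-σ l) (blk-redirect σ blk-σ l) (proj₂ (neighbour l))

      rest : Fin r → (Fin n → 𝕂) → 𝕂
      rest a z = prod (λ b → if does (b Fin.≟ a) then 1# else z (σ b))

      rest≉0 : ∀ a z → (∀ b → z (σ b) ≉ 0#) → rest a z ≉ 0#
      rest≉0 a z zσ≉0 = prod-≉0 (λ b → if-≉0 (does (b Fin.≟ a)) 1≉0 (zσ≉0 b))

      Ψ-neighbour : ∀ z a l → blk l ≡ a → Ψ z (neighbour l) ≈ (z l * rest a z) * plücker X (neighbour l)
      Ψ-neighbour z a l ≡.refl = *-congʳ (trans (ψ-chosen z σ′ (blk-redirect σ blk-σ l)) (trans (prod-extract (z ∘ σ′) (blk l))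
        (*-cong (reflexive (≡.cong z (redirect-new σ blk-σ l))) (prod-cong (λ b → by b (b Fin.≟ blk l))))))
        where
        σ′ = redirect σ blk-σ l
        by : ∀ b (d : Dec (b ≡ blk l)) → (if does d then 1# else z (σ′ b)) ≈ (if does d then 1# else z (σ b))
        by b (yes _) = refl
        by b (no b≢) = reflexive (≡.cong z (redirect-old σ blk-σ l b≢))

    Ψ-nonzero : ∀ {z} → Good z → ∃[ I ] Ψ z I ≉ 0#
    Ψ-nonzero {z} (good σ blk-σ zσ≉0) = (Section.chosen σ blk-σ , chosen-size σ blk-σ) ,
      *-≉0 (≉0-cong (sym (ψ-chosen z σ blk-σ)) (prod-≉0 zσ≉0)) (chosen⇒plücker≉0 σ blk-σ (chosen-size σ blk-σ))

    Ψ-injective : ∀ {z z′} → Good z → Ψ z ∝ Ψ z′ → ∀ a → (z ∘ pt a) ∝ (z′ ∘ pt a)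
    Ψ-injective {z} {z′} (good σ blk-σ zσ≉0) (c , c≉0 , e) a =
      ∝-cancel blk isLine σ blk-σ z (rest≉0 a z zσ≉0) (*-≉0 c≉0 rest′≉0) (λ i → equal (pt a i) (blk-pt a i))
      where
      open Chart σ blk-σ
      equal : ∀ l → blk l ≡ a → rest a z * z l ≈ (c * rest a z′) * z′ l
      equal l p = *-cancel (neighbour≉0 l) (begin
        q * (rest a z * z l)              ≈⟨ solve 3 (λ q r z → q :* (r :* z) := (z :* r) :* q) refl q (rest a z) (z l) ⟩
        (z l * rest a z) * q              ≈⟨ Ψ-neighbour z a l p ⟨
        Ψ z (neighbour l)                 ≈⟨ e (neighbour l) ⟩
        c * Ψ z′ (neighbour l)            ≈⟨ *-congˡ (Ψ-neighbour z′ a l p) ⟩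
        c * ((z′ l * rest a z′) * q)
          ≈⟨ solve 4 (λ c z r q → c :* ((z :* r) :* q) := q :* ((c :* r) :* z)) refl c (z′ l) (rest a z′) q ⟩
        q * ((c * rest a z′) * z′ l)      ∎)
        where
        open ≈-Reasoning
        q = plücker X (neighbour l)
      -- Obtained from the equation at `σ a`, whose left side is nonzero because `z` is nonzero
      -- along the section.
      rest′≉0 : rest a z′ ≉ 0#
      rest′≉0 = ≉0-factorʳ (≉0-factorˡ (≉0-cong (equal (σ a) (blk-σ a)) (*-≉0 (rest≉0 a z zσ≉0) (zσ≉0 a))))

    values-good : (q : Point P) → Good (values (coords q))
    values-good q = good (λ a → pt a (proj₁ (nonzero q a))) (λ a → blk-pt a _)
      (λ a → ≉0-cong (reflexive (≡.sym (values-pt (coords q) a _))) (proj₂ (nonzero q a)))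

    good-point : ∀ z → Good z → Point P
    good-point z (good σ blk-σ zσ≉0) = record
      { coords  = λ a → z ∘ pt a
      ; nonzero = λ a → let (i , e) = index a (σ a) (blk-σ a) in i , ≉0-cong (reflexive (≡.cong z (≡.sym e))) (zσ≉0 a) }

    private
      abstract
        at : (p : ∃ Z) → IsSpace (proj₁ (proj₂ p))
        at (p , Y , Y∈ , _) = closure⇒space Y Y∈

        at-∝ : (p : ∃ Z) → coords (proj₁ p) zero ∝ Ψ (proj₁ (at p))
        at-∝ p@(_ , Y , Y∈ , e) = ∝-trans e (space⇒plücker (proj₁ (proj₂ (at p))) Y (proj₂ (proj₂ (at p))))

      toP : ∃ Z → ∃ (ProjectiveSpaces m)
      toP p = good-point (proj₁ (at p)) (proj₁ (proj₂ (at p))) , tt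

      fromP : ∃ (ProjectiveSpaces m) → ∃ Z
      fromP (q , _) = point (Ψ z) (Ψ-nonzero g) , Y , space⇒closure Y (z , g , id , id) , ∝-sym (space⇒plücker g Y (id , id))
        where
        z = values (coords q)
        g = values-good q
        Y = spaceGr z g

      -- The block `a` of the image is read from the coordinates at the neighbours of the section
      -- found at `p`, each divided by that of X. At another point `q` these linear forms give the
      -- coordinates of its block times one common factor, nonzero as soon as one of the forms is.
      to-regularP : Regular Z (λ p → proj₁ (toP p))
      to-regularP p a = (λ _ → 1) , form , (λ j → (λ { zero → ≡.refl }) ∷ []) , (proj₁ i , nonzero-here) , λ q → proportional q
        where
        z = proj₁ (at p)
        open Good (proj₁ (proj₂ (at p)))
        open Chart σ blk-σ
        scale : P a → 𝕂
        scale j = plücker X (neighbour (pt a j)) ⁻¹[ neighbour≉0 (pt a j) ]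
        form : P a → Poly {1} (λ _ → KSubset k n)
        form j = (scale j , (zero , neighbour (pt a j)) ∷ []) ∷ []
        eval-form : ∀ (q : ∃ Z) j → eval (form j) (coords (proj₁ q)) ≈ (proj₁ (at-∝ q) * rest a (proj₁ (at q))) * proj₁ (at q) (pt a j)
        eval-form q j = begin
          scale j * (coords (proj₁ q) zero (neighbour (pt a j)) * 1#) + 0#
            ≈⟨ trans (+-identityʳ _) (*-congˡ (*-identityʳ _)) ⟩
          scale j * coords (proj₁ q) zero (neighbour (pt a j))
            ≈⟨ *-congˡ (trans (proj₂ (proj₂ (at-∝ q)) (neighbour (pt a j))) (*-congˡ (Ψ-neighbour z′ a (pt a j) (blk-pt a j)))) ⟩
          scale j * (c * ((z′ (pt a j) * rest a z′) * x′))
            ≈⟨ solve 5 (λ s c z r x → s :* (c :* ((z :* r) :* x)) := (x :* s) :* ((c :* r) :* z)) refl (scale j) c (z′ (pt a j)) (rest a z′) x′ ⟩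
          (x′ * scale j) * ((c * rest a z′) * z′ (pt a j))
            ≈⟨ 1*≈ (*-inv (neighbour≉0 (pt a j))) ⟩
          (c * rest a z′) * z′ (pt a j) ∎
          where
          open ≈-Reasoning
          c = proj₁ (at-∝ q)
          z′ = proj₁ (at q)
          x′ = plücker X (neighbour (pt a j))
        i = index a (σ a) (blk-σ a)
        nonzero-here : eval (form (proj₁ i)) (coords (proj₁ p)) ≉ 0#
        nonzero-here = ≉0-cong (sym (eval-form p (proj₁ i))) (*-≉0 (*-≉0 (proj₁ (proj₂ (at-∝ p))) (rest≉0 a z zσ≉0))
          (≉0-cong (reflexive (≡.cong z (≡.sym (proj₂ i)))) (zσ≉0 a)))
        proportional : (q : ∃ Z) → ∃[ j ] eval (form j) (coords (proj₁ q)) ≉ 0# →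
          (proj₁ (at q) ∘ pt a) ∝ (λ j → eval (form j) (coords (proj₁ q)))
        proportional q (j , ≉0) = ∝-sym (proj₁ (at-∝ q) * rest a (proj₁ (at q)) , ≉0-factorˡ (≉0-cong (eval-form q j) ≉0) , eval-form q)

      -- Monomials with one variable from each block. Sets that come from no section get the zero
      -- form, since X has a vanishing coordinate there.
      from-form : (T : KSubset k n) → Dec (Chosen (proj₁ T)) → Poly P
      from-form T (yes (σ , _)) = (plücker X T , List.tabulate (locate ∘ σ)) ∷ []
      from-form T (no _)        = []

      from-homogeneous : ∀ T d → Homogeneous (λ _ → 1) (from-form T d)
      from-homogeneous T (no _) = []
      from-homogeneous T (yes (σ , blk-σ , _)) = (λ a → ≡.trans (multidegree-tabulate (locate ∘ σ) a)
        (≡.trans (Counting.sum-cong (λ b → Counting.within 1 (blk (σ b) Fin.≟ a)) (λ b → Counting.within 1 (b Fin.≟ a))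
          (λ b → ≡.cong (λ c → Counting.within 1 (c Fin.≟ a)) (blk-σ b))) (Counting.sum-one a))) ∷ []

      from-eval : ∀ T d (c : ∀ a → P a → 𝕂) → eval (from-form T d) c ≈ Ψ (values c) T
      from-eval T (no ¬chosen) c = sym (*0≈0 (by-contradiction (λ ≉0 → ¬chosen (plücker≉0⇒chosen T ≉0))))
      from-eval T (yes (σ , blk-σ , e)) c = trans (+-identityʳ _) (trans (*-comm _ _) (*-congʳ (trans (evalMonomial-tabulate (locate ∘ σ) c)
        (trans (sym (ψ-chosen (values c) σ blk-σ)) (reflexive (≡.cong (ψ blk isLine (values c)) e))))))

      from-regularP : Regular (ProjectiveSpaces m) (λ q → proj₁ (fromP q))
      from-regularP q zero = (λ _ → 1) , (λ T → from-form T (em _)) , (λ T → from-homogeneous T (em _)) ,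
        (proj₁ nz , ≉0-cong (sym (from-eval (proj₁ nz) (em _) (coords (proj₁ q)))) (proj₂ nz)) ,
        λ q′ _ → ≋⇒∝ (λ T → sym (from-eval T (em _) (coords (proj₁ q′))))
        where
        nz = Ψ-nonzero (values-good (proj₁ q))

    closure≅projective-spaces : Plücker (OrbitClosure X) ≅ ProjectiveSpaces m
    closure≅projective-spaces = record
      { to = toP
      ; from = fromP
      ; to-regular = to-regularP
      ; from-regular = from-regularP
      ; from∘to = λ { p zero → ∝-sym (∝-trans (at-∝ p) (≋⇒∝ (Ψ-cong (λ l → reflexive (≡.cong (proj₁ (at p)) (≡.sym (pt-locate l))))))) }
      ; to∘from = λ q a → ∝-trans (Ψ-injective (proj₁ (proj₂ (at (fromP q)))) (∝-sym (at-∝ (fromP q))) a)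
          (≋⇒∝ (λ i → reflexive (values-pt (coords (proj₁ q)) a i))) }

-- Both conclusions over a classical field of characteristic zero.

module SmoothOrbitClosures {K : CommutativeRing 0ℓ 0ℓ} (F : ClassicalField K) where
  open StarIsomorphism F

  smooth-orbit-closure : (n k : ℕ) (X : Gr k (Fin n)) → Smooth (Plücker (OrbitClosure X)) →
    (∃[ r ] Σ[ J ∈ (Fin r → Subset n) ] Σ[ κ ∈ (Fin r → ℕ) ]
      (IsPartition J ×
       Vec.sum (tabulate κ) ≡ k ×
       (∀ i → κ i ≡ 0 ⊎ κ i ≡ 1 ⊎ κ i ≡ ∣ J i ∣ ∸ 1 ⊎ κ i ≡ ∣ J i ∣) ×
       OrbitClosure X ≐ ProductOfGrassmannians J κ)) ×
    (∃[ s ] Σ[ m ∈ (Fin s → ℕ) ]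
      Plücker (OrbitClosure X) ≅ ProjectiveSpaces m)
  smooth-orbit-closure n k X (d , _ , tangent) =
    (_ , J , κ , J-partition , κ-sum , κ-options , closure≐product) , (_ , m X X-star , closure≅projective-spaces X X-star)
    where
    X-star : Star X
    X-star = star X tangent (proj₂ (reduced-exists (X-closed X)))
    open OnStarProduct X X-star using (J; κ; J-partition; κ-sum; κ-options; closure≐product)

-- Inverses in K[i] by conjugation.

module GaussianInverse (K : CommutativeRing 0ℓ 0ℓ) where
  open CommutativeRing K
  open RingSolver K using (solve; _:=_; _:+_; _:*_; _:-_; :-_)
  open Gaussian K using (_+i_; _,_; _≈ᶜ_; _*ᶜ_)

  conjugate-inverse : ∀ a b c → (a * a + b * b) * c ≈ 1# → (a +i b) *ᶜ ((a * c) +i (- (b * c))) ≈ᶜ (1# +i 0#)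
  conjugate-inverse a b c e =
    trans (solve 3 (λ a b c → a :* (a :* c) :- b :* (:- (b :* c)) := (a :* a :+ b :* b) :* c) refl a b c) e ,
    trans (solve 3 (λ a b c → a :* (:- (b :* c)) :+ b :* (a :* c) := a :- a) refl a b c) (-‿inverseʳ a)

  module _ (inverse : ∀ x → ¬ x ≈ 0# → ∃[ y ] x * y ≈ 1#) (definite : ∀ x y → x * x + y * y ≈ 0# → x ≈ 0#) where

    gaussian-inverse : ∀ z → ¬ z ≈ᶜ (0# +i 0#) → ∃[ w ] z *ᶜ w ≈ᶜ (1# +i 0#)
    gaussian-inverse (a +i b) z≉0 =
      let (c , e) = inverse (a * a + b * b) (λ e → z≉0 (definite a b e , definite b a (trans (+-comm _ _) e))) in
      ((a * c) +i (- (b * c))) , conjugate-inverse a b c e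

-- The complex numbers as a classical field.

module ComplexField (em : (P : Set) → Dec P) where
  open ℝ
  module ℝ′ = CommutativeRing Reals.commutativeRing
  module ℚSolver = RingSolver ℚ.+-*-commutativeRing

  private
    *-mono-≤ : ∀ {p q r s} → 0ℚ ℚ.≤ q → 0ℚ ℚ.≤ r → p ℚ.≤ q → r ℚ.≤ s → p ℚ.* r ℚ.≤ q ℚ.* s
    *-mono-≤ {q = q} {r} 0≤q 0≤r p≤q r≤s = ℚ.≤-trans (ℚ.*-monoʳ-≤-nonNeg r {{ℚ.nonNegative 0≤r}} p≤q)
      (ℚ.*-monoˡ-≤-nonNeg q {{ℚ.nonNegative 0≤q}} r≤s)

    *-pos : ∀ {p q} → 0ℚ ℚ.< p → 0ℚ ℚ.< q → 0ℚ ℚ.< p ℚ.* q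
    *-pos {p} {q} 0<p 0<q = ≡.subst (ℚ._< p ℚ.* q) (ℚ.*-zeroʳ p) (ℚ.*-monoʳ-<-pos p {{ℚ.positive 0<p}} 0<q)

    half>0 : ∀ {ε} → 0ℚ ℚ.< ε → 0ℚ ℚ.< ½ ℚ.* ε
    half>0 = *-pos (ℚ.positive⁻¹ ½)

    halves : ∀ ε → ½ ℚ.* ε ℚ.+ ½ ℚ.* ε ≡ ε
    halves ε = ≡.trans (≡.sym (ℚ.*-distribʳ-+ ε ½ ½)) (ℚ.*-identityˡ ε)

    triangle : ∀ p q → ℚ.∣ p ∣ ℚ.≤ ℚ.∣ p ℚ.- q ∣ ℚ.+ ℚ.∣ q ∣
    triangle p q = ≡.subst (λ z → ℚ.∣ z ∣ ℚ.≤ ℚ.∣ p ℚ.- q ∣ ℚ.+ ℚ.∣ q ∣)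
      (ℚSolver.solve 2 (λ p q → (p ℚSolver.:- q) ℚSolver.:+ q ℚSolver.:= p) ≡.refl p q) (ℚ.∣p+q∣≤∣p∣+∣q∣ (p ℚ.- q) q)

    ∣-∣-swap : ∀ p q → ℚ.∣ p ℚ.- q ∣ ≡ ℚ.∣ q ℚ.- p ∣
    ∣-∣-swap p q = ≡.trans (≡.cong ℚ.∣_∣ (ℚSolver.solve 2 (λ p q → p ℚSolver.:- q ℚSolver.:= ℚSolver.:- (q ℚSolver.:- p)) ≡.refl p q))
      (ℚ.∣-p∣≡∣p∣ (q ℚ.- p))

    minus-0 : ∀ p → p ℚ.- 0ℚ ≡ p
    minus-0 p = ℚ.+-identityʳ p

    -- Total, with the value 0 at 0, so that the termwise inverse of a sequence is defined even
    -- before its terms are bounded away from zero.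
    inv : ℚ → ℚ
    inv q with q ℚ.≟ 0ℚ
    ... | yes _   = 0ℚ
    ... | no  q≢0 = (ℚ.1/ q) {{ℚ.≢-nonZero q≢0}}

    *-inv : ∀ q → q ≢ 0ℚ → q ℚ.* inv q ≡ 1ℚ
    *-inv q q≢0 with q ℚ.≟ 0ℚ
    ... | yes e   = contradiction e q≢0
    ... | no  q≢0 = ℚ.*-inverseʳ q {{ℚ.≢-nonZero q≢0}}

    ≢0 : ∀ {ε q} → 0ℚ ℚ.< ε → ε ℚ.≤ ℚ.∣ q ∣ → q ≢ 0ℚ
    ≢0 0<ε ε≤ ≡.refl = ℚ.<-irrefl ≡.refl (ℚ.<-≤-trans 0<ε ε≤)

    -- From `(inv a - inv b) * (a * b) = b - a`, where the product `a * b` is at least `ε * ε` in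
    -- absolute value; hence the precision `η * (ε * ε)`.
    inv-close : ∀ {ε η a b} → 0ℚ ℚ.< ε → 0ℚ ℚ.< η → ε ℚ.≤ ℚ.∣ a ∣ → ε ℚ.≤ ℚ.∣ b ∣ →
      ℚ.∣ a ℚ.- b ∣ ℚ.< η ℚ.* (ε ℚ.* ε) → ℚ.∣ inv a ℚ.- inv b ∣ ℚ.< η
    inv-close {ε} {η} {a} {b} 0<ε 0<η ε≤a ε≤b close = ℚ.≰⇒> (λ η≤d → ℚ.<-irrefl ≡.refl (ℚ.<-≤-trans close (below η≤d)))
      where
      d = inv a ℚ.- inv b
      product : d ℚ.* (a ℚ.* b) ≡ b ℚ.- a
      product = ≡.trans (ℚSolver.solve 4 (λ x y a b → (x ℚSolver.:- y) ℚSolver.:* (a ℚSolver.:* b) ℚSolver.:=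
          b ℚSolver.:* (a ℚSolver.:* x) ℚSolver.:- a ℚSolver.:* (b ℚSolver.:* y)) ≡.refl (inv a) (inv b) a b)
        (≡.cong₂ ℚ._-_ (≡.trans (≡.cong (b ℚ.*_) (*-inv a (≢0 0<ε ε≤a))) (ℚ.*-identityʳ b))
                       (≡.trans (≡.cong (a ℚ.*_) (*-inv b (≢0 0<ε ε≤b))) (ℚ.*-identityʳ a)))
      absolute : ℚ.∣ d ∣ ℚ.* (ℚ.∣ a ∣ ℚ.* ℚ.∣ b ∣) ≡ ℚ.∣ a ℚ.- b ∣
      absolute = ≡.trans (≡.cong (ℚ.∣ d ∣ ℚ.*_) (≡.sym (ℚ.∣p*q∣≡∣p∣*∣q∣ a b))) (≡.trans (≡.sym (ℚ.∣p*q∣≡∣p∣*∣q∣ d (a ℚ.* b)))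
        (≡.trans (≡.cong ℚ.∣_∣ product) (∣-∣-swap b a)))
      below : η ℚ.≤ ℚ.∣ d ∣ → η ℚ.* (ε ℚ.* ε) ℚ.≤ ℚ.∣ a ℚ.- b ∣
      below η≤d = ≡.subst (η ℚ.* (ε ℚ.* ε) ℚ.≤_) absolute
        (*-mono-≤ (ℚ.0≤∣p∣ d) (ℚ.<⇒≤ (*-pos 0<ε 0<ε)) η≤d (*-mono-≤ (ℚ.0≤∣p∣ a) (ℚ.<⇒≤ 0<ε) ε≤a ε≤b))

  BoundedAway : ℝ → Set
  BoundedAway x = ∃[ ε ] 0ℚ ℚ.< ε × ∃[ N ] (∀ n → N ℕ.≤ n → ε ℚ.≤ ℚ.∣ seq x n ∣)

  -- Take a Cauchy index for a quarter of `ε`. If the term there were at least half of `ε`, all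
  -- later terms would be at least a quarter of it; so a sequence not bounded away stays below three
  -- quarters of `ε` and is null.
  nonzero⇒bounded-away : ∀ x → ¬ x ℝ′.≈ ℝ′.0# → BoundedAway x
  nonzero⇒bounded-away x x≉0 = by (em (BoundedAway x))
    where
    by : Dec (BoundedAway x) → BoundedAway x
    by (yes p) = p
    by (no ¬p) = contradiction (Reals.mk≈ (λ ε 0<ε → small ε 0<ε (cauchy x (½ ℚ.* (½ ℚ.* ε)) (half>0 (half>0 0<ε))))) x≉0
      where
      small : ∀ ε → 0ℚ ℚ.< ε →
        ∃[ N ] (∀ m n → N ℕ.≤ m → N ℕ.≤ n → ℚ.∣ seq x m ℚ.- seq x n ∣ ℚ.< ½ ℚ.* (½ ℚ.* ε)) →
        ∃[ N ] (∀ n → N ℕ.≤ n → ℚ.∣ seq x n ℚ.- 0ℚ ∣ ℚ.< ε)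
      small ε 0<ε (N , close) = N , λ n N≤n → ≡.subst (λ z → ℚ.∣ z ∣ ℚ.< ε) (≡.sym (minus-0 (seq x n)))
          (ℚ.≤-<-trans (triangle (seq x n) (seq x N)) (ℚ.<-trans
            (ℚ.+-mono-< {ℚ.∣ seq x n ℚ.- seq x N ∣} {½ ℚ.* δ} {ℚ.∣ seq x N ∣} {δ} (close n N N≤n ℕ.≤-refl) (ℚ.≰⇒> large))
            (≡.subst (½ ℚ.* δ ℚ.+ δ ℚ.<_) (halves ε) (ℚ.+-monoˡ-< δ half-δ))))
        where
        δ = ½ ℚ.* ε
        half-δ : ½ ℚ.* δ ℚ.< δ
        half-δ = ≡.subst₂ ℚ._<_ (ℚ.+-identityʳ (½ ℚ.* δ)) (halves δ) (ℚ.+-monoʳ-< (½ ℚ.* δ) (half>0 (half>0 0<ε)))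
        large : ¬ δ ℚ.≤ ℚ.∣ seq x N ∣
        large δ≤ = ¬p (½ ℚ.* δ , half>0 (half>0 0<ε) , N , λ n N≤n → ℚ.≮⇒≥ (λ below → ℚ.<-irrefl ≡.refl
          (ℚ.≤-<-trans (ℚ.≤-trans δ≤ (triangle (seq x N) (seq x n)))
            (≡.subst (ℚ.∣ seq x N ℚ.- seq x n ∣ ℚ.+ ℚ.∣ seq x n ∣ ℚ.<_) (halves δ)
              (ℚ.+-mono-< {ℚ.∣ seq x N ℚ.- seq x n ∣} {½ ℚ.* δ} {ℚ.∣ seq x n ∣} {½ ℚ.* δ} (close N n ℕ.≤-refl N≤n) below)))))

  ℝ-inverse : ∀ x → ¬ x ℝ′.≈ ℝ′.0# → ∃[ y ] x ℝ′.* y ℝ′.≈ ℝ′.1#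
  ℝ-inverse x x≉0 = by (nonzero⇒bounded-away x x≉0)
    where
    by : BoundedAway x → ∃[ y ] x ℝ′.* y ℝ′.≈ ℝ′.1#
    by (ε , 0<ε , N , away) = y , Reals.mk≈ λ η 0<η → N , λ n N≤n →
        ≡.subst (λ z → ℚ.∣ z ℚ.- 1ℚ ∣ ℚ.< η) (≡.sym (*-inv (seq x n) (≢0 0<ε (away n N≤n)))) 0<η
      where
      y : ℝ
      y = mkℝ (λ n → inv (seq x n)) (λ η 0<η → let (M , close) = cauchy x (η ℚ.* (ε ℚ.* ε)) (*-pos 0<η (*-pos 0<ε 0<ε)) in
        N ℕ.⊔ M , λ m n ≤m ≤n → inv-close 0<ε 0<η (away m (ℕ.m⊔n≤o⇒m≤o N M ≤m)) (away n (ℕ.m⊔n≤o⇒m≤o N M ≤n))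
          (close m n (ℕ.m⊔n≤o⇒n≤o N M ≤m) (ℕ.m⊔n≤o⇒n≤o N M ≤n)))

  -- A rational square is bounded by the sum of two squares, so precision `ε * ε` for the sum gives
  -- `ε` for `x`.
  sum-of-squares-zero : ∀ x y → x ℝ′.* x ℝ′.+ y ℝ′.* y ℝ′.≈ ℝ′.0# → x ℝ′.≈ ℝ′.0#
  sum-of-squares-zero x y e = Reals.mk≈ (λ ε 0<ε → let (N , close) = Reals.close e (ε ℚ.* ε) (*-pos 0<ε 0<ε) in
      N , λ n N≤n → ≡.subst (λ z → ℚ.∣ z ∣ ℚ.< ε) (≡.sym (minus-0 (seq x n)))
        (root ε (seq x n) (seq y n) 0<ε (≡.subst (λ z → ℚ.∣ z ∣ ℚ.< ε ℚ.* ε) (minus-0 _) (close n N≤n))))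
    where
    0≤square : ∀ a → 0ℚ ℚ.≤ a ℚ.* a
    0≤square a = nonneg (ℚ.∣p∣≡p∨∣p∣≡-p a)
      where
      squared : 0ℚ ℚ.≤ ℚ.∣ a ∣ ℚ.* ℚ.∣ a ∣
      squared = *-mono-≤ {0ℚ} {_} {0ℚ} (ℚ.0≤∣p∣ a) ℚ.≤-refl (ℚ.0≤∣p∣ a) (ℚ.0≤∣p∣ a)
      nonneg : ℚ.∣ a ∣ ≡ a ⊎ ℚ.∣ a ∣ ≡ ℚ.- a → 0ℚ ℚ.≤ a ℚ.* a
      nonneg (inj₁ p) = ≡.subst (λ z → 0ℚ ℚ.≤ z ℚ.* z) p squared
      nonneg (inj₂ p) = ≡.subst (0ℚ ℚ.≤_) (ℚSolver.solve 1 (λ a → (ℚSolver.:- a) ℚSolver.:* (ℚSolver.:- a) ℚSolver.:= a ℚSolver.:* a) ≡.refl a)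
        (≡.subst (λ z → 0ℚ ℚ.≤ z ℚ.* z) p squared)
    square : ∀ a → a ℚ.* a ≡ ℚ.∣ a ∣ ℚ.* ℚ.∣ a ∣
    square a = ≡.trans (≡.sym (ℚ.0≤p⇒∣p∣≡p (0≤square a))) (ℚ.∣p*q∣≡∣p∣*∣q∣ a a)
    root : ∀ ε a b → 0ℚ ℚ.< ε → ℚ.∣ a ℚ.* a ℚ.+ b ℚ.* b ∣ ℚ.< ε ℚ.* ε → ℚ.∣ a ∣ ℚ.< ε
    root ε a b 0<ε close = ℚ.≰⇒> (λ ε≤a → ℚ.<-irrefl ≡.refl (ℚ.≤-<-trans (begin
        ε ℚ.* ε                                              ≤⟨ *-mono-≤ (ℚ.0≤∣p∣ a) (ℚ.<⇒≤ 0<ε) ε≤a ε≤a ⟩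
        ℚ.∣ a ∣ ℚ.* ℚ.∣ a ∣                                  ≡⟨ square a ⟨
        a ℚ.* a                                              ≡⟨ ℚ.+-identityʳ (a ℚ.* a) ⟨
        a ℚ.* a ℚ.+ 0ℚ                                       ≤⟨ ℚ.+-monoʳ-≤ (a ℚ.* a) (0≤square b) ⟩
        a ℚ.* a ℚ.+ b ℚ.* b                                  ≡⟨ ℚ.0≤p⇒∣p∣≡p (ℚ.+-mono-≤ {0ℚ} {_} {0ℚ} (0≤square a) (0≤square b)) ⟨
        ℚ.∣ a ℚ.* a ℚ.+ b ℚ.* b ∣                            ∎) close))
      where open ℚ.≤-Reasoning

  module ℂ′ = CommutativeRing ℂ

  ℂ-inverse : ∀ z → ¬ z ℂ′.≈ ℂ′.0# → ∃[ w ] z ℂ′.* w ℂ′.≈ ℂ′.1#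
  ℂ-inverse = GaussianInverse.gaussian-inverse Reals.commutativeRing ℝ-inverse sum-of-squares-zero

  -- All terms of the real part of a positive multiple of one are at least 1, so none is closer to 0
  -- than 1.
  ℂ-char0 : ∀ n → ¬ Mult._×_ ℂ′.semiring (suc n) ℂ′.1# ℂ′.≈ ℂ′.0#
  ℂ-char0 n e = ℚ.<-irrefl ≡.refl (ℚ.≤-<-trans (at-least-one N) (≡.subst (λ z → ℚ.∣ z ∣ ℚ.< 1ℚ) (minus-0 _) (close N ℕ.≤-refl)))
    where
    real-part : ℕ → ℕ → ℚ
    real-part n = seq (Gaussian.re (Mult._×_ ℂ′.semiring n ℂ′.1#))
    nonneg : ∀ n k → 0ℚ ℚ.≤ real-part n k
    nonneg zero    k = ℚ.≤-refl
    nonneg (suc n) k = ℚ.≤-trans (nonneg n k) (≡.subst (ℚ._≤ 1ℚ ℚ.+ real-part n k) (ℚ.+-identityˡ _)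
      (ℚ.+-monoˡ-≤ (real-part n k) (ℚ.<⇒≤ (ℚ.positive⁻¹ 1ℚ))))
    at-least-one : ∀ k → 1ℚ ℚ.≤ ℚ.∣ real-part (suc n) k ∣
    at-least-one k = ℚ.≤-trans (≡.subst (ℚ._≤ 1ℚ ℚ.+ real-part n k) (ℚ.+-identityʳ 1ℚ) (ℚ.+-monoʳ-≤ 1ℚ (nonneg n k)))
      (ℚ.≤-reflexive (≡.sym (ℚ.0≤p⇒∣p∣≡p (nonneg (suc n) k))))
    zero-real = Reals.close (Gaussian._≈ᶜ_.re≈ e) 1ℚ (ℚ.positive⁻¹ 1ℚ)
    N = proj₁ zero-real
    close = proj₂ zero-real

  complexField : ClassicalField ℂ
  complexField = record { inverse = ℂ-inverse ; char0 = ℂ-char0 ; em = em }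

open import Defs

theoremA : ExcludedMiddle (Level.suc 0ℓ) →
    (n k : ℕ) → 1 ≤ n → k ≤ n →
    (X : Gr k (Fin n)) →
    Smooth (Plücker (OrbitClosure X)) →
    (∃[ r ] Σ[ J ∈ (Fin r → Subset n) ] Σ[ κ ∈ (Fin r → ℕ) ]
    (IsPartition J ×
    Vec.sum (tabulate κ) ≡ k ×
    (∀ i → κ i ≡ 0 ⊎ κ i ≡ 1 ⊎ κ i ≡ ∣ J i ∣ ∸ 1 ⊎ κ i ≡ ∣ J i ∣) ×
    OrbitClosure X ≐ ProductOfGrassmannians J κ)) ×
    (∃[ s ] Σ[ m ∈ (Fin s → ℕ) ]
    Plücker (OrbitClosure X) ≅ ProjectiveSpaces m)
-- Decisions are made about propositions in `Set`; `Lift` moves them to the level at which excluded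
-- middle is assumed.
theoremA em n k _ _ X = SmoothOrbitClosures.smooth-orbit-closure
  (ComplexField.complexField (λ P → map′ Level.lower Level.lift (em {Level.Lift (Level.suc 0ℓ) P}))) n k X
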